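{- Let $p$ be a prime, let $a$ be a positive integer, let $l,n\in\mathbb{N}$, $r\in\mathbb{Z}$ and $s,t\in\{0,\ldots,p^{a-1}-1\}$. Let $m\in\mathbb{N}$ with $m\equiv-n\pmod p$. Suppose one of the following holds: (i) $a=1$, or $p\mid n$, or $p-1\nmid n-l-1$; (ii) $\lfloor s/p^{a-2}\rfloor=2\lfloor t/p^{a-2}\rfloor$ and $p\ne2$; (iii) $\lfloor s/p^{a-2}\rfloor=\lfloor t/p^{a-2}\rfloor=p-1$. Then $$(-1)^{l+t-1}F^{(l)}_{p^a}(p^{a-1}n+s,\,p^{a-1}r+t)\equiv[\![n>l]\!]\binom st\binom{\lfloor(n-l-1)/(p-1)\rfloor}{l}\,(n-l)_*!\,B^{(m)}_{(n-l)^*}(-r)\pmod p.$$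
   Context: For a prime $p$, $a\in\mathbb{Z}^+$, $l,n\in\mathbb{N}$ and $r\in\mathbb{Z}$, the extended Fleck quotient is $$F^{(l)}_{p^a}(n,r)=(-p)^{ -\lfloor (n-lp^a-p^{a-1})/\varphi(p^a)\rfloor}\sum_{k\equiv r\,(\mathrm{mod}\ p^a)}\binom nk(-1)^k\binom{(k-r)/p^a}{l},$$ which is an integer ($\varphi$ is Euler's totient function). $[\![A]\!]$ is $1$ if $A$ holds and $0$ otherwise. For an integer $x$, $x_*$ denotes the smallest positive residue of $x$ modulo $p-1$ and $x^*$ the least nonnegative residue of $-x$ modulo $p-1$. For $m\in\mathbb{N}$ the $m$th order Bernoulli polynomials are given by $\frac{x^me^{tx}}{(e^x-1)^m}=\sum_{k\ge0}B^{(m)}_k(t)\frac{x^k}{k!}$. Congruences between rationals modulo $p$ mean the difference divided by $p$ is a $p$-adic integer. -}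

module Defs where

open import Data.Nat as N using (ℕ; zero; suc; NonZero)
open import Data.Nat.Properties using (m^n≢0; _!≢0)
open import Data.Nat.Divisibility as ND using ()
open import Data.Nat.Coprimality using (coprime?)
open import Data.Nat.Combinatorics using (_C_)
open import Data.Nat.Base using (_!)
open import Data.Nat.Properties using ()
open import Data.Integer as Z using (ℤ; +_; -[1+_])
open import Data.Rational as Q using (ℚ; 0ℚ; 1ℚ)
open import Data.Bool using (Bool; true; false; if_then_else_)
open import Data.List using (List; []; _∷_; length; filter; upTo; map; applyUpTo)
open import Relation.Nullary using (¬_; Dec; yes; no)
open import Relation.Nullary.Decidable using (⌊_⌋)

ℤtoℚ : ℤ → ℚ
ℤtoℚ z = z Q./ 1

ℕtoℚ : ℕ → ℚ
ℕtoℚ k = (+ k) Q./ 1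

powℚ : ℚ → ℕ → ℚ
powℚ x zero    = 1ℚ
powℚ x (suc k) = x Q.* powℚ x k

sgn : ℕ → ℚ
sgn k = powℚ (Q.- 1ℚ) k

sumTo : ℕ → (ℕ → ℚ) → ℚ
sumTo zero    f = f 0
sumTo (suc N) f = sumTo N f Q.+ f (suc N)

iv : {A : Set} → Dec A → ℚ
iv (yes _) = 1ℚ
iv (no _)  = 0ℚ

binomℚ : ℚ → ℕ → ℚ
binomℚ x zero    = 1ℚ
binomℚ x (suc l) = binomℚ x l Q.* (x Q.- ℕtoℚ l) Q.* ((+ 1) Q./ suc l)

fdiv : ℤ → ℕ → ℤ
fdiv x zero    = + 0
fdiv x (suc d) = x Z./ℕ suc d

fmod : ℤ → ℕ → ℕ
fmod x zero    = 0
fmod x (suc d) = x Z.%ℕ suc d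

_//_ : ℕ → ℕ → ℕ
x // zero  = 0
x // suc d = x N./ suc d

negPowℤ : ℕ → ℤ → ℚ
negPowℤ p (+ k)         = powℚ (Q.- ℕtoℚ p) k
negPowℤ zero -[1+ j ]   = 0ℚ
negPowℤ (suc q) -[1+ j ] =
  sgn (suc j) Q.* ((+ 1) Q./ (suc q N.^ suc j))
  where instance _ = m^n≢0 (suc q) (suc j)

totient : ℕ → ℕ
totient N = length (filter (λ k → coprime? k N) (applyUpTo suc N))

fleckSum : (p a l n : ℕ) → ℤ → ℚ
fleckSum p a l n r =
  sumTo n (λ k → iv (fmod ((+ k) Z.- r) (p N.^ a) N.≟ 0)
                  Q.* ℕtoℚ (n C k) Q.* sgn k
                  Q.* binomℚ (ℤtoℚ (fdiv ((+ k) Z.- r) (p N.^ a))) l)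

fleckExp : (p a l n : ℕ) → ℤ
fleckExp p a l n =
  fdiv ((+ n) Z.- (+ (l N.* p N.^ a)) Z.- (+ (p N.^ (a N.∸ 1)))) (totient (p N.^ a))

F : (p a l n : ℕ) → ℤ → ℚ
F p a l n r = negPowℤ p (Z.- fleckExp p a l n) Q.* fleckSum p a l n r

-- x_* : smallest positive residue of x modulo p-1
lowStar : ℕ → ℤ → ℕ
lowStar p x = suc (fmod (x Z.- (+ 1)) (p N.∸ 1))

upStar : ℕ → ℤ → ℕ
upStar p x = fmod (Z.- x) (p N.∸ 1)

Series : Set
Series = ℕ → ℚ

mulS : Series → Series → Series
mulS f g k = sumTo k (λ j → f j Q.* g (k N.∸ j))

powS : Series → ℕ → Series
powS f zero    zero    = 1ℚ
powS f zero    (suc k) = 0ℚ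
powS f (suc m) = mulS f (powS f m)

-- inverse of a series with constant term 1:
-- g 0 = 1,  g k = - Σ_{j=1}^{k} f j * g (k - j)
-- invList f k = [g k, g (k-1), ..., g 0]
invList : Series → ℕ → List ℚ
invList f zero    = 1ℚ ∷ []
invList f (suc k) = Q.- dot 0 gs ∷ gs
  where
  gs = invList f k
  dot : ℕ → List ℚ → ℚ
  dot i []       = 0ℚ
  dot i (g ∷ hs) = f (suc i) Q.* g Q.+ dot (suc i) hs

headℚ : List ℚ → ℚ
headℚ []      = 0ℚ
headℚ (x ∷ _) = x

invS : Series → Series
invS f k = headℚ (invList f k)

expm1OverX : Series
expm1OverX k = (+ 1) Q./ (suc k !)
  where instance _ = (suc k) !≢0

expS : ℚ → Series
expS t k = powℚ t k Q.* ((+ 1) Q./ (k !))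
  where instance _ = k !≢0

-- m-th order Bernoulli polynomial, defined by the generating function
--   x^m e^{t x} / (e^x - 1)^m = Σ_k B^{(m)}_k(t) x^k / k!
-- i.e. B^{(m)}_k(t) = k! · [x^k] ( e^{t x} · ((e^x - 1)/x)^{-m} )
bernoulliPoly : ℕ → ℕ → ℚ → ℚ
bernoulliPoly m k t = ℕtoℚ (k !) Q.* mulS (expS t) (powS (invS expm1OverX) m) k

-- Congruence modulo p for rationals: (x - y)/p is a p-adic integer,
-- i.e. p does not divide the (reduced) denominator of (x - y)/p.

IsPAdicInt : ℕ → ℚ → Set
IsPAdicInt p q = ¬ (p ND.∣ Q.ℚ.denominatorℕ q)

_≡_[modℚ_] : ℚ → ℚ → ℕ → Set
x ≡ y [modℚ p ] = IsPAdicInt p ((x Q.- y) Q.* invℕ p)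
  where
  invℕ : ℕ → ℚ
  invℕ zero    = 0ℚ
  invℕ (suc q) = (+ 1) Q./ suc q

-- For fixed p^a and l put e_l(r) = [p^a | r] binom(-r/p^a, l). With σ the shift f ↦ f(· - 1) and Δ = 1 - σ, the sum in the
-- Fleck quotient is (Δ^n e_l)(r), while (1 - σ^(p^a)) e_l = - e_(l-1).
--
-- For a = 1, the relation Δ^p = 1 - σ^p + p Δ h expresses Δ^(p+n) e_l through Δ^n e_(l-1) and p h Δ^(n+1) e_l. It yields the
-- divisibility of Δ^n e_l by the expected power p^j, and determines Δ^n e_l / p^j modulo p by recursion. The coefficients
-- c_(n,k)(r) of x^k in e^(-rx) ((e^x - 1)/x)^n satisfy Δ c_(n,k+1) = - c_(n+1,k), and by a Taylor expansion
-- (1 - σ^p) c_(n,k+1) ≡ - p c_(n,k) modulo p²; so they solve the same recursion, which starts with Fermat's little theorem.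
-- Because ((e^x - 1)/x)^p ≡ 1 modulo p below degree p - 1, c_(n,k)(r) is congruent to B^(m)_k(-r)/k! when m ≡ - n.
--
-- For a = b + 1 with b > 0, write Δ^(p^b) = A + pD with A = 1 - σ^(p^b). In Δ^s (A + pD)^n the term Δ^s A^n gives the product of
-- (-1)^t binom(s, t) and the sum for a = 1, all terms beyond the first order in pD are negligible, and each of the
-- hypotheses (i), (ii), (iii) makes the first-order term n p D A^(n-1) negligible; under (ii) it is odd under a reflection.
module Submission where

open import Defs
open import Data.Nat as N using (ℕ; zero; suc)
open import Data.Nat.Primality using (Prime)

-- The exponent in the Fleck quotient is a weight count. Let `Δ` have weight one and a factor `p`
-- weight `p - 1`, while each lowering of `l` uses weight `p`. For a = 1 the floor is then the
-- number of factors `p` that `Δ^n` can pay for, and the remainder of `n - l - 1` modulo `p - 1`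
-- fixes which coefficient c occurs; its degree stays below `p - 1`, where all factorials involved
-- are prime to `p`. The same count shows the obstacle for a > 1. Trading one `A` for `pD` loses
-- weight one and gains one `p`. If `p - 1` divides `n - l - 1`, the lost `A` costs a whole factor
-- `p`, the gain only restores it, and the congruence needs one factor more. Under (i) this factor
-- comes from `n` or from spare weight. Under (iii) the leading digit of `s` completes a p-th power,
-- which is another `A` modulo `p`. Under (ii) the term is, up to the required precision, a multiple
-- of a difference of the indicator of the multiples of `p`, taken at a centre of symmetry. For p =
-- 2 the second-order terms fall short as well, and the square of `D` has to be examined.

-- Arithmetic in ℚ: embedded integers, powers, finite sums, generalised binomial coefficients

module Rationals where

  import Data.Nat.Properties as NP
  open import Data.Integer as Z using (ℤ)
  import Data.Integer.Properties as ZP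
  open import Data.Rational as Q using (ℚ; 0ℚ; 1ℚ; _+_; _*_; _-_; -_)
  import Data.Rational.Properties as QP
  open import Data.Rational.Unnormalised as U using (mkℚᵘ; *≡*)
  import Data.Rational.Unnormalised.Properties as UP
  open import Data.Maybe using (Maybe)
  open import Relation.Nullary.Decidable using (dec⇒maybe)
  open import Tactic.RingSolver using (solve-∀)
  open import Tactic.RingSolver.Core.AlmostCommutativeRing using (AlmostCommutativeRing; fromCommutativeRing)
  open import Level using (0ℓ)
  open import Data.Product using (∃; _,_)
  open import Function using (_∘_)
  open import Relation.Binary.PropositionalEquality

  private
    0≟ : (x : ℚ) → Maybe (0ℚ ≡ x)
    0≟ x = dec⇒maybe (0ℚ QP.≟ x)

  ℚ-ring : AlmostCommutativeRing 0ℓ 0ℓ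
  ℚ-ring = fromCommutativeRing QP.+-*-commutativeRing 0≟

  private
    -- Forming `z / 1` normalises by a gcd, which is stuck on a variable numerator. The equation is
    -- therefore compared on unnormalised fractions, where only numerators matter.
    /1-homo : ∀ a b c (_∙_ : ℚ → ℚ → ℚ) (_∙ᵘ_ : U.ℚᵘ → U.ℚᵘ → U.ℚᵘ) →
              (∀ x y → Q.toℚᵘ (x ∙ y) U.≃ (Q.toℚᵘ x ∙ᵘ Q.toℚᵘ y)) →
              (∀ {x y u v} → x U.≃ y → u U.≃ v → (x ∙ᵘ u) U.≃ (y ∙ᵘ v)) →
              mkℚᵘ c 0 U.≃ (mkℚᵘ a 0 ∙ᵘ mkℚᵘ b 0) →
              ℤtoℚ c ≡ ℤtoℚ a ∙ ℤtoℚ b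
    /1-homo a b c _∙_ _∙ᵘ_ homo ∙-cong e = QP.toℚᵘ-injective
      (UP.≃-trans (QP.toℚᵘ-fromℚᵘ (mkℚᵘ c 0))
      (UP.≃-trans e
      (UP.≃-sym (UP.≃-trans (homo (ℤtoℚ a) (ℤtoℚ b))
        (∙-cong (QP.toℚᵘ-fromℚᵘ (mkℚᵘ a 0)) (QP.toℚᵘ-fromℚᵘ (mkℚᵘ b 0)))))))

  ℤtoℚ-+ : ∀ a b → ℤtoℚ (a Z.+ b) ≡ ℤtoℚ a + ℤtoℚ b
  ℤtoℚ-+ a b = /1-homo a b (a Z.+ b) _+_ U._+_ QP.toℚᵘ-homo-+ UP.+-cong
    (*≡* (trans (ZP.*-identityʳ (a Z.+ b)) (trans (cong₂ Z._+_ (sym (ZP.*-identityʳ a)) (sym (ZP.*-identityʳ b)))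
      (sym (ZP.*-identityʳ _)))))

  ℤtoℚ-* : ∀ a b → ℤtoℚ (a Z.* b) ≡ ℤtoℚ a * ℤtoℚ b
  ℤtoℚ-* a b = /1-homo a b (a Z.* b) _*_ U._*_ QP.toℚᵘ-homo-* UP.*-cong (*≡* refl)

  ℤtoℚ-neg : ∀ a → ℤtoℚ (Z.- a) ≡ - ℤtoℚ a
  ℤtoℚ-neg (Z.+ zero) = refl
  ℤtoℚ-neg (Z.+ suc n) = refl
  ℤtoℚ-neg Z.-[1+ n ] = neg-neg (ℤtoℚ (Z.+ suc n))
    where
    neg-neg : ∀ x → x ≡ - (- x)
    neg-neg = solve-∀ ℚ-ring

  ℤtoℚ-- : ∀ a b → ℤtoℚ (a Z.- b) ≡ ℤtoℚ a - ℤtoℚ b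
  ℤtoℚ-- a b = trans (ℤtoℚ-+ a (Z.- b)) (cong (ℤtoℚ a +_) (ℤtoℚ-neg b))

  ℤtoℚ-injective : ∀ {a b} → ℤtoℚ a ≡ ℤtoℚ b → a ≡ b
  ℤtoℚ-injective {a} {b} e with QP.fromℚᵘ-injective {mkℚᵘ a 0} {mkℚᵘ b 0} e
  ... | *≡* e′ = trans (sym (ZP.*-identityʳ a)) (trans e′ (ZP.*-identityʳ b))

  ℕtoℚ-+ : ∀ a b → ℕtoℚ (a N.+ b) ≡ ℕtoℚ a + ℕtoℚ b
  ℕtoℚ-+ a b = trans (cong ℤtoℚ (ZP.pos-+ a b)) (ℤtoℚ-+ (Z.+ a) (Z.+ b))

  ℕtoℚ-* : ∀ a b → ℕtoℚ (a N.* b) ≡ ℕtoℚ a * ℕtoℚ b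
  ℕtoℚ-* a b = trans (cong ℤtoℚ (ZP.pos-* a b)) (ℤtoℚ-* (Z.+ a) (Z.+ b))

  ℕtoℚ-suc : ∀ a → ℕtoℚ (suc a) ≡ 1ℚ + ℕtoℚ a
  ℕtoℚ-suc = ℕtoℚ-+ 1

  ℕtoℚ-^ : ∀ a k → ℕtoℚ (a N.^ k) ≡ powℚ (ℕtoℚ a) k
  ℕtoℚ-^ a zero = refl
  ℕtoℚ-^ a (suc k) = trans (ℕtoℚ-* a (a N.^ k)) (cong (ℕtoℚ a *_) (ℕtoℚ-^ a k))

  inv : (n : ℕ) .{{_ : N.NonZero n}} → ℚ
  inv n = (Z.+ 1) Q./ n

  inv-* : ∀ n .{{_ : N.NonZero n}} → inv n * ℕtoℚ n ≡ 1ℚ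
  inv-* (suc n) = QP.toℚᵘ-injective (UP.≃-trans (QP.toℚᵘ-homo-* (inv (suc n)) (ℕtoℚ (suc n)))
    (UP.≃-trans (UP.*-cong (QP.toℚᵘ-fromℚᵘ (mkℚᵘ (Z.+ 1) n)) (QP.toℚᵘ-fromℚᵘ (mkℚᵘ (Z.+ suc n) 0)))
    (*≡* (cong (λ x → Z.+ suc x) (trans (trans (NP.*-identityʳ _) (NP.+-identityʳ n))
       (sym (trans (NP.+-identityʳ _) (trans (NP.*-identityʳ n) refl))))))))

  *-cancel : ∀ n .{{_ : N.NonZero n}} {x y} → x * ℕtoℚ n ≡ y * ℕtoℚ n → x ≡ y
  *-cancel n {x} {y} e = begin
    x ≡⟨ ins x (inv n) (ℕtoℚ n) (inv-* n) ⟩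
    inv n * (x * ℕtoℚ n) ≡⟨ cong (inv n *_) e ⟩
    inv n * (y * ℕtoℚ n) ≡⟨ sym (ins y (inv n) (ℕtoℚ n) (inv-* n)) ⟩
    y ∎
    where
    open ≡-Reasoning
    ins : ∀ x i n → i * n ≡ 1ℚ → x ≡ i * (x * n)
    ins x i n e = trans (sym (QP.*-identityʳ x)) (trans (cong (x *_) (sym e)) (r x i n))
      where
      r : ∀ x i n → x * (i * n) ≡ i * (x * n)
      r = solve-∀ ℚ-ring

  powℚ-+ : ∀ x a b → powℚ x (a N.+ b) ≡ powℚ x a * powℚ x b
  powℚ-+ x zero b = sym (QP.*-identityˡ _)
  powℚ-+ x (suc a) b = trans (cong (x *_) (powℚ-+ x a b)) (sym (QP.*-assoc x (powℚ x a) (powℚ x b)))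

  powℚ-* : ∀ x y k → powℚ (x * y) k ≡ powℚ x k * powℚ y k
  powℚ-* x y zero = refl
  powℚ-* x y (suc k) = trans (cong (x * y *_) (powℚ-* x y k)) (r x y (powℚ x k) (powℚ y k))
    where
    r : ∀ x y a b → x * y * (a * b) ≡ x * a * (y * b)
    r = solve-∀ ℚ-ring

  powℚ-1 : ∀ k → powℚ 1ℚ k ≡ 1ℚ
  powℚ-1 zero = refl
  powℚ-1 (suc k) = trans (QP.*-identityˡ _) (powℚ-1 k)

  powℚ-neg : ∀ x k → powℚ (- x) k ≡ sgn k * powℚ x k
  powℚ-neg x k = trans (cong (λ y → powℚ y k) (r x)) (powℚ-* (- 1ℚ) x k)
    where
    r : ∀ x → - x ≡ - 1ℚ * x
    r = solve-∀ ℚ-ring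

  sgn-+ : ∀ a b → sgn (a N.+ b) ≡ sgn a * sgn b
  sgn-+ = powℚ-+ (- 1ℚ)

  sgn-double : ∀ k → sgn (k N.+ k) ≡ 1ℚ
  sgn-double k = trans (sgn-+ k k) (trans (sym (powℚ-* (- 1ℚ) (- 1ℚ) k)) (powℚ-1 k))

  sgn² : ∀ k → sgn k * sgn k ≡ 1ℚ
  sgn² k = trans (sym (sgn-+ k k)) (sgn-double k)

  sumTo-cong : ∀ n {f g : ℕ → ℚ} → (∀ i → i N.≤ n → f i ≡ g i) → sumTo n f ≡ sumTo n g
  sumTo-cong zero h = h 0 N.z≤n
  sumTo-cong (suc n) h = cong₂ _+_ (sumTo-cong n (λ i i≤n → h i (NP.m≤n⇒m≤1+n i≤n))) (h (suc n) NP.≤-refl)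

  sumTo-+ : ∀ n (f g : ℕ → ℚ) → sumTo n (λ i → f i + g i) ≡ sumTo n f + sumTo n g
  sumTo-+ zero f g = refl
  sumTo-+ (suc n) f g = trans (cong (_+ (f (suc n) + g (suc n))) (sumTo-+ n f g)) (r (sumTo n f) (sumTo n g) (f (suc n)) (g (suc n)))
    where
    r : ∀ a b c d → a + b + (c + d) ≡ a + c + (b + d)
    r = solve-∀ ℚ-ring

  sumTo-*ˡ : ∀ n c (f : ℕ → ℚ) → sumTo n (λ i → c * f i) ≡ c * sumTo n f
  sumTo-*ˡ zero c f = refl
  sumTo-*ˡ (suc n) c f = trans (cong (_+ c * f (suc n)) (sumTo-*ˡ n c f)) (sym (QP.*-distribˡ-+ c (sumTo n f) (f (suc n))))

  sumTo-first : ∀ n (f : ℕ → ℚ) → sumTo (suc n) f ≡ f 0 + sumTo n (f ∘ suc)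
  sumTo-first zero f = refl
  sumTo-first (suc n) f = trans (cong (_+ f (suc (suc n))) (sumTo-first n f)) (QP.+-assoc (f 0) (sumTo n (f ∘ suc)) (f (suc (suc n))))

  binomℚ-suc : ∀ x l → binomℚ x (suc l) * ℕtoℚ (suc l) ≡ binomℚ x l * (x - ℕtoℚ l)
  binomℚ-suc x l = trans (QP.*-assoc (binomℚ x l * (x - ℕtoℚ l)) (inv (suc l)) (ℕtoℚ (suc l))) (trans (cong (binomℚ x l * (x - ℕtoℚ l) *_) (inv-* (suc l))) (QP.*-identityʳ _))

  -- Both sides are (1 + x) x (x - 1) ... (x - l + 1) / l!, with the last or the first factor split
  -- off. The definition of `binomℚ` varies only the lower index, so this is the route to Pascal's
  -- rule.
  binomℚ-shift : ∀ x l → binomℚ (1ℚ + x) l * (1ℚ + x - ℕtoℚ l) ≡ binomℚ x l * (1ℚ + x)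
  binomℚ-shift x zero = r x
    where
    r : ∀ x → 1ℚ * (1ℚ + x - 0ℚ) ≡ 1ℚ * (1ℚ + x)
    r = solve-∀ ℚ-ring
  binomℚ-shift x (suc l) = *-cancel (suc l) (begin
    binomℚ (1ℚ + x) (suc l) * (1ℚ + x - ℕtoℚ (suc l)) * ℕtoℚ (suc l)
      ≡⟨ r₁ (binomℚ (1ℚ + x) (suc l)) (1ℚ + x - ℕtoℚ (suc l)) (ℕtoℚ (suc l)) ⟩
    binomℚ (1ℚ + x) (suc l) * ℕtoℚ (suc l) * (1ℚ + x - ℕtoℚ (suc l))
      ≡⟨ cong₂ (λ a b → a * (1ℚ + x - b)) (binomℚ-suc (1ℚ + x) l) (ℕtoℚ-suc l) ⟩
    binomℚ (1ℚ + x) l * (1ℚ + x - ℕtoℚ l) * (1ℚ + x - (1ℚ + ℕtoℚ l))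
      ≡⟨ cong₂ _*_ (binomℚ-shift x l) (r₂ x (ℕtoℚ l)) ⟩
    binomℚ x l * (1ℚ + x) * (x - ℕtoℚ l)
      ≡⟨ r₁ (binomℚ x l) (1ℚ + x) (x - ℕtoℚ l) ⟩
    binomℚ x l * (x - ℕtoℚ l) * (1ℚ + x)
      ≡⟨ cong (_* (1ℚ + x)) (sym (binomℚ-suc x l)) ⟩
    binomℚ x (suc l) * ℕtoℚ (suc l) * (1ℚ + x)
      ≡⟨ r₁ (binomℚ x (suc l)) (ℕtoℚ (suc l)) (1ℚ + x) ⟩
    binomℚ x (suc l) * (1ℚ + x) * ℕtoℚ (suc l) ∎)
    where
    open ≡-Reasoning
    r₁ : ∀ a b c → a * b * c ≡ a * c * b
    r₁ = solve-∀ ℚ-ring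
    r₂ : ∀ x l → 1ℚ + x - (1ℚ + l) ≡ x - l
    r₂ = solve-∀ ℚ-ring

  binomℚ-pascal : ∀ x l → binomℚ (1ℚ + x) (suc l) ≡ binomℚ x (suc l) + binomℚ x l
  binomℚ-pascal x l = *-cancel (suc l) (begin
    binomℚ (1ℚ + x) (suc l) * ℕtoℚ (suc l) ≡⟨ binomℚ-suc (1ℚ + x) l ⟩
    binomℚ (1ℚ + x) l * (1ℚ + x - ℕtoℚ l) ≡⟨ binomℚ-shift x l ⟩
    binomℚ x l * (1ℚ + x) ≡⟨ r (binomℚ x l) x (ℕtoℚ l) ⟩
    binomℚ x l * (x - ℕtoℚ l) + binomℚ x l * (1ℚ + ℕtoℚ l)
      ≡⟨ cong₂ (λ a b → a + binomℚ x l * b) (sym (binomℚ-suc x l)) (sym (ℕtoℚ-suc l)) ⟩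
    binomℚ x (suc l) * ℕtoℚ (suc l) + binomℚ x l * ℕtoℚ (suc l) ≡⟨ sym (QP.*-distribʳ-+ (ℕtoℚ (suc l)) (binomℚ x (suc l)) (binomℚ x l)) ⟩
    (binomℚ x (suc l) + binomℚ x l) * ℕtoℚ (suc l) ∎)
    where
    open ≡-Reasoning
    r : ∀ b x l → b * (1ℚ + x) ≡ b * (x - l) + b * (1ℚ + l)
    r = solve-∀ ℚ-ring

  binomℚ-0 : ∀ l → binomℚ 0ℚ (suc l) ≡ 0ℚ
  binomℚ-0 zero = refl
  binomℚ-0 (suc l) = trans (cong (λ b → b * (0ℚ - ℕtoℚ (suc l)) * inv (suc (suc l))) (binomℚ-0 l))
    (r (0ℚ - ℕtoℚ (suc l)) (inv (suc (suc l))))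
    where
    r : ∀ a b → 0ℚ * a * b ≡ 0ℚ
    r = solve-∀ ℚ-ring

  binomℚ-<≡0 : ∀ n l → n N.< l → binomℚ (ℕtoℚ n) l ≡ 0ℚ
  binomℚ-<≡0 zero (suc l) _ = binomℚ-0 l
  binomℚ-<≡0 (suc n) (suc l) (N.s≤s n<l) = trans (cong (λ x → binomℚ x (suc l)) (ℕtoℚ-suc n))
    (trans (binomℚ-pascal (ℕtoℚ n) l) (cong₂ _+_ (binomℚ-<≡0 n (suc l) (NP.m<n⇒m<1+n n<l)) (binomℚ-<≡0 n l n<l)))

  integer-induction : (P : ℤ → Set) → P (Z.+ 0) → (∀ z → P z → P (Z.suc z)) → (∀ z → P (Z.suc z) → P z) → ∀ z → P z
  integer-induction P p₀ up down (Z.+ zero) = p₀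
  integer-induction P p₀ up down (Z.+ suc n) = up (Z.+ n) (integer-induction P p₀ up down (Z.+ n))
  integer-induction P p₀ up down Z.-[1+ zero ] = down Z.-[1+ 0 ] p₀
  integer-induction P p₀ up down Z.-[1+ suc n ] = down Z.-[1+ suc n ] (integer-induction P p₀ up down Z.-[1+ n ])

  -- Negative arguments do occur, as quotients by the modulus. Pascal's rule, read upwards and
  -- downwards, reaches them all from binom(0, l + 1) = 0.
  binomℚ-integer : ∀ l z → ∃ λ u → binomℚ (ℤtoℚ z) l ≡ ℤtoℚ u
  binomℚ-integer zero z = Z.+ 1 , refl
  binomℚ-integer (suc l) = integer-induction (λ z → ∃ λ u → binomℚ (ℤtoℚ z) (suc l) ≡ ℤtoℚ u)
    (Z.+ 0 , binomℚ-0 l)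
    (λ z (u , e) → let v , e′ = binomℚ-integer l z in
      u Z.+ v , trans (pascal z) (trans (cong₂ _+_ e e′) (sym (ℤtoℚ-+ u v))))
    (λ z (u , e) → let v , e′ = binomℚ-integer l z in
      u Z.- v , trans (r (binomℚ (ℤtoℚ z) (suc l)) (binomℚ (ℤtoℚ z) l))
        (trans (cong₂ _-_ (trans (sym (pascal z)) e) e′) (sym (ℤtoℚ-- u v))))
    where
    pascal : ∀ z → binomℚ (ℤtoℚ (Z.suc z)) (suc l) ≡ binomℚ (ℤtoℚ z) (suc l) + binomℚ (ℤtoℚ z) l
    pascal z = trans (cong (λ x → binomℚ x (suc l)) (ℤtoℚ-+ (Z.+ 1) z)) (binomℚ-pascal (ℤtoℚ z) l)
    r : ∀ a b → a ≡ a + b - b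
    r = solve-∀ ℚ-ring

-- Rationals integral at p, and divisibility by powers of p

module Valuation (p : ℕ) (p-prime : Prime p) where

  open Rationals
  import Data.Nat.Properties as NP
  import Data.Nat.Divisibility as ND
  open import Data.Nat.Primality using (euclidsLemma; prime⇒nonTrivial; prime⇒nonZero)
  open import Data.Nat.Coprimality as Coprime using ()
  open import Data.Integer as Z using (ℤ)
  import Data.Integer.Properties as ZP
  open import Data.Rational as Q using (ℚ; 0ℚ; 1ℚ; _+_; _*_; _-_; -_)
  import Data.Rational.Properties as QP
  open import Data.Rational.Unnormalised as U using (mkℚᵘ; *≡*)
  import Data.Rational.Unnormalised.Properties as UP
  open import Data.Sum using (inj₁; inj₂)
  open import Relation.Nullary using (¬_)
  open import Tactic.RingSolver using (solve-∀)
  open import Relation.Binary.PropositionalEquality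

  instance
    p≢0 : N.NonZero p
    p≢0 = prime⇒nonZero p-prime

  1<p : 1 N.< p
  1<p = N.nonTrivial⇒n>1 p {{prime⇒nonTrivial p-prime}}

  P : ℚ
  P = ℕtoℚ p

  -- The localisation of ℤ at `p`. Any denominator prime to `p` is accepted, reduced or not, so that
  -- closure under sums and products needs no gcd.
  record Integral (x : ℚ) : Set where
    constructor integral
    field
      denom : ℕ
      numer : ℤ
      p∤denom : ¬ (p ND.∣ denom)
      clear : x * ℕtoℚ denom ≡ ℤtoℚ numer

  p∤1 : ¬ (p ND.∣ 1)
  p∤1 p∣1 = NP.<-irrefl (sym (ND.∣1⇒≡1 p∣1)) 1<p

  p∤* : ∀ {d e} → ¬ (p ND.∣ d) → ¬ (p ND.∣ e) → ¬ (p ND.∣ d N.* e)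
  p∤* {d} {e} p∤d p∤e p∣de with euclidsLemma d e p-prime p∣de
  ... | inj₁ p∣d = p∤d p∣d
  ... | inj₂ p∣e = p∤e p∣e

  int-ℤ : ∀ z → Integral (ℤtoℚ z)
  int-ℤ z = integral 1 z p∤1 (QP.*-identityʳ (ℤtoℚ z))

  int-ℕ : ∀ n → Integral (ℕtoℚ n)
  int-ℕ n = int-ℤ (Z.+ n)

  int-+ : ∀ {x y} → Integral x → Integral y → Integral (x + y)
  int-+ {x} {y} (integral d u p∤d e) (integral d′ u′ p∤d′ e′) =
    integral (d N.* d′) (u Z.* Z.+ d′ Z.+ u′ Z.* Z.+ d) (p∤* p∤d p∤d′) (begin
      (x + y) * ℕtoℚ (d N.* d′) ≡⟨ cong ((x + y) *_) (ℕtoℚ-* d d′) ⟩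
      (x + y) * (ℕtoℚ d * ℕtoℚ d′) ≡⟨ r x y (ℕtoℚ d) (ℕtoℚ d′) ⟩
      x * ℕtoℚ d * ℕtoℚ d′ + y * ℕtoℚ d′ * ℕtoℚ d ≡⟨ cong₂ (λ a b → a * ℕtoℚ d′ + b * ℕtoℚ d) e e′ ⟩
      ℤtoℚ u * ℕtoℚ d′ + ℤtoℚ u′ * ℕtoℚ d ≡⟨ cong₂ _+_ (ℤtoℚ-* u (Z.+ d′)) (ℤtoℚ-* u′ (Z.+ d)) ⟨
      ℤtoℚ (u Z.* Z.+ d′) + ℤtoℚ (u′ Z.* Z.+ d) ≡⟨ ℤtoℚ-+ (u Z.* Z.+ d′) (u′ Z.* Z.+ d) ⟨
      ℤtoℚ (u Z.* Z.+ d′ Z.+ u′ Z.* Z.+ d) ∎)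
    where
    open ≡-Reasoning
    r : ∀ x y d e → (x + y) * (d * e) ≡ x * d * e + y * e * d
    r = solve-∀ ℚ-ring

  int-* : ∀ {x y} → Integral x → Integral y → Integral (x * y)
  int-* {x} {y} (integral d u p∤d e) (integral d′ u′ p∤d′ e′) =
    integral (d N.* d′) (u Z.* u′) (p∤* p∤d p∤d′) (begin
      x * y * ℕtoℚ (d N.* d′) ≡⟨ cong (x * y *_) (ℕtoℚ-* d d′) ⟩
      x * y * (ℕtoℚ d * ℕtoℚ d′) ≡⟨ r x y (ℕtoℚ d) (ℕtoℚ d′) ⟩
      x * ℕtoℚ d * (y * ℕtoℚ d′) ≡⟨ cong₂ _*_ e e′ ⟩
      ℤtoℚ u * ℤtoℚ u′ ≡⟨ ℤtoℚ-* u u′ ⟨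
      ℤtoℚ (u Z.* u′) ∎)
    where
    open ≡-Reasoning
    r : ∀ x y d e → x * y * (d * e) ≡ x * d * (y * e)
    r = solve-∀ ℚ-ring

  int-inv : ∀ n .{{_ : N.NonZero n}} → ¬ (p ND.∣ n) → Integral (inv n)
  int-inv n p∤n = integral n (Z.+ 1) p∤n (inv-* n)

  int-pow : ∀ {x} → Integral x → ∀ k → Integral (powℚ x k)
  int-pow i zero = int-ℕ 1
  int-pow i (suc k) = int-* i (int-pow i k)

  int-neg : ∀ {x} → Integral x → Integral (- x)
  int-neg {x} i = subst Integral (r x) (int-* (int-ℤ Z.-[1+ 0 ]) i)
    where
    r : ∀ x → - 1ℚ * x ≡ - x
    r = solve-∀ ℚ-ring

  int-sgn : ∀ k → Integral (sgn k)
  int-sgn = int-pow (int-ℤ Z.-[1+ 0 ])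

  infix 4 _≼_

  -- Lower bounds for the p-adic valuation, phrased as divisibility so that zero is no exception.
  record _≼_ (k : ℕ) (x : ℚ) : Set where
    constructor multiple
    field
      quotient : ℚ
      quotient-integral : Integral quotient
      equality : x ≡ powℚ P k * quotient

  ≼-resp : ∀ {k x y} → x ≡ y → k ≼ x → k ≼ y
  ≼-resp refl d = d

  ≼-+ : ∀ {k x y} → k ≼ x → k ≼ y → k ≼ x + y
  ≼-+ {k} (multiple u i refl) (multiple v j refl) = multiple (u + v) (int-+ i j) (sym (QP.*-distribˡ-+ (powℚ P k) u v))

  ≼-* : ∀ {k l x y} → k ≼ x → l ≼ y → k N.+ l ≼ x * y
  ≼-* {k} {l} (multiple u i refl) (multiple v j refl) = multiple (u * v) (int-* i j)
    (trans (r (powℚ P k) u (powℚ P l) v) (cong (_* (u * v)) (sym (powℚ-+ P k l))))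
    where
    r : ∀ a u b v → a * u * (b * v) ≡ a * b * (u * v)
    r = solve-∀ ℚ-ring

  ≼-int : ∀ {x} → Integral x → 0 ≼ x
  ≼-int {x} i = multiple x i (sym (QP.*-identityˡ x))

  int-≼ : ∀ {x} → 0 ≼ x → Integral x
  int-≼ (multiple q i refl) = subst Integral (sym (QP.*-identityˡ q)) i

  ≼-*ʳ : ∀ {k x y} → Integral x → k ≼ y → k ≼ x * y
  ≼-*ʳ i d = ≼-* (≼-int i) d

  ≼-*ˡ : ∀ {k x y} → k ≼ x → Integral y → k ≼ x * y
  ≼-*ˡ {k} {x} {y} d i = ≼-resp (QP.*-comm y x) (≼-*ʳ i d)

  ≼-neg : ∀ {k x} → k ≼ x → k ≼ - x
  ≼-neg {k} {x} d = ≼-resp (r x) (≼-*ʳ (int-ℤ Z.-[1+ 0 ]) d)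
    where
    r : ∀ x → - 1ℚ * x ≡ - x
    r = solve-∀ ℚ-ring

  ≼-- : ∀ {k x y} → k ≼ x → k ≼ y → k ≼ x - y
  ≼-- d e = ≼-+ d (≼-neg e)

  ≼-P^ : ∀ k → k ≼ powℚ P k
  ≼-P^ k = multiple 1ℚ (int-ℕ 1) (sym (QP.*-identityʳ (powℚ P k)))

  ≼-P : 1 ≼ P
  ≼-P = ≼-resp (QP.*-identityʳ P) (≼-P^ 1)

  ≼-0 : ∀ {k} → k ≼ 0ℚ
  ≼-0 {k} = multiple 0ℚ (int-ℕ 0) (sym (QP.*-zeroʳ (powℚ P k)))

  ≼-weaken : ∀ {k l x} → l N.≤ k → k ≼ x → l ≼ x
  ≼-weaken {k} {l} l≤k (multiple q i refl) = multiple (powℚ P (k N.∸ l) * q) (int-* (int-pow (int-ℕ p) (k N.∸ l)) i)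
    (trans (cong (λ m → powℚ P m * q) (sym (NP.m+[n∸m]≡n l≤k)))
    (trans (cong (_* q) (powℚ-+ P l (k N.∸ l))) (QP.*-assoc (powℚ P l) (powℚ P (k N.∸ l)) q)))

  ≼⇒integral : ∀ {k x} → k ≼ x → Integral x
  ≼⇒integral d = int-≼ (≼-weaken N.z≤n d)

  ≼-P* : ∀ {k x} → k ≼ x → suc k ≼ P * x
  ≼-P* d = ≼-* ≼-P d

  ≼-sum : ∀ {k} n (f : ℕ → ℚ) → (∀ i → i N.≤ n → k ≼ f i) → k ≼ sumTo n f
  ≼-sum zero f h = h 0 N.z≤n
  ≼-sum (suc n) f h = ≼-+ (≼-sum n f (λ i i≤n → h i (NP.m≤n⇒m≤1+n i≤n))) (h (suc n) NP.≤-refl)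

  ≼-ℕ : ∀ {n} → p ND.∣ n → 1 ≼ ℕtoℚ n
  ≼-ℕ (ND.divides q refl) = ≼-resp (trans (QP.*-comm P (ℕtoℚ q)) (sym (ℕtoℚ-* q p))) (≼-P* (≼-int (int-ℕ q)))

  ≼-unit : ∀ {k} n {x} → ¬ (p ND.∣ n) → k ≼ ℕtoℚ n * x → k ≼ x
  ≼-unit {k} zero p∤0 d with () ← p∤0 (p ND.∣0)
  ≼-unit {k} (suc n) {x} p∤n d = ≼-resp
    (trans (r (inv (suc n)) (ℕtoℚ (suc n)) x) (trans (cong (_* x) (inv-* (suc n))) (QP.*-identityˡ x)))
    (≼-*ʳ (int-inv (suc n) p∤n) d)
    where
    r : ∀ i n x → i * (n * x) ≡ i * n * x
    r = solve-∀ ℚ-ring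

  -- Cross multiplication and the coprimality of a reduced fraction show that the reduced
  -- denominator divides every other denominator, in particular one prime to `p`.
  integral⇒IsPAdicInt : ∀ {x} → Integral x → IsPAdicInt p x
  integral⇒IsPAdicInt {x@(Q.mkℚ n d-1 c)} (integral d u p∤d e) p∣den = p∤d (ND.∣-trans p∣den den∣d)
    where
    den = suc d-1
    cross : mkℚᵘ n d-1 U.* mkℚᵘ (Z.+ d) 0 U.≃ mkℚᵘ u 0
    cross = UP.≃-trans (UP.*-cong (UP.≃-refl {mkℚᵘ n d-1}) (UP.≃-sym (QP.toℚᵘ-fromℚᵘ (mkℚᵘ (Z.+ d) 0))))
      (UP.≃-trans (UP.≃-sym (QP.toℚᵘ-homo-* x (ℕtoℚ d)))
      (UP.≃-trans (UP.≃-reflexive (cong Q.toℚᵘ e)) (QP.toℚᵘ-fromℚᵘ (mkℚᵘ u 0))))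
    num*d : n Z.* Z.+ d ≡ u Z.* Z.+ den
    num*d with *≡* eq ← cross =
      trans (sym (ZP.*-identityʳ (n Z.* Z.+ d))) (trans eq (cong (λ m → u Z.* Z.+ m) (NP.*-identityʳ den)))
    den∣d : den ND.∣ d
    den∣d = Coprime.coprime-divisor (Coprime.sym (Coprime.recompute c))
      (ND.divides Z.∣ u ∣ (trans (sym (ZP.abs-* n (Z.+ d))) (trans (cong Z.∣_∣ num*d) (ZP.abs-* u (Z.+ den)))))

  ≼⇒≡[modℚ] : ∀ {x y} → 1 ≼ x - y → x ≡ y [modℚ p ]
  ≼⇒≡[modℚ] {x} {y} = go p refl
    where
    -- The reciprocal hidden in the congruence reduces only when the modulus is a visible successor.
    go : ∀ q → q ≡ p → 1 ≼ x - y → x ≡ y [modℚ q ]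
    go (suc q) refl (multiple w i e) = integral⇒IsPAdicInt (subst Integral (sym eq) i)
      where
      r : ∀ P w v → P * 1ℚ * w * v ≡ v * P * w
      r = solve-∀ ℚ-ring
      eq : (x - y) * inv (suc q) ≡ w
      eq = trans (cong (_* inv (suc q)) e) (trans (r P w (inv (suc q)))
        (trans (cong (_* w) (inv-* (suc q))) (QP.*-identityˡ w)))
    go zero refl _ with () ← 1<p

-- The commutative ring of polynomials in the shift

module Operators where

  open Rationals
  open import Algebra.Bundles using (CommutativeRing)
  open import Algebra.Solver.Ring.AlmostCommutativeRing as ACR using (AlmostCommutativeRing; _-Raw-AlmostCommutative⟶_)
  import Algebra.Solver.Ring as RingSolver
  open import Data.Integer as Z using (ℤ)
  import Data.Integer.Properties as ZP
  import Data.Integer.Tactic.RingSolver as ZS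
  open import Data.Rational using (ℚ; 0ℚ; 1ℚ; _+_; _*_; _-_; -_)
  import Data.Rational.Properties as QP
  import Data.Maybe as Maybe
  open import Data.Product using (_,_)
  open import Function using (_∘_)
  open import Level using (0ℓ)
  open import Relation.Nullary.Decidable using (dec⇒maybe)
  open import Relation.Binary using (IsEquivalence)
  open import Relation.Binary.PropositionalEquality
  open import Tactic.RingSolver using (solve-∀)

  infixl 6 _⊕_
  infixl 7 _⊗_
  infix 7.5 ⊝_
  infix 4 _≈_

  -- Integer polynomials in the shift f ↦ f (· - 1), acting on functions ℤ → ℚ;
  -- two polynomials are identified when they act alike.
  data Op : Set where
    κ : ℤ → Op
    σ : ℕ → Op
    _⊕_ _⊗_ : Op → Op → Op

  ⊝_ : Op → Op
  ⊝ A = κ Z.-[1+ 0 ] ⊗ A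

  act : Op → (ℤ → ℚ) → ℤ → ℚ
  act (κ c) f r = ℤtoℚ c * f r
  act (σ k) f r = f (r Z.- Z.+ k)
  act (A ⊕ B) f r = act A f r + act B f r
  act (A ⊗ B) f r = act A (act B f) r

  record _≈_ (A B : Op) : Set where
    constructor ext
    field at : ∀ f r → act A f r ≡ act B f r
  open _≈_ public

  act-cong : ∀ A {f g} → (∀ r → f r ≡ g r) → ∀ r → act A f r ≡ act A g r
  act-cong (κ c) h r = cong (ℤtoℚ c *_) (h r)
  act-cong (σ k) h r = h (r Z.- Z.+ k)
  act-cong (A ⊕ B) h r = cong₂ _+_ (act-cong A h r) (act-cong B h r)
  act-cong (A ⊗ B) h r = act-cong A (act-cong B h) r

  act-+ : ∀ A f g r → act A (λ i → f i + g i) r ≡ act A f r + act A g r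
  act-+ (κ c) f g r = QP.*-distribˡ-+ (ℤtoℚ c) (f r) (g r)
  act-+ (σ k) f g r = refl
  act-+ (A ⊕ B) f g r = trans (cong₂ _+_ (act-+ A f g r) (act-+ B f g r)) (r₁ (act A f r) (act A g r) (act B f r) (act B g r))
    where
    r₁ : ∀ a b c d → a + b + (c + d) ≡ a + c + (b + d)
    r₁ = solve-∀ ℚ-ring
  act-+ (A ⊗ B) f g r = trans (act-cong A (act-+ B f g) r) (act-+ A (act B f) (act B g) r)

  act-* : ∀ A c f r → act A (λ i → c * f i) r ≡ c * act A f r
  act-* (κ d) c f r = r₁ (ℤtoℚ d) c (f r)
    where
    r₁ : ∀ d c x → d * (c * x) ≡ c * (d * x)
    r₁ = solve-∀ ℚ-ring
  act-* (σ k) c f r = refl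
  act-* (A ⊕ B) c f r = trans (cong₂ _+_ (act-* A c f r) (act-* B c f r)) (sym (QP.*-distribˡ-+ c (act A f r) (act B f r)))
  act-* (A ⊗ B) c f r = trans (act-cong A (act-* B c f) r) (act-* A c (act B f) r)

  act-neg : ∀ A f r → act A (λ i → - f i) r ≡ - act A f r
  act-neg A f r = trans (act-cong A (λ i → r₁ (f i)) r) (trans (act-* A (- 1ℚ) f r) (sym (r₁ (act A f r))))
    where
    r₁ : ∀ x → - x ≡ - 1ℚ * x
    r₁ = solve-∀ ℚ-ring

  act-- : ∀ A f g r → act A (λ i → f i - g i) r ≡ act A f r - act A g r
  act-- A f g r = trans (act-+ A f (-_ ∘ g) r) (cong (λ x → act A f r + x) (act-neg A g r))

  act-0 : ∀ A r → act A (λ _ → 0ℚ) r ≡ 0ℚ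
  act-0 A r = trans (act-cong A (λ _ → sym (QP.*-zeroˡ 0ℚ)) r) (trans (act-* A 0ℚ (λ _ → 0ℚ) r) (QP.*-zeroˡ (act A (λ _ → 0ℚ) r)))

  act-shift : ∀ A z f r → act A (λ i → f (i Z.- z)) r ≡ act A f (r Z.- z)
  act-shift (κ c) z f r = refl
  act-shift (σ k) z f r = cong f (r₁ r (Z.+ k) z)
    where
    r₁ : ∀ r k z → r Z.- k Z.- z ≡ r Z.- z Z.- k
    r₁ = ZS.solve-∀
  act-shift (A ⊕ B) z f r = cong₂ _+_ (act-shift A z f r) (act-shift B z f r)
  act-shift (A ⊗ B) z f r = trans (act-cong A (act-shift B z f) r) (act-shift A z (act B f) r)

  act-comm : ∀ A B f r → act A (act B f) r ≡ act B (act A f) r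
  act-comm (κ c) B f r = sym (act-* B (ℤtoℚ c) f r)
  act-comm (σ k) B f r = sym (act-shift B (Z.+ k) f r)
  act-comm (A₁ ⊕ A₂) B f r = trans (cong₂ _+_ (act-comm A₁ B f r) (act-comm A₂ B f r)) (sym (act-+ B (act A₁ f) (act A₂ f) r))
  act-comm (A₁ ⊗ A₂) B f r = trans (act-cong A₁ (act-comm A₂ B f) r) (act-comm A₁ B (act A₂ f) r)

  -- Constants and shifts commute with every operator, by linearity and translation invariance.
  -- Hence operator identities are polynomial identities, open to a ring solver.
  Op-ring : CommutativeRing 0ℓ 0ℓ
  Op-ring = record
    { Carrier = Op ; _≈_ = _≈_ ; _+_ = _⊕_ ; _*_ = _⊗_ ; -_ = ⊝_ ; 0# = κ (Z.+ 0) ; 1# = κ (Z.+ 1)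
    ; isCommutativeRing = record
      { isRing = record
        { +-isAbelianGroup = record
          { isGroup = record
            { isMonoid = record
              { isSemigroup = record
                { isMagma = record
                  { isEquivalence = ≈-isEquivalence
                  ; ∙-cong = λ e e′ → ext λ f r → cong₂ _+_ (at e f r) (at e′ f r) }
                ; assoc = λ A B C → ext λ f r → QP.+-assoc (act A f r) (act B f r) (act C f r) }
              ; identity = (λ A → ext λ f r → r₀ (f r) (act A f r)) , (λ A → ext λ f r → r₀′ (f r) (act A f r)) }
            ; inverse = (λ A → ext λ f r → r₁ (f r) (act A f r)) , (λ A → ext λ f r → r₁′ (f r) (act A f r))
            ; ⁻¹-cong = λ e → ext λ f r → cong (- 1ℚ *_) (at e f r) }
          ; comm = λ A B → ext λ f r → QP.+-comm (act A f r) (act B f r) }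
        ; *-cong = λ {A} {A′} {B} {B′} e e′ → ext λ f r → trans (act-cong A (at e′ f) r) (at e (act B′ f) r)
        ; *-assoc = λ A B C → ext λ f r → refl
        ; *-identity = (λ A → ext λ f r → QP.*-identityˡ (act A f r))
                     , (λ A → ext λ f r → act-cong A (λ i → QP.*-identityˡ (f i)) r)
        ; distrib = (λ A B C → ext λ f r → act-+ A (act B f) (act C f) r) , (λ A B C → ext λ f r → refl) }
      ; *-comm = λ A B → ext (act-comm A B) } }
    where
    ≈-isEquivalence : IsEquivalence _≈_
    ≈-isEquivalence = record
      { refl = ext λ f r → refl ; sym = λ e → ext λ f r → sym (at e f r) ; trans = λ e e′ → ext λ f r → trans (at e f r) (at e′ f r) }
    r₀ : ∀ x a → 0ℚ * x + a ≡ a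
    r₀ = solve-∀ ℚ-ring
    r₀′ : ∀ x a → a + 0ℚ * x ≡ a
    r₀′ = solve-∀ ℚ-ring
    r₁ : ∀ x a → - 1ℚ * a + a ≡ 0ℚ * x
    r₁ = solve-∀ ℚ-ring
    r₁′ : ∀ x a → a + - 1ℚ * a ≡ 0ℚ * x
    r₁′ = solve-∀ ℚ-ring

  module Op-solver where
    ring : AlmostCommutativeRing 0ℓ 0ℓ
    ring = ACR.fromCommutativeRing Op-ring

    -- With ℤ as coefficient ring the solver computes with the constants `κ c`, and so with signs
    -- and numerals.
    coefficients : CommutativeRing.rawRing ZP.+-*-commutativeRing -Raw-AlmostCommutative⟶ ring
    coefficients = record
      { ⟦_⟧ = κ
      ; +-homo = λ a b → ext λ f r → trans (cong (_* f r) (ℤtoℚ-+ a b)) (QP.*-distribʳ-+ (f r) (ℤtoℚ a) (ℤtoℚ b))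
      ; *-homo = λ a b → ext λ f r → trans (cong (_* f r) (ℤtoℚ-* a b)) (QP.*-assoc (ℤtoℚ a) (ℤtoℚ b) (f r))
      ; -‿homo = λ a → ext λ f r → trans (cong (_* f r) (ℤtoℚ-neg a)) (r₁ (ℤtoℚ a) (f r))
      ; 0-homo = CommutativeRing.refl Op-ring
      ; 1-homo = CommutativeRing.refl Op-ring }
      where
      r₁ : ∀ a x → - a * x ≡ - 1ℚ * (a * x)
      r₁ = solve-∀ ℚ-ring

    equal? : ∀ a b → _
    equal? a b = Maybe.map (λ e → CommutativeRing.reflexive Op-ring (cong κ e)) (dec⇒maybe (a ZP.≟ b))

    open RingSolver (CommutativeRing.rawRing ZP.+-*-commutativeRing) ring coefficients equal? public

  open Op-solver public using (solve; con; _:+_; _:*_; _:-_; :-_; _:^_; _:=_)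
  open CommutativeRing Op-ring public using (semiring; commutativeSemiring; +-cong; *-cong; *-assoc; *-comm)
    renaming (setoid to Op-setoid; refl to ≈-refl; sym to ≈-sym; trans to ≈-trans; reflexive to ≈-reflexive)
  open import Algebra.Properties.Semiring.Exp semiring public using (_^_; ^-congˡ; ^-homo-*; ^-assocʳ)

  κ₁ : Op
  κ₁ = κ (Z.+ 1)

  κℕ : ℕ → Op
  κℕ n = κ (Z.+ n)

  ∇ : Op → Op
  ∇ A = κ₁ ⊕ ⊝ A

  Δ : Op
  Δ = ∇ (σ 1)

  σ-0 : σ 0 ≈ κ₁
  σ-0 = ext λ f r → trans (cong f (ZP.+-identityʳ r)) (sym (QP.*-identityˡ (f r)))

  σ-+ : ∀ a b → σ a ⊗ σ b ≈ σ (a N.+ b)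
  σ-+ a b = ext λ f r → cong f (trans (r₁ r (Z.+ a) (Z.+ b)) (cong (λ z → r Z.- z) (sym (ZP.pos-+ a b))))
    where
    r₁ : ∀ r a b → r Z.- a Z.- b ≡ r Z.- (a Z.+ b)
    r₁ = ZS.solve-∀

  σ-^ : ∀ k n → σ k ^ n ≈ σ (n N.* k)
  σ-^ k zero = ≈-sym σ-0
  σ-^ k (suc n) = ≈-trans (*-cong (≈-refl {σ k}) (σ-^ k n)) (σ-+ k (n N.* k))

  κ-+ : ∀ a b → κℕ (a N.+ b) ≈ κℕ a ⊕ κℕ b
  κ-+ a b = ext λ f r → trans (cong (_* f r) (ℕtoℚ-+ a b)) (QP.*-distribʳ-+ (f r) (ℕtoℚ a) (ℕtoℚ b))

  κ-* : ∀ a b → κℕ (a N.* b) ≈ κℕ a ⊗ κℕ b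
  κ-* a b = ext λ f r → trans (cong (_* f r) (ℕtoℚ-* a b)) (QP.*-assoc (ℕtoℚ a) (ℕtoℚ b) (f r))

  -- The substitution of the `m`th power for the variable. It acts on terms, which is why operators
  -- are represented by syntax and not by functions.
  sub : ℕ → Op → Op
  sub m (κ c) = κ c
  sub m (σ k) = σ (m N.* k)
  sub m (A ⊕ B) = sub m A ⊕ sub m B
  sub m (A ⊗ B) = sub m A ⊗ sub m B

  act-sub : ∀ m A f s r → act (sub m A) f (s Z.+ Z.+ m Z.* r) ≡ act A (λ i → f (s Z.+ Z.+ m Z.* i)) r
  act-sub m (κ c) f s r = refl
  act-sub m (σ k) f s r = cong f (trans (cong (λ z → s Z.+ Z.+ m Z.* r Z.- z) (ZP.pos-* m k)) (r₁ s (Z.+ m) r (Z.+ k)))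
    where
    r₁ : ∀ s m r k → s Z.+ m Z.* r Z.- m Z.* k ≡ s Z.+ m Z.* (r Z.- k)
    r₁ = ZS.solve-∀
  act-sub m (A ⊕ B) f s r = cong₂ _+_ (act-sub m A f s r) (act-sub m B f s r)
  act-sub m (A ⊗ B) f s r = trans (act-sub m A (act (sub m B) f) s r) (act-cong A (act-sub m B f s) r)

  -- At `r` the operator `sub m A` does what `A` does at 0 to the function `i ↦ f (r + m i)`.
  -- Equality of actions on all functions therefore survives substitution.
  sub-≈ : ∀ m {A B} → A ≈ B → sub m A ≈ sub m B
  sub-≈ m {A} {B} e = ext λ f r → begin
    act (sub m A) f r ≡⟨ cong (act (sub m A) f) (r₁ r (Z.+ m)) ⟩
    act (sub m A) f (r Z.+ Z.+ m Z.* Z.0ℤ) ≡⟨ act-sub m A f r Z.0ℤ ⟩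
    act A (λ i → f (r Z.+ Z.+ m Z.* i)) Z.0ℤ ≡⟨ at e (λ i → f (r Z.+ Z.+ m Z.* i)) Z.0ℤ ⟩
    act B (λ i → f (r Z.+ Z.+ m Z.* i)) Z.0ℤ ≡⟨ act-sub m B f r Z.0ℤ ⟨
    act (sub m B) f (r Z.+ Z.+ m Z.* Z.0ℤ) ≡⟨ cong (act (sub m B) f) (r₁ r (Z.+ m)) ⟨
    act (sub m B) f r ∎
    where
    open ≡-Reasoning
    r₁ : ∀ r m → r ≡ r Z.+ m Z.* Z.0ℤ
    r₁ = ZS.solve-∀

  sub-^ : ∀ m A n → sub m (A ^ n) ≡ sub m A ^ n
  sub-^ m A zero = refl
  sub-^ m A (suc n) = cong (sub m A ⊗_) (sub-^ m A n)

  -- Unrolled, this is the sum over 1 ≤ i ≤ m of `i c^2 K^2 A^(i-1) (A + c K)^(m-i)`. Each term has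
  -- exactly `m - 1` factors `A` or `A + c K`, a shape suited to counting weights.
  remainder : Op → Op → Op → ℕ → Op
  remainder A c K zero = κ (Z.+ 0)
  remainder A c K (suc m) = (A ⊕ c ⊗ K) ⊗ remainder A c K m ⊕ κℕ (suc m) ⊗ (c ⊗ c ⊗ (K ⊗ K ⊗ A ^ m))

  expansion : ∀ A c K m → (A ⊕ c ⊗ K) ^ suc m ≈ A ^ suc m ⊕ κℕ (suc m) ⊗ (c ⊗ (K ⊗ A ^ m)) ⊕ remainder A c K m
  expansion A c K zero = solve 3 (λ a c k → (a :+ c :* k) :* con (Z.+ 1) := a :* con (Z.+ 1) :+ con (Z.+ 1) :* (c :* (k :* con (Z.+ 1))) :+ con (Z.+ 0)) ≈-refl A c K
  expansion A c K (suc m) = ≈-trans (*-cong (≈-refl {A ⊕ c ⊗ K}) (expansion A c K m))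
    (≈-trans (solve 6 (λ a c k n x R → (a :+ c :* k) :* (a :* x :+ n :* (c :* (k :* x)) :+ R)
        := a :* (a :* x) :+ (con (Z.+ 1) :+ n) :* (c :* (k :* (a :* x))) :+ ((a :+ c :* k) :* R :+ n :* (c :* c :* (k :* k :* x))))
       ≈-refl A c K (κℕ (suc m)) (A ^ m) (remainder A c K m))
    (+-cong (+-cong (≈-refl {A ^ suc (suc m)}) (*-cong (≈-sym (κ-+ 1 (suc m))) (≈-refl {c ⊗ (K ⊗ A ^ suc m)}))) (≈-refl {remainder A c K (suc m)})))

  ∇-cong : ∀ {A B} → A ≈ B → ∇ A ≈ ∇ B
  ∇-cong e = +-cong (≈-refl {κ₁}) (*-cong (≈-refl {κ Z.-[1+ 0 ]}) e)

-- Powers of operators with exponent a power of p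

module Freshman (p : ℕ) (p-prime : Prime p) where

  open Operators
  open Valuation p p-prime using (1<p)
  open import Data.Nat.Primality using (euclidsLemma; prime⇒irreducible)
  import Data.Nat.Properties as NP
  import Data.Nat.Divisibility as ND
  open import Data.Nat.Combinatorics using (_C_; nCk+nC[k+1]≡[n+1]C[k+1]; nC1≡n; nCn≡1; k>n⇒nCk≡0)
  import Data.Nat.Tactic.RingSolver as NS
  open import Data.Fin as Fin using (Fin; toℕ)
  import Data.Fin.Properties as FP
  import Data.Integer as Z
  open import Data.Product using (∃; _,_; proj₁; proj₂)
  open import Data.Sum using (_⊎_; inj₁; inj₂)
  open import Data.Empty using (⊥-elim)
  open import Function using (_∘_)
  open import Relation.Binary.PropositionalEquality
  open import Algebra.Properties.Semiring.Sum semiring using (sum; sum-init-last)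
  open import Algebra.Properties.Semiring.Mult semiring using (_×_)
  open import Algebra.Properties.CommutativeSemiring.Binomial commutativeSemiring using (theorem; binomialTerm)

  absorption : ∀ n k → suc k N.* (suc n C suc k) ≡ suc n N.* (n C k)
  absorption zero zero = refl
  absorption zero (suc k) = trans (cong (suc (suc k) N.*_) (k>n⇒nCk≡0 {1} {suc (suc k)} (N.s≤s (N.s≤s N.z≤n)))) (NP.*-zeroʳ (suc (suc k)))
  absorption (suc n) zero = trans (NP.+-identityʳ (suc (suc n) C 1)) (trans (nC1≡n (suc (suc n))) (sym (NP.*-identityʳ (suc (suc n)))))
  absorption (suc n) (suc k) = begin
    suc (suc k) N.* (suc (suc n) C suc (suc k))
      ≡⟨ cong (suc (suc k) N.*_) (nCk+nC[k+1]≡[n+1]C[k+1] (suc n) (suc k)) ⟨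
    suc (suc k) N.* ((suc n C suc k) N.+ (suc n C suc (suc k)))
      ≡⟨ r₁ (suc k) (suc n C suc k) (suc n C suc (suc k)) ⟩
    suc k N.* (suc n C suc k) N.+ (suc n C suc k) N.+ suc (suc k) N.* (suc n C suc (suc k))
      ≡⟨ cong₂ (λ a b → a N.+ (suc n C suc k) N.+ b) (absorption n k) (absorption n (suc k)) ⟩
    suc n N.* (n C k) N.+ (suc n C suc k) N.+ suc n N.* (n C suc k)
      ≡⟨ r₂ (suc n) (n C k) (suc n C suc k) (n C suc k) ⟩
    suc n N.* ((n C k) N.+ (n C suc k)) N.+ (suc n C suc k)
      ≡⟨ cong (λ a → suc n N.* a N.+ (suc n C suc k)) (nCk+nC[k+1]≡[n+1]C[k+1] n k) ⟩
    suc n N.* (suc n C suc k) N.+ (suc n C suc k)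
      ≡⟨ NP.+-comm (suc n N.* (suc n C suc k)) (suc n C suc k) ⟩
    suc (suc n) N.* (suc n C suc k) ∎
    where
    open ≡-Reasoning
    r₁ : ∀ k a b → suc k N.* (a N.+ b) ≡ k N.* a N.+ a N.+ suc k N.* b
    r₁ = NS.solve-∀
    r₂ : ∀ n a b c → n N.* a N.+ b N.+ n N.* c ≡ n N.* (a N.+ c) N.+ b
    r₂ = NS.solve-∀

  p∣pCk : ∀ k → 0 N.< k → k N.< p → p ND.∣ p C k
  p∣pCk (suc k) _ k<p = go p refl
    where
    go : ∀ n → n ≡ p → p ND.∣ p C suc k
    go zero refl = ⊥-elim (NP.n≮0 k<p)
    go (suc n) refl with euclidsLemma (suc k) (p C suc k) p-prime (ND.divides (n C k) (trans (absorption n k) (NP.*-comm p (n C k))))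
    ... | inj₁ p∣k = ⊥-elim (NP.<⇒≱ k<p (ND.∣⇒≤ p∣k))
    ... | inj₂ d = d

  private
    parity : ∀ n → ∃ λ k → n ≡ k N.+ k ⊎ n ≡ suc (k N.+ k)
    parity zero = 0 , inj₁ refl
    parity (suc n) with parity n
    ... | k , inj₁ e = k , inj₂ (cong suc e)
    ... | k , inj₂ e = suc k , inj₁ (trans (cong suc e) (cong suc (sym (NP.+-suc k k))))

  p≡2⊎odd : p ≡ 2 ⊎ ∃ λ k → p ≡ suc (k N.+ k)
  p≡2⊎odd with parity p
  ... | k , inj₂ e = inj₂ (k , e)
  ... | k , inj₁ e with prime⇒irreducible p-prime {2} (ND.divides k (trans e (r k)))
    where
    r : ∀ k → k N.+ k ≡ k N.* 2
    r = NS.solve-∀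
  ... | inj₁ ()
  ... | inj₂ e′ = inj₁ (sym e′)

  ×-κ : ∀ n A → n × A ≈ κℕ n ⊗ A
  ×-κ zero A = solve 1 (λ a → con (Z.+ 0) := con (Z.+ 0) :* a) ≈-refl A
  ×-κ (suc n) A = ≈-trans (+-cong (≈-refl {A}) (×-κ n A))
    (≈-trans (solve 2 (λ a n → a :+ n :* a := (con (Z.+ 1) :+ n) :* a) ≈-refl A (κℕ n)) (*-cong (≈-sym (κ-+ 1 n)) (≈-refl {A})))

  -- The factor `Z` is recorded besides `p`; it becomes the factor `Δ` of the correction in `Δ^p`,
  -- without which a unit of weight would be lost.
  record PMultiple (Z A : Op) : Set where
    constructor pmultiple
    field
      cofactor : Op
      factors : A ≈ κℕ p ⊗ (Z ⊗ cofactor)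

  private
    sum-PMultiple : ∀ Z {n} (f : Fin n → Op) → (∀ i → PMultiple Z (f i)) → PMultiple Z (sum f)
    sum-PMultiple Z {zero} f h = pmultiple (κ (Z.+ 0)) (solve 2 (λ p z → con (Z.+ 0) := p :* (z :* con (Z.+ 0))) ≈-refl (κℕ p) Z)
    sum-PMultiple Z {suc n} f h with h Fin.zero | sum-PMultiple Z (f ∘ Fin.suc) (h ∘ Fin.suc)
    ... | pmultiple g e | pmultiple g′ e′ = pmultiple (g ⊕ g′)
      (≈-trans (+-cong e e′) (solve 4 (λ p z g g′ → p :* (z :* g) :+ p :* (z :* g′) := p :* (z :* (g :+ g′))) ≈-refl (κℕ p) Z g g′))

  -- In the binomial theorem all terms but the two extreme ones contain both `Z` and a binomial
  -- coefficient divisible by `p`.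
  [1+Z]^p : ∀ Z → ∃ λ h → (Z ⊕ κ₁) ^ p ≈ κ₁ ⊕ Z ^ p ⊕ κℕ p ⊗ (Z ⊗ h)
  [1+Z]^p Z = go p refl 1<p
    where
    go : ∀ n → n ≡ p → 1 N.< n → ∃ λ h → (Z ⊕ κ₁) ^ n ≈ κ₁ ⊕ Z ^ n ⊕ κℕ p ⊗ (Z ⊗ h)
    go (suc (suc m)) e _ = PMultiple.cofactor middle , ≈-trans (theorem n Z κ₁)
      (≈-trans (+-cong (≈-refl {t Fin.zero}) (sum-init-last (t ∘ Fin.suc)))
      (≈-trans (+-cong first (+-cong (PMultiple.factors middle) last))
        (solve 3 (λ a b c → a :+ (b :+ c) := a :+ c :+ b) ≈-refl κ₁ (κℕ p ⊗ (Z ⊗ PMultiple.cofactor middle)) (Z ^ n))))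
      where
      n = suc (suc m)
      t : Fin (suc n) → Op
      t = binomialTerm Z κ₁ n
      κ₁^ : ∀ k → κ₁ ^ k ≈ κ₁
      κ₁^ zero = ≈-refl
      κ₁^ (suc k) = ≈-trans (*-cong (≈-refl {κ₁}) (κ₁^ k)) (solve 0 (con (Z.+ 1) :* con (Z.+ 1) := con (Z.+ 1)) ≈-refl)
      term : ∀ k → t k ≈ κℕ (n C toℕ k) ⊗ (Z ^ toℕ k)
      term k = ≈-trans (×-κ (n C toℕ k) (Z ^ toℕ k ⊗ κ₁ ^ (n N.∸ toℕ k)))
        (*-cong (≈-refl {κℕ (n C toℕ k)}) (≈-trans (*-cong (≈-refl {Z ^ toℕ k}) (κ₁^ (n N.∸ toℕ k)))
          (solve 1 (λ z → z :* con (Z.+ 1) := z) ≈-refl (Z ^ toℕ k))))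
      first : t Fin.zero ≈ κ₁
      first = ≈-trans (term Fin.zero) (solve 0 (con (Z.+ 1) :* con (Z.+ 1) := con (Z.+ 1)) ≈-refl)
      last : t (Fin.suc (Fin.fromℕ (suc m))) ≈ Z ^ n
      last = ≈-trans (term (Fin.suc (Fin.fromℕ (suc m)))) (≈-trans
        (≈-reflexive (cong (λ k → κℕ (n C k) ⊗ (Z ^ k)) (cong suc (FP.toℕ-fromℕ (suc m)))))
        (≈-trans (≈-reflexive (cong (λ c → κℕ c ⊗ (Z ^ n)) (nCn≡1 n))) (solve 1 (λ z → con (Z.+ 1) :* z := z) ≈-refl (Z ^ n))))
      mid : ∀ k → 0 N.< k → k N.< n → PMultiple Z (κℕ (n C k) ⊗ (Z ^ k))
      mid (suc k) 0<k k<n with subst (λ q → p ND.∣ q C suc k) (sym e) (p∣pCk (suc k) 0<k (subst (suc k N.<_) e k<n))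
      ... | ND.divides q eq = pmultiple (κℕ q ⊗ (Z ^ k))
        (≈-trans (*-cong (≈-trans (≈-reflexive (cong κℕ eq)) (κ-* q p)) (≈-refl {Z ^ suc k}))
          (solve 4 (λ q p z w → q :* p :* (z :* w) := p :* (z :* (q :* w))) ≈-refl (κℕ q) (κℕ p) Z (Z ^ k)))
      transport : ∀ {A B} → B ≈ A → PMultiple Z A → PMultiple Z B
      transport e (pmultiple h e′) = pmultiple h (≈-trans e e′)
      middle : PMultiple Z (sum (λ i → t (Fin.suc (Fin.inject₁ i))))
      middle = sum-PMultiple Z (λ i → t (Fin.suc (Fin.inject₁ i))) (λ i → transport (term (Fin.suc (Fin.inject₁ i)))
        (mid (suc (toℕ (Fin.inject₁ i))) (N.s≤s N.z≤n)
          (N.s≤s (subst (N._< suc m) (sym (FP.toℕ-inject₁ i)) (FP.toℕ<n i)))))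
    go (suc zero) _ (N.s≤s ())

  ⊝^p : ∀ Z → ∃ λ h → (⊝ Z) ^ p ≈ ⊝ Z ^ p ⊕ κℕ p ⊗ (Z ⊗ h)
  ⊝^p Z with p≡2⊎odd
  -- For p = 2 the two sides differ by twice the square of `Z`, hence the witness `Z`.
  ... | inj₁ refl = Z , solve 1 (λ z → (:- z) :* ((:- z) :* con (Z.+ 1)) := (:- (z :* (z :* con (Z.+ 1)))) :+ con (Z.+ 2) :* (z :* z)) ≈-refl Z
  ... | inj₂ (k , refl) = κ (Z.+ 0) , ≈-trans (odd k)
        (solve 3 (λ p z w → :- w := :- w :+ p :* (z :* con (Z.+ 0))) ≈-refl (κℕ p) Z (Z ^ p))
    where
    odd : ∀ k → (⊝ Z) ^ suc (k N.+ k) ≈ ⊝ Z ^ suc (k N.+ k)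
    odd zero = solve 1 (λ z → (:- z) :* con (Z.+ 1) := :- (z :* con (Z.+ 1))) ≈-refl Z
    odd (suc k) = subst (λ m → (⊝ Z) ^ suc (suc m) ≈ ⊝ Z ^ suc (suc m)) (sym (NP.+-suc k k))
      (≈-trans (*-cong (≈-refl {⊝ Z}) (*-cong (≈-refl {⊝ Z}) (odd k)))
        (solve 2 (λ z w → :- z :* (:- z :* :- w) := :- (z :* (z :* w))) ≈-refl Z (Z ^ suc (k N.+ k))))

  -- A direct expansion of `(1 - X)^p` would give a correction with factor `X`. Expanding `X^p` in
  -- powers of `1 - X` instead gives one with factor `1 - X`.
  ∇^p : ∀ X → ∃ λ h → ∇ X ^ p ≈ ∇ (X ^ p) ⊕ κℕ p ⊗ (∇ X ⊗ h)
  ∇^p X with [1+Z]^p (⊝ ∇ X) | ⊝^p (∇ X)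
  ... | h , e | h′ , e′ = h′ ⊕ ⊝ h , (begin
    ∇ X ^ p ≈⟨ solve 1 (λ w → w := con (Z.+ 1) :- (con (Z.+ 1) :+ :- w)) ≈-refl (∇ X ^ p) ⟩
    κ₁ ⊕ ⊝ (κ₁ ⊕ ⊝ ∇ X ^ p) ≈⟨ solve 5 (λ w W p h h′ → con (Z.+ 1) :+ :- (con (Z.+ 1) :+ :- w)
          := con (Z.+ 1) :+ :- (con (Z.+ 1) :+ (:- w :+ p :* (W :* h′)) :+ p :* (:- W :* h)) :+ p :* (W :* (h′ :- h)))
        ≈-refl (∇ X ^ p) (∇ X) (κℕ p) h h′ ⟩
    κ₁ ⊕ ⊝ (κ₁ ⊕ (⊝ ∇ X ^ p ⊕ κℕ p ⊗ (∇ X ⊗ h′)) ⊕ κℕ p ⊗ (⊝ ∇ X ⊗ h)) ⊕ κℕ p ⊗ (∇ X ⊗ (h′ ⊕ ⊝ h))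
      ≈⟨ +-cong (+-cong (≈-refl {κ₁}) (⊝-cong (+-cong (+-cong (≈-refl {κ₁}) (≈-sym e′)) (≈-refl {κℕ p ⊗ (⊝ ∇ X ⊗ h)})))) (≈-refl {κℕ p ⊗ (∇ X ⊗ (h′ ⊕ ⊝ h))}) ⟩
    κ₁ ⊕ ⊝ (κ₁ ⊕ (⊝ ∇ X) ^ p ⊕ κℕ p ⊗ (⊝ ∇ X ⊗ h)) ⊕ κℕ p ⊗ (∇ X ⊗ (h′ ⊕ ⊝ h))
      ≈⟨ +-cong (+-cong (≈-refl {κ₁}) (⊝-cong (≈-trans (≈-sym e) (^-congˡ p (solve 1 (λ x → (:- (con (Z.+ 1) :+ :- x)) :+ con (Z.+ 1) := x) ≈-refl X))))) (≈-refl {κℕ p ⊗ (∇ X ⊗ (h′ ⊕ ⊝ h))}) ⟩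
    ∇ (X ^ p) ⊕ κℕ p ⊗ (∇ X ⊗ (h′ ⊕ ⊝ h)) ∎)
    where
    open import Relation.Binary.Reasoning.Setoid Op-setoid
    ⊝-cong : ∀ {A B} → A ≈ B → ⊝ A ≈ ⊝ B
    ⊝-cong = *-cong ≈-refl

  h₀ : Op
  h₀ = proj₁ (∇^p (σ 1))

  Δ^p : Δ ^ p ≈ ∇ (σ p) ⊕ κℕ p ⊗ (Δ ⊗ h₀)
  Δ^p = ≈-trans (proj₂ (∇^p (σ 1)))
    (+-cong (∇-cong (≈-trans (σ-^ 1 p) (≈-reflexive (cong σ (NP.*-identityʳ p))))) (≈-refl {κℕ p ⊗ (Δ ⊗ h₀)}))

  -- Obtained by substitution into `Δ^p`, so that the cofactor is a polynomial in `σ m` and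
  -- preserves functions supported on the multiples of `m`.
  ∇σ^p : ∀ m → ∇ (σ m) ^ p ≈ ∇ (σ (p N.* m)) ⊕ κℕ p ⊗ (∇ (σ m) ⊗ sub m h₀)
  ∇σ^p m = ≈-trans (≈-reflexive (trans (cong (λ k → ∇ (σ k) ^ p) (sym (NP.*-identityʳ m))) (sym (sub-^ m Δ p))))
    (≈-trans (sub-≈ m Δ^p) (≈-reflexive (cong₂ (λ k l → ∇ (σ k) ⊕ κℕ p ⊗ (∇ (σ l) ⊗ sub m h₀)) (NP.*-comm m p) (NP.*-identityʳ m))))

  remainder-c² : ∀ A c K m → ∃ λ L → remainder A c K m ≈ c ⊗ c ⊗ L
  remainder-c² A c K zero = κ (Z.+ 0) , solve 1 (λ c → con (Z.+ 0) := c :* c :* con (Z.+ 0)) ≈-refl c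
  remainder-c² A c K (suc m) with remainder-c² A c K m
  ... | L , e = (A ⊕ c ⊗ K) ⊗ L ⊕ κℕ (suc m) ⊗ (K ⊗ K ⊗ A ^ m) , ≈-trans
    (+-cong (*-cong (≈-refl {A ⊕ c ⊗ K}) e) (≈-refl {κℕ (suc m) ⊗ (c ⊗ c ⊗ (K ⊗ K ⊗ A ^ m))}))
    (solve 6 (λ a c k n x L → (a :+ c :* k) :* (c :* c :* L) :+ n :* (c :* c :* (k :* k :* x))
        := c :* c :* ((a :+ c :* k) :* L :+ n :* (k :* k :* x))) ≈-refl A c K (κℕ (suc m)) (A ^ m) L)

  -- The first-order term has coefficient `p` times `p`, so changing the base by a multiple of `p`
  -- changes the p-th power by a multiple of `p^2`.
  [A+pK]^p : ∀ A K → ∃ λ L → (A ⊕ κℕ p ⊗ K) ^ p ≈ A ^ p ⊕ κℕ p ⊗ (κℕ p ⊗ L)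
  [A+pK]^p A K = go p refl 1<p
    where
    go : ∀ n → n ≡ p → 1 N.< n → ∃ λ L → (A ⊕ κℕ p ⊗ K) ^ n ≈ A ^ n ⊕ κℕ p ⊗ (κℕ p ⊗ L)
    go (suc m) refl _ with remainder-c² A (κℕ p) K m
    ... | L , e = K ⊗ A ^ m ⊕ L , ≈-trans (expansion A (κℕ p) K m)
      (≈-trans (+-cong (≈-refl {A ^ p ⊕ κℕ p ⊗ (κℕ p ⊗ (K ⊗ A ^ m))}) e)
        (solve 4 (λ p x y L → x :+ p :* (p :* y) :+ p :* p :* L := x :+ p :* (p :* (y :+ L))) ≈-refl (κℕ p) (A ^ p) (K ⊗ A ^ m) L))

  Δ^p^b : ∀ b → ∃ λ K → Δ ^ (p N.^ b) ≈ ∇ (σ (p N.^ b)) ⊕ κℕ p ⊗ K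
  -- The coefficient of `p` is needed modulo `p`. The error `K` of the previous level enters only
  -- with `p^2`, so what remains is the cofactor from `∇σ^p`, with its factor `1 - σ^(p^b)`.
  Δ^p^[1+b] : ∀ b → ∃ λ L → Δ ^ (p N.^ suc b) ≈ ∇ (σ (p N.^ suc b)) ⊕ κℕ p ⊗ (∇ (σ (p N.^ b)) ⊗ sub (p N.^ b) h₀ ⊕ κℕ p ⊗ L)

  Δ^p^b zero = κ (Z.+ 0) , solve 2 (λ x p → x :* con (Z.+ 1) := x :+ p :* con (Z.+ 0)) ≈-refl Δ (κℕ p)
  Δ^p^b (suc b) with Δ^p^[1+b] b
  ... | L , e = ∇ (σ (p N.^ b)) ⊗ sub (p N.^ b) h₀ ⊕ κℕ p ⊗ L , e

  Δ^p^[1+b] b with Δ^p^b b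
  ... | K , e with [A+pK]^p (∇ (σ (p N.^ b))) K
  ... | L , e′ = L , (begin
    Δ ^ (p N.* p N.^ b) ≈⟨ ≈-reflexive (cong (Δ ^_) (NP.*-comm p (p N.^ b))) ⟩
    Δ ^ (p N.^ b N.* p) ≈⟨ ^-assocʳ Δ (p N.^ b) p ⟨
    (Δ ^ (p N.^ b)) ^ p ≈⟨ ^-congˡ p e ⟩
    (∇ X ⊕ κℕ p ⊗ K) ^ p ≈⟨ e′ ⟩
    ∇ X ^ p ⊕ κℕ p ⊗ (κℕ p ⊗ L) ≈⟨ +-cong (∇σ^p (p N.^ b)) (≈-refl {κℕ p ⊗ (κℕ p ⊗ L)}) ⟩
    ∇ (σ (p N.* p N.^ b)) ⊕ κℕ p ⊗ (∇ X ⊗ sub (p N.^ b) h₀) ⊕ κℕ p ⊗ (κℕ p ⊗ L)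
      ≈⟨ solve 4 (λ y p a b → y :+ p :* a :+ p :* b := y :+ p :* (a :+ b)) ≈-refl (∇ (σ (p N.* p N.^ b))) (κℕ p) (∇ X ⊗ sub (p N.^ b) h₀) (κℕ p ⊗ L) ⟩
    ∇ (σ (p N.* p N.^ b)) ⊕ κℕ p ⊗ (∇ X ⊗ sub (p N.^ b) h₀ ⊕ κℕ p ⊗ L) ∎)
    where
    X = σ (p N.^ b)
    open import Relation.Binary.Reasoning.Setoid Op-setoid

-- The Fleck sum as an iterated difference

module FleckFunction where

  open Rationals
  open Operators
  import Data.Nat.Properties as NP
  open import Data.Nat.Combinatorics using (_C_; nCk+nC[k+1]≡[n+1]C[k+1]; k>n⇒nCk≡0)
  open import Data.Integer as Z using (ℤ)
  import Data.Integer.Properties as ZP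
  import Data.Integer.DivMod as ZD
  open import Algebra.Properties.AbelianGroup ZP.+-0-abelianGroup using (∙-cancelʳ)
  import Data.Integer.Tactic.RingSolver as ZS
  open import Data.Rational using (ℚ; 0ℚ; 1ℚ; _+_; _*_; _-_; -_)
  import Data.Rational.Properties as QP
  open import Data.Product using (∃; _×_; _,_; proj₁; proj₂)
  open import Data.Sum using (_⊎_; inj₁; inj₂)
  open import Data.Empty using (⊥-elim)
  open import Function using (_∘_)
  open import Relation.Nullary using (¬_; yes; no)
  open import Relation.Binary.PropositionalEquality
  open import Tactic.RingSolver using (solve-∀)

  act-Δ : ∀ f r → act Δ f r ≡ f r - f (r Z.- Z.1ℤ)
  act-Δ f r = r₁ (f r) (f (r Z.- Z.1ℤ))
    where
    r₁ : ∀ a b → 1ℚ * a + - 1ℚ * b ≡ a - b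
    r₁ = solve-∀ ℚ-ring

  act-Δ^ : ∀ n f r → act (Δ ^ n) f r ≡ sumTo n (λ k → ℕtoℚ (n C k) * sgn k * f (r Z.- Z.+ k))
  act-Δ^ zero f r = trans (cong (λ z → 1ℚ * f z) (sym (ZP.+-identityʳ r))) (cong (λ x → x * f (r Z.- Z.+ 0)) (sym (QP.*-identityʳ 1ℚ)))
  act-Δ^ (suc n) f r = begin
    act Δ (act (Δ ^ n) f) r ≡⟨ act-Δ (act (Δ ^ n) f) r ⟩
    act (Δ ^ n) f r - act (Δ ^ n) f (r Z.- Z.1ℤ) ≡⟨ cong₂ _-_ (act-Δ^ n f r) (act-Δ^ n f (r Z.- Z.1ℤ)) ⟩
    sumTo n (λ k → t k * x k) - sumTo n (λ k → t k * f (r Z.- Z.1ℤ Z.- Z.+ k))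
      ≡⟨ cong₂ (λ a b → a + b) top (trans (r₁ (sumTo n _)) (trans (sym (sumTo-*ˡ n (- 1ℚ) _)) (sumTo-cong n λ k _ → lower k))) ⟩
    1ℚ * 1ℚ * x 0 + sumTo n (λ k → t (suc k) * x (suc k)) + sumTo n (λ k → ℕtoℚ (n C k) * sgn (suc k) * x (suc k))
      ≡⟨ QP.+-assoc (1ℚ * 1ℚ * x 0) (sumTo n (λ k → t (suc k) * x (suc k))) (sumTo n (λ k → ℕtoℚ (n C k) * sgn (suc k) * x (suc k))) ⟩
    1ℚ * 1ℚ * x 0 + (sumTo n (λ k → t (suc k) * x (suc k)) + sumTo n (λ k → ℕtoℚ (n C k) * sgn (suc k) * x (suc k)))
      ≡⟨ cong (λ a → 1ℚ * 1ℚ * x 0 + a) (trans (sym (sumTo-+ n _ _)) (sumTo-cong n λ k _ → pascal k)) ⟩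
    1ℚ * 1ℚ * x 0 + sumTo n (λ k → ℕtoℚ (suc n C suc k) * sgn (suc k) * x (suc k))
      ≡⟨ sumTo-first n (λ k → ℕtoℚ (suc n C k) * sgn k * x k) ⟨
    sumTo (suc n) (λ k → ℕtoℚ (suc n C k) * sgn k * x k) ∎
    where
    open ≡-Reasoning
    x : ℕ → ℚ
    x k = f (r Z.- Z.+ k)
    t : ℕ → ℚ
    t k = ℕtoℚ (n C k) * sgn k
    r₁ : ∀ a → - a ≡ - 1ℚ * a
    r₁ = solve-∀ ℚ-ring
    r₂ : ∀ c s y → - 1ℚ * (c * s * y) ≡ c * (- 1ℚ * s) * y
    r₂ = solve-∀ ℚ-ring
    r₃ : ∀ a b s y → a * s * y + b * s * y ≡ (b + a) * s * y
    r₃ = solve-∀ ℚ-ring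
    r₄ : ∀ a s y → a ≡ a + 0ℚ * s * y
    r₄ = solve-∀ ℚ-ring
    shift : ∀ r k → r Z.- Z.1ℤ Z.- k ≡ r Z.- (Z.1ℤ Z.+ k)
    shift = ZS.solve-∀
    lower : ∀ k → - 1ℚ * (t k * f (r Z.- Z.1ℤ Z.- Z.+ k)) ≡ ℕtoℚ (n C k) * sgn (suc k) * x (suc k)
    lower k = trans (r₂ (ℕtoℚ (n C k)) (sgn k) (f (r Z.- Z.1ℤ Z.- Z.+ k)))
      (cong (λ z → ℕtoℚ (n C k) * sgn (suc k) * f z) (shift r (Z.+ k)))
    pascal : ∀ k → t (suc k) * x (suc k) + ℕtoℚ (n C k) * sgn (suc k) * x (suc k) ≡ ℕtoℚ (suc n C suc k) * sgn (suc k) * x (suc k)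
    pascal k = trans (r₃ (ℕtoℚ (n C suc k)) (ℕtoℚ (n C k)) (sgn (suc k)) (x (suc k)))
      (cong (λ c → c * sgn (suc k) * x (suc k)) (trans (sym (ℕtoℚ-+ (n C k) (n C suc k))) (cong ℕtoℚ (nCk+nC[k+1]≡[n+1]C[k+1] n k))))
    top : sumTo n (λ k → t k * x k) ≡ 1ℚ * 1ℚ * x 0 + sumTo n (λ k → t (suc k) * x (suc k))
    top = begin
      sumTo n (λ k → t k * x k) ≡⟨ r₄ (sumTo n (λ k → t k * x k)) (sgn (suc n)) (x (suc n)) ⟩
      sumTo n (λ k → t k * x k) + 0ℚ * sgn (suc n) * x (suc n)
        -- A zero term, with binom(n, n + 1), is appended so that the two sums to be merged by
        -- Pascal's rule run over the same range.
        ≡⟨ cong (λ c → sumTo n (λ k → t k * x k) + ℕtoℚ c * sgn (suc n) * x (suc n)) (sym (k>n⇒nCk≡0 (NP.n<1+n n))) ⟩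
      sumTo (suc n) (λ k → t k * x k) ≡⟨ sumTo-first n (λ k → t k * x k) ⟩
      1ℚ * 1ℚ * x 0 + sumTo n (λ k → t (suc k) * x (suc k)) ∎

  private
    div-≤ : ∀ d .{{_ : N.NonZero d}} x y k l → y N.< d → x N.< d → Z.+ x Z.+ k Z.* Z.+ d ≡ Z.+ y Z.+ l Z.* Z.+ d → k Z.≤ l
    div-≤ d@(suc _) x y k l y<d x<d e = ZP.≮⇒≥ λ l<k → ZP.<-irrefl (sym e) (begin-strict
      Z.+ y Z.+ l Z.* Z.+ d <⟨ ZP.+-monoˡ-< (l Z.* Z.+ d) (Z.+<+ y<d) ⟩
      Z.+ d Z.+ l Z.* Z.+ d ≡⟨ r₁ (Z.+ d) l ⟩
      Z.suc l Z.* Z.+ d ≤⟨ ZP.*-monoʳ-≤-nonNeg (Z.+ d) (ZP.i<j⇒suc[i]≤j l<k) ⟩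
      k Z.* Z.+ d ≤⟨ ZP.i≤j+i (k Z.* Z.+ d) (Z.+ x) ⟩
      Z.+ x Z.+ k Z.* Z.+ d ∎)
      where
      open ZP.≤-Reasoning
      r₁ : ∀ d l → d Z.+ l Z.* d ≡ (Z.1ℤ Z.+ l) Z.* d
      r₁ = ZS.solve-∀

  divMod-unique : ∀ d x ρ k → ρ N.< d → x ≡ Z.+ ρ Z.+ k Z.* Z.+ d → fdiv x d ≡ k × fmod x d ≡ ρ
  divMod-unique d@(suc _) x ρ k ρ<d e = k≡ , ρ≡
    where
    e′ : Z.+ (x Z.%ℕ d) Z.+ (x Z./ℕ d) Z.* Z.+ d ≡ Z.+ ρ Z.+ k Z.* Z.+ d
    e′ = trans (sym (ZD.a≡a%ℕn+[a/ℕn]*n x d)) e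
    k≡ : fdiv x d ≡ k
    k≡ = ZP.≤-antisym (div-≤ d (x Z.%ℕ d) ρ (x Z./ℕ d) k ρ<d (ZD.n%ℕd<d x d) e′) (div-≤ d ρ (x Z.%ℕ d) k (x Z./ℕ d) (ZD.n%ℕd<d x d) ρ<d (sym e′))
    ρ≡ : fmod x d ≡ ρ
    ρ≡ = ZP.+-injective (∙-cancelʳ (k Z.* Z.+ d) (Z.+ (x Z.%ℕ d)) (Z.+ ρ) (trans (cong (λ j → Z.+ (x Z.%ℕ d) Z.+ j Z.* Z.+ d) (sym k≡)) e′))

  divMod-spec : ∀ d x .{{_ : N.NonZero d}} → x ≡ Z.+ fmod x d Z.+ fdiv x d Z.* Z.+ d × fmod x d N.< d
  divMod-spec d@(suc _) x = ZD.a≡a%ℕn+[a/ℕn]*n x d , ZD.n%ℕd<d x d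

  -- The sign of `r` is reversed because a difference operator evaluates at `r - k`, whereas the
  -- Fleck sum involves `k - r`.
  fleck : ℕ → ℕ → ℤ → ℚ
  fleck q l r = iv (fmod (Z.- r) q N.≟ 0) * binomℚ (ℤtoℚ (fdiv (Z.- r) q)) l

  fleckSum≡act : ∀ p a l n r → fleckSum p a l n r ≡ act (Δ ^ n) (fleck (p N.^ a) l) r
  fleckSum≡act p a l n r = trans (sumTo-cong n λ k _ → trans (r₁ (iv (fmod (Z.+ k Z.- r) (p N.^ a) N.≟ 0)) (ℕtoℚ (n C k)) (sgn k) (binomℚ (ℤtoℚ (fdiv (Z.+ k Z.- r) (p N.^ a))) l))
      (cong (λ z → ℕtoℚ (n C k) * sgn k * (iv (fmod z (p N.^ a) N.≟ 0) * binomℚ (ℤtoℚ (fdiv z (p N.^ a))) l)) (flip r (Z.+ k))))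
    (sym (act-Δ^ n (fleck (p N.^ a) l) r))
    where
    r₁ : ∀ i c s b → i * c * s * b ≡ c * s * (i * b)
    r₁ = solve-∀ ℚ-ring
    flip : ∀ r k → k Z.- r ≡ Z.- (r Z.- k)
    flip = ZS.solve-∀

  infix 4 _∣ᶻ_

  _∣ᶻ_ : ℕ → ℤ → Set
  q ∣ᶻ r = ∃ λ z → r ≡ Z.+ q Z.* z

  module _ (q : ℕ) .{{_ : N.NonZero q}} where

    fleck-on : ∀ l z → fleck q l (Z.+ q Z.* z) ≡ binomℚ (ℤtoℚ (Z.- z)) l
    fleck-on l z with divMod-unique q (Z.- (Z.+ q Z.* z)) 0 (Z.- z) (N.>-nonZero⁻¹ q) (r₁ (Z.+ q) z)
      where
      r₁ : ∀ q z → Z.- (q Z.* z) ≡ Z.0ℤ Z.+ Z.- z Z.* q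
      r₁ = ZS.solve-∀
    ... | e , e′ = trans (cong₂ (λ m k → iv (m N.≟ 0) * binomℚ (ℤtoℚ k) l) e′ e) (QP.*-identityˡ (binomℚ (ℤtoℚ (Z.- z)) l))

    private
      fmod≡0⇒∣ : ∀ r → fmod (Z.- r) q ≡ 0 → q ∣ᶻ r
      fmod≡0⇒∣ r e = Z.- fdiv (Z.- r) q , trans (sym (ZP.neg-involutive r))
        (trans (cong Z.-_ (trans (proj₁ (divMod-spec q (Z.- r))) (cong (λ m → Z.+ m Z.+ fdiv (Z.- r) q Z.* Z.+ q) e))) (r₁ (Z.+ q) (fdiv (Z.- r) q)))
        where
        r₁ : ∀ q z → Z.- (Z.0ℤ Z.+ z Z.* q) ≡ q Z.* Z.- z
        r₁ = ZS.solve-∀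

    fleck-off : ∀ l r → ¬ q ∣ᶻ r → fleck q l r ≡ 0ℚ
    fleck-off l r q∤r with fmod (Z.- r) q N.≟ 0
    ... | yes e = ⊥-elim (q∤r (fmod≡0⇒∣ r e))
    ... | no _ = QP.*-zeroˡ (binomℚ (ℤtoℚ (fdiv (Z.- r) q)) l)

    _∣ᶻ?_ : ∀ r → q ∣ᶻ r ⊎ ¬ q ∣ᶻ r
    _∣ᶻ?_ r with fmod (Z.- r) q N.≟ 0
    ... | yes e = inj₁ (fmod≡0⇒∣ r e)
    ... | no ne = inj₂ λ { (z , refl) → ne (proj₂ (divMod-unique q (Z.- (Z.+ q Z.* z)) 0 (Z.- z) (N.>-nonZero⁻¹ q) (r₁ (Z.+ q) z))) }
      where
      r₁ : ∀ q z → Z.- (q Z.* z) ≡ Z.0ℤ Z.+ Z.- z Z.* q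
      r₁ = ZS.solve-∀

    ∣ᶻ-shift : ∀ r → q ∣ᶻ r Z.- Z.+ q → q ∣ᶻ r
    ∣ᶻ-shift r (z , e) = Z.suc z , trans (r₁ r (Z.+ q)) (trans (cong (λ x → x Z.+ Z.+ q) e) (r₂ (Z.+ q) z))
      where
      r₁ : ∀ r q → r ≡ r Z.- q Z.+ q
      r₁ = ZS.solve-∀
      r₂ : ∀ q z → q Z.* z Z.+ q ≡ q Z.* (Z.1ℤ Z.+ z)
      r₂ = ZS.solve-∀

    private
      shift-on : ∀ l z → fleck q l (Z.+ q Z.* z Z.- Z.+ q) ≡ binomℚ (1ℚ + ℤtoℚ (Z.- z)) l
      shift-on l z = trans (cong (fleck q l) (r₁ (Z.+ q) z)) (trans (fleck-on l (z Z.- Z.1ℤ))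
          (cong (λ x → binomℚ x l) (trans (cong ℤtoℚ (r₂ z)) (ℤtoℚ-+ Z.1ℤ (Z.- z)))))
        where
        r₁ : ∀ q z → q Z.* z Z.- q ≡ q Z.* (z Z.- Z.1ℤ)
        r₁ = ZS.solve-∀
        r₂ : ∀ z → Z.- (z Z.- Z.1ℤ) ≡ Z.1ℤ Z.+ Z.- z
        r₂ = ZS.solve-∀

    fleck-shift-0 : ∀ r → act (∇ (σ q)) (fleck q 0) r ≡ 0ℚ
    fleck-shift-0 r with _∣ᶻ?_ r
    ... | inj₁ (z , refl) = cong₂ (λ a b → 1ℚ * a + - 1ℚ * b) (fleck-on 0 z) (shift-on 0 z)
    ... | inj₂ q∤r = cong₂ (λ a b → 1ℚ * a + - 1ℚ * b) (fleck-off 0 r q∤r) (fleck-off 0 (r Z.- Z.+ q) (q∤r ∘ ∣ᶻ-shift r))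

    -- On multiples of `q` the shift raises the upper argument of the binomial coefficient by one,
    -- and Pascal's rule applies. Elsewhere everything is zero.
    fleck-shift-suc : ∀ l r → act (∇ (σ q)) (fleck q (suc l)) r ≡ - fleck q l r
    fleck-shift-suc l r with _∣ᶻ?_ r
    ... | inj₁ (z , refl) = trans (cong₂ (λ a b → 1ℚ * a + - 1ℚ * b) (fleck-on (suc l) z)
        (trans (shift-on (suc l) z) (binomℚ-pascal (ℤtoℚ (Z.- z)) l)))
      (trans (r₁ (binomℚ (ℤtoℚ (Z.- z)) (suc l)) (binomℚ (ℤtoℚ (Z.- z)) l)) (cong -_ (sym (fleck-on l z))))
      where
      r₁ : ∀ a b → 1ℚ * a + - 1ℚ * (a + b) ≡ - b
      r₁ = solve-∀ ℚ-ring
    ... | inj₂ q∤r = trans (cong₂ (λ a b → 1ℚ * a + - 1ℚ * b) (fleck-off (suc l) r q∤r) (fleck-off (suc l) (r Z.- Z.+ q) (q∤r ∘ ∣ᶻ-shift r)))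
      (cong -_ (sym (fleck-off l r q∤r)))

    fleck-integer : ∀ l r → ∃ λ u → fleck q l r ≡ ℤtoℚ u
    fleck-integer l r with _∣ᶻ?_ r
    ... | inj₁ (z , refl) = let u , e = binomℚ-integer l (Z.- z) in u , trans (fleck-on l z) e
    ... | inj₂ q∤r = Z.0ℤ , fleck-off l r q∤r

  fleck-scale : ∀ m q .{{_ : N.NonZero m}} .{{_ : N.NonZero q}} l r → fleck (m N.* q) l (Z.+ m Z.* r) ≡ fleck q l r
  fleck-scale m@(suc _) q l r with _∣ᶻ?_ q r
  ... | inj₁ (z , refl) = trans (cong (fleck (m N.* q) l) (trans (sym (ZP.*-assoc (Z.+ m) (Z.+ q) z)) (cong (Z._* z) (sym (ZP.pos-* m q)))))
      (trans (fleck-on (m N.* q) {{NP.m*n≢0 m q}} l z) (sym (fleck-on q l z)))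
  ... | inj₂ q∤r = trans (fleck-off (m N.* q) {{NP.m*n≢0 m q}} l (Z.+ m Z.* r)
      λ (z , e) → q∤r (z , ZP.*-cancelˡ-≡ (Z.+ m) r (Z.+ q Z.* z) (trans e (trans (cong (Z._* z) (ZP.pos-* m q)) (ZP.*-assoc (Z.+ m) (Z.+ q) z)))))
    (sym (fleck-off q l r q∤r))

  fleck-sparse : ∀ m q .{{_ : N.NonZero m}} .{{_ : N.NonZero q}} l r → ¬ m ∣ᶻ r → fleck (m N.* q) l r ≡ 0ℚ
  fleck-sparse m q l r m∤r = fleck-off (m N.* q) {{NP.m*n≢0 m q}} l r
    λ (z , e) → m∤r (Z.+ q Z.* z , trans e (trans (cong (Z._* z) (ZP.pos-* m q)) (ZP.*-assoc (Z.+ m) (Z.+ q) z)))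

-- Divisibility by counting weights

module Weights (p : ℕ) (p-prime : Prime p) where

  open Rationals
  open Operators
  open FleckFunction
  open Valuation p p-prime
  open Freshman p p-prime
  import Data.Nat.Properties as NP
  import Data.Nat.Tactic.RingSolver as NS
  import Data.Integer as Z
  open import Data.Rational using (_+_; _*_; _-_; -_)
  import Data.Rational.Properties as QP
  open import Data.Product using (_,_)
  open import Relation.Binary.PropositionalEquality

  p′ : ℕ
  p′ = N.pred p

  p≡ : p ≡ suc p′
  p≡ = sym (NP.suc-pred p)

  1≤p′ : 1 N.≤ p′
  1≤p′ = NP.≤-pred (subst (2 N.≤_) p≡ 1<p)

  ≼-act : ∀ {k f} A → (∀ r → k ≼ f r) → ∀ r → k ≼ act A f r
  ≼-act (κ c) h r = ≼-*ʳ (int-ℤ c) (h r)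
  ≼-act (σ m) h r = h (r Z.- Z.+ m)
  ≼-act (A ⊕ B) h r = ≼-+ (≼-act A h r) (≼-act B h r)
  ≼-act (A ⊗ B) h r = ≼-act A (≼-act B h) r

  ≼-fleck : ∀ q .{{_ : N.NonZero q}} l r → 0 ≼ fleck q l r
  ≼-fleck q l r = let u , e = fleck-integer q l r in ≼-resp (sym e) (≼-int (int-ℤ u))

  -- As A^p = (1 - σ q) + p A h and 1 - σ q lowers l, give A weight 1 and p weight p - 1; then lowering l costs weight p.
  weight : ℕ → ℕ → ℕ
  weight l j = l N.* p N.+ suc (p′ N.* j)

  weight-suc-j : ∀ l j → weight l (suc j) ≡ weight l j N.+ p′
  weight-suc-j l j = trans (cong (λ a → l N.* p N.+ suc a) (NP.*-suc p′ j)) (r (l N.* p) p′ (p′ N.* j))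
    where
    r : ∀ a b c → a N.+ suc (b N.+ c) ≡ a N.+ suc c N.+ b
    r = NS.solve-∀

  weight-suc-l : ∀ l j → weight (suc l) j ≡ p N.+ weight l j
  weight-suc-l l j = NP.+-assoc p (l N.* p) (suc (p′ N.* j))

  module _ (m : ℕ) .{{_ : N.NonZero m}} where

    private
      q = p N.* m
      instance
        q≢0 : N.NonZero q
        q≢0 = NP.m*n≢0 p m
      A = ∇ (σ m)
      h = sub m h₀

    A^[p+n] : ∀ n → A ^ (p N.+ n) ≈ A ^ n ⊗ ∇ (σ q) ⊕ κℕ p ⊗ (h ⊗ A ^ suc n)
    A^[p+n] n = ≈-trans (^-homo-* A p n) (≈-trans (*-cong (∇σ^p m) (≈-refl {A ^ n}))
      (solve 5 (λ a x d p h → (d :+ p :* (a :* h)) :* x := x :* d :+ p :* (h :* (a :* x))) ≈-refl A (A ^ n) (∇ (σ q)) (κℕ p) h))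

    -- The bound says `j ≤ (n - l p - 1) / (p - 1)`, which is Fleck's exponent. One `A^p` is
    -- exchanged: the summand with `1 - σ q` lowers `l` and uses weight `p`, the other one trades
    -- `p - 1` factors `A` for a factor `p`.
    ≼-A^ : ∀ l j n → weight l j N.≤ n → ∀ r → j ≼ act (A ^ n) (fleck q l) r
    ≼-A^ l zero n _ = ≼-act (A ^ n) (≼-fleck q l)
    ≼-A^ l (suc j) n w≤n r = subst (λ n → suc j ≼ act (A ^ n) (fleck q l) r) (NP.m+[n∸m]≡n p≤n)
      (≼-resp (sym (at (A^[p+n] n′) (fleck q l) r))
        (≼-+ (first l w≤) (≼-P* (≼-act h (≼-A^ l j (suc n′) w≤′) r))))
      where
      n′ = n N.∸ p
      p≤w : p N.≤ weight l (suc j)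
      p≤w = subst (N._≤ weight l (suc j)) (sym p≡)
        (NP.≤-trans (N.s≤s (NP.≤-trans (NP.m≤m+n p′ (p′ N.* j)) (NP.≤-reflexive (sym (NP.*-suc p′ j))))) (NP.m≤n+m (suc (p′ N.* suc j)) (l N.* p)))
      p≤n = NP.≤-trans p≤w w≤n
      w≤ : weight l (suc j) N.≤ p N.+ n′
      w≤ = subst (weight l (suc j) N.≤_) (sym (NP.m+[n∸m]≡n p≤n)) w≤n
      w≤′ : weight l j N.≤ suc n′
      w≤′ = NP.+-cancelʳ-≤ p′ (weight l j) (suc n′) (subst₂ N._≤_ (weight-suc-j l j) (trans (cong (N._+ n′) p≡) (cong suc (NP.+-comm p′ n′))) w≤)
      first : ∀ l → weight l (suc j) N.≤ p N.+ n′ → suc j ≼ act (A ^ n′) (act (∇ (σ q)) (fleck q l)) r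
      first zero _ = ≼-resp (sym (trans (act-cong (A ^ n′) (fleck-shift-0 q) r) (act-0 (A ^ n′) r))) ≼-0
      first (suc l) w≤ = ≼-resp (sym (trans (act-cong (A ^ n′) (fleck-shift-suc q l) r) (act-neg (A ^ n′) (fleck q l) r)))
        (≼-neg (≼-A^ l (suc j) n′ (NP.+-cancelˡ-≤ p (weight l (suc j)) n′ (subst (N._≤ p N.+ n′) (weight-suc-l l (suc j)) w≤)) r))

    module _ (D : Op) where

      private
        B = A ⊕ κℕ p ⊗ D

      -- A factor `B` is as good as an `A`: its summand `p D` lacks one unit of weight, but
      -- contributes a `p`, worth at least one unit.
      ≼-A^B^ : ∀ l j k n → weight l j N.≤ k N.+ n → ∀ r → j ≼ act (A ^ k ⊗ B ^ n) (fleck q l) r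
      ≼-A^B^ l j k zero w r = ≼-resp (act-cong (A ^ k) (λ i → sym (QP.*-identityˡ (fleck q l i))) r)
        (≼-A^ l j k (subst (weight l j N.≤_) (NP.+-identityʳ k) w) r)
      ≼-A^B^ l zero k (suc n) w = ≼-act (A ^ k ⊗ B ^ suc n) (≼-fleck q l)
      ≼-A^B^ l (suc j) k (suc n) w r = ≼-resp
        (sym (at (solve 5 (λ a x y p d → x :* ((a :+ p :* d) :* y) := a :* x :* y :+ p :* (d :* (x :* y))) ≈-refl A (A ^ k) (B ^ n) (κℕ p) D) (fleck q l) r))
        (≼-+ (≼-A^B^ l (suc j) (suc k) n (subst (weight l (suc j) N.≤_) (NP.+-suc k n) w) r)
          (≼-P* (≼-act D (≼-A^B^ l j k n (NP.+-cancelʳ-≤ 1 (weight l j) (k N.+ n)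
            (NP.≤-trans (NP.+-monoʳ-≤ (weight l j) 1≤p′)
              (subst₂ N._≤_ (weight-suc-j l j) (trans (NP.+-suc k n) (sym (NP.+-comm (k N.+ n) 1))) w)))) r)))

-- Formal power series and the coefficients of e^(-rx) ((e^x - 1)/x)^n

module PowerSeries where

  open Rationals
  open import Data.Nat using (_!)
  import Data.Nat.Properties as NP
  open import Data.Integer as Z using (ℤ)
  import Data.Integer.Tactic.RingSolver as ZS
  open import Data.List using (List; []; _∷_)
  open import Data.Rational using (ℚ; 0ℚ; 1ℚ; _+_; _*_; _-_; -_)
  import Data.Rational.Properties as QP
  open import Function using (_∘_)
  open import Relation.Binary.PropositionalEquality
  open import Tactic.RingSolver using (solve-∀)

  infix 4 _≗ˢ_

  _≗ˢ_ : Series → Series → Set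
  f ≗ˢ g = ∀ k → f k ≡ g k

  mulS-cong : ∀ {f f′ g g′} → f ≗ˢ f′ → g ≗ˢ g′ → mulS f g ≗ˢ mulS f′ g′
  mulS-cong e e′ k = sumTo-cong k λ j _ → cong₂ _*_ (e j) (e′ (k N.∸ j))

  mulS-sucˡ : ∀ f g k → mulS f g (suc k) ≡ f 0 * g (suc k) + mulS (f ∘ suc) g k
  mulS-sucˡ f g k = sumTo-first k (λ j → f j * g (suc k N.∸ j))

  mulS-sucʳ : ∀ f g k → mulS f g (suc k) ≡ mulS f (g ∘ suc) k + f (suc k) * g 0
  mulS-sucʳ f g k = cong₂ (λ a b → a + f (suc k) * g b)
    (sumTo-cong k λ j j≤k → cong (λ i → f j * g i) (NP.+-∸-assoc 1 j≤k)) (NP.n∸n≡0 k)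

  mulS-comm : ∀ f g → mulS f g ≗ˢ mulS g f
  mulS-comm f g zero = QP.*-comm (f 0) (g 0)
  mulS-comm f g (suc k) = trans (mulS-sucˡ f g k) (trans (cong (λ x → f 0 * g (suc k) + x) (mulS-comm (f ∘ suc) g k))
    (trans (r₁ (f 0) (g (suc k)) (mulS g (f ∘ suc) k)) (sym (mulS-sucʳ g f k))))
    where
    r₁ : ∀ a b c → a * b + c ≡ c + b * a
    r₁ = solve-∀ ℚ-ring

  mulS-+ʳ : ∀ f g h k → mulS f (λ i → g i + h i) k ≡ mulS f g k + mulS f h k
  mulS-+ʳ f g h k = trans (sumTo-cong k λ j _ → QP.*-distribˡ-+ (f j) (g (k N.∸ j)) (h (k N.∸ j)))
    (sumTo-+ k (λ j → f j * g (k N.∸ j)) (λ j → f j * h (k N.∸ j)))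

  mulS-*ʳ : ∀ f c g k → mulS f (λ i → c * g i) k ≡ c * mulS f g k
  mulS-*ʳ f c g k = trans (sumTo-cong k λ j _ → r₁ (f j) c (g (k N.∸ j))) (sumTo-*ˡ k c (λ j → f j * g (k N.∸ j)))
    where
    r₁ : ∀ a b c → a * (b * c) ≡ b * (a * c)
    r₁ = solve-∀ ℚ-ring

  mulS-+ˡ : ∀ f g h k → mulS (λ i → g i + h i) f k ≡ mulS g f k + mulS h f k
  mulS-+ˡ f g h k = trans (mulS-comm (λ i → g i + h i) f k) (trans (mulS-+ʳ f g h k) (cong₂ _+_ (mulS-comm f g k) (mulS-comm f h k)))

  mulS-*ˡ : ∀ f c g k → mulS (λ i → c * g i) f k ≡ c * mulS g f k
  mulS-*ˡ f c g k = trans (mulS-comm (λ i → c * g i) f k) (trans (mulS-*ʳ f c g k) (cong (λ x → c * x) (mulS-comm f g k)))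

  mulS-assoc : ∀ f g h → mulS (mulS f g) h ≗ˢ mulS f (mulS g h)
  mulS-assoc f g h zero = QP.*-assoc (f 0) (g 0) (h 0)
  mulS-assoc f g h (suc k) = begin
    mulS (mulS f g) h (suc k) ≡⟨ mulS-sucˡ (mulS f g) h k ⟩
    f 0 * g 0 * h (suc k) + mulS (mulS f g ∘ suc) h k
      ≡⟨ cong (λ x → f 0 * g 0 * h (suc k) + x) (trans (mulS-cong {g = h} (mulS-sucˡ f g) (λ _ → refl) k)
          (trans (mulS-+ˡ h (λ i → f 0 * g (suc i)) (mulS (f ∘ suc) g) k)
            (cong₂ _+_ (mulS-*ˡ h (f 0) (g ∘ suc) k) (mulS-assoc (f ∘ suc) g h k)))) ⟩
    f 0 * g 0 * h (suc k) + (f 0 * mulS (g ∘ suc) h k + mulS (f ∘ suc) (mulS g h) k)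
      ≡⟨ r₁ (f 0) (g 0) (h (suc k)) (mulS (g ∘ suc) h k) (mulS (f ∘ suc) (mulS g h) k) ⟩
    f 0 * (g 0 * h (suc k) + mulS (g ∘ suc) h k) + mulS (f ∘ suc) (mulS g h) k
      ≡⟨ cong (λ x → f 0 * x + mulS (f ∘ suc) (mulS g h) k) (mulS-sucˡ g h k) ⟨
    f 0 * mulS g h (suc k) + mulS (f ∘ suc) (mulS g h) k ≡⟨ mulS-sucˡ f (mulS g h) k ⟨
    mulS f (mulS g h) (suc k) ∎
    where
    open ≡-Reasoning
    r₁ : ∀ a b c d e → a * b * c + (a * d + e) ≡ a * (b * c + d) + e
    r₁ = solve-∀ ℚ-ring

  mulS-swap : ∀ f g h → mulS f (mulS g h) ≗ˢ mulS g (mulS f h)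
  mulS-swap f g h k = trans (sym (mulS-assoc f g h k)) (trans (mulS-cong {g = h} (mulS-comm f g) (λ _ → refl) k) (mulS-assoc g f h k))

  oneS : Series
  oneS zero = 1ℚ
  oneS (suc k) = 0ℚ

  powS-zero : ∀ f → powS f 0 ≗ˢ oneS
  powS-zero f zero = refl
  powS-zero f (suc k) = refl

  mulS-0ˡ : ∀ g k → mulS (λ _ → 0ℚ) g k ≡ 0ℚ
  mulS-0ˡ g k = trans (mulS-*ˡ g 0ℚ (λ _ → 0ℚ) k) (QP.*-zeroˡ (mulS (λ _ → 0ℚ) g k))

  mulS-oneˡ : ∀ g → mulS oneS g ≗ˢ g
  mulS-oneˡ g zero = QP.*-identityˡ (g 0)
  mulS-oneˡ g (suc k) = trans (mulS-sucˡ oneS g k) (trans (cong₂ _+_ (QP.*-identityˡ (g (suc k))) (mulS-0ˡ g k)) (QP.+-identityʳ (g (suc k))))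

  powS-+ : ∀ f m n → powS f (m N.+ n) ≗ˢ mulS (powS f m) (powS f n)
  powS-+ f zero n k = sym (trans (mulS-cong {g = powS f n} (powS-zero f) (λ _ → refl) k) (mulS-oneˡ (powS f n) k))
  powS-+ f (suc m) n k = trans (mulS-cong {f} (λ _ → refl) (powS-+ f m n) k) (sym (mulS-assoc f (powS f m) (powS f n) k))

  powS-inverse : ∀ f g → mulS f g ≗ˢ oneS → ∀ m → mulS (powS f m) (powS g m) ≗ˢ oneS
  powS-inverse f g e zero k = trans (mulS-cong (powS-zero f) (powS-zero g) k) (mulS-oneˡ oneS k)
  powS-inverse f g e (suc m) k = begin
    mulS (mulS f (powS f m)) (mulS g (powS g m)) k ≡⟨ mulS-assoc f (powS f m) (mulS g (powS g m)) k ⟩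
    mulS f (mulS (powS f m) (mulS g (powS g m))) k ≡⟨ mulS-cong {f} (λ _ → refl) (mulS-swap (powS f m) g (powS g m)) k ⟩
    mulS f (mulS g (mulS (powS f m) (powS g m))) k ≡⟨ mulS-assoc f g (mulS (powS f m) (powS g m)) k ⟨
    mulS (mulS f g) (mulS (powS f m) (powS g m)) k ≡⟨ mulS-cong e (powS-inverse f g e m) k ⟩
    mulS oneS oneS k ≡⟨ mulS-oneˡ oneS k ⟩
    oneS k ∎
    where open ≡-Reasoning

  powS-0 : ∀ f m → f 0 ≡ 1ℚ → powS f m 0 ≡ 1ℚ
  powS-0 f zero e = refl
  powS-0 f (suc m) e = trans (cong₂ _*_ e (powS-0 f m e)) refl

  -- The derivation x d/dx, preferred to d/dx because it leaves indices in place.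
  θ : Series → Series
  θ f k = ℕtoℚ k * f k

  θ-mulS : ∀ f g k → θ (mulS f g) k ≡ mulS (θ f) g k + mulS f (θ g) k
  θ-mulS f g k = trans (sym (sumTo-*ˡ k (ℕtoℚ k) (λ j → f j * g (k N.∸ j))))
    (trans (sumTo-cong k λ j j≤k → trans (cong (λ x → x * (f j * g (k N.∸ j)))
        (trans (cong ℕtoℚ (sym (NP.m+[n∸m]≡n j≤k))) (ℕtoℚ-+ j (k N.∸ j)))) (r₁ (ℕtoℚ j) (ℕtoℚ (k N.∸ j)) (f j) (g (k N.∸ j))))
      (sumTo-+ k (λ j → θ f j * g (k N.∸ j)) (λ j → f j * θ g (k N.∸ j))))
    where
    r₁ : ∀ a b x y → (a + b) * (x * y) ≡ a * x * y + x * (b * y)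
    r₁ = solve-∀ ℚ-ring

  θ-powS : ∀ f n k → θ (powS f (suc n)) k ≡ ℕtoℚ (suc n) * mulS (powS f n) (θ f) k
  θ-powS f zero k = begin
    θ (mulS f (powS f 0)) k ≡⟨ cong (λ x → ℕtoℚ k * x) (trans (mulS-comm f (powS f 0) k) (trans (mulS-cong {g = f} (powS-zero f) (λ _ → refl) k) (mulS-oneˡ f k))) ⟩
    θ f k ≡⟨ trans (mulS-cong {g = θ f} (powS-zero f) (λ _ → refl) k) (mulS-oneˡ (θ f) k) ⟨
    mulS (powS f 0) (θ f) k ≡⟨ QP.*-identityˡ (mulS (powS f 0) (θ f) k) ⟨
    1ℚ * mulS (powS f 0) (θ f) k ∎
    where open ≡-Reasoning
  θ-powS f (suc n) k = begin
    θ (mulS f (powS f (suc n))) k ≡⟨ θ-mulS f (powS f (suc n)) k ⟩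
    mulS (θ f) (powS f (suc n)) k + mulS f (θ (powS f (suc n))) k
      ≡⟨ cong₂ _+_ (mulS-comm (θ f) (powS f (suc n)) k)
        (trans (mulS-cong {f} (λ _ → refl) (θ-powS f n) k) (trans (mulS-*ʳ f (ℕtoℚ (suc n)) (mulS (powS f n) (θ f)) k)
          (cong (λ x → ℕtoℚ (suc n) * x) (sym (mulS-assoc f (powS f n) (θ f) k))))) ⟩
    mulS (powS f (suc n)) (θ f) k + ℕtoℚ (suc n) * mulS (powS f (suc n)) (θ f) k
      ≡⟨ r₁ (mulS (powS f (suc n)) (θ f) k) (ℕtoℚ (suc n)) ⟩
    (1ℚ + ℕtoℚ (suc n)) * mulS (powS f (suc n)) (θ f) k
      ≡⟨ cong (λ x → x * mulS (powS f (suc n)) (θ f) k) (ℕtoℚ-suc (suc n)) ⟨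
    ℕtoℚ (suc (suc n)) * mulS (powS f (suc n)) (θ f) k ∎
    where
    open ≡-Reasoning
    r₁ : ∀ x n → x + n * x ≡ (1ℚ + n) * x
    r₁ = solve-∀ ℚ-ring

  private
    dot : Series → ℕ → List ℚ → ℚ
    dot f i [] = 0ℚ
    dot f i (g ∷ gs) = f (suc i) * g + dot f (suc i) gs

    dot-unique : ∀ (f : Series) (d : ℕ → List ℚ → ℚ) → (∀ i → d i [] ≡ 0ℚ) → (∀ i g gs → d i (g ∷ gs) ≡ f (suc i) * g + d (suc i) gs) →
      ∀ i gs → d i gs ≡ dot f i gs
    dot-unique f d h h′ i [] = h i
    dot-unique f d h h′ i (g ∷ gs) = trans (h′ i g gs) (cong (λ x → f (suc i) * g + x) (dot-unique f d h h′ (suc i) gs))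

    -- The summation inside invList has no name; unification finds it here.
    invS-dot : ∀ f k → invS f (suc k) ≡ - dot f 0 (invList f k)
    invS-dot f k with 0 | invList f k | dot-unique f _ (λ _ → refl) (λ _ _ _ → refl)
    ... | i | gs | H = cong -_ (H i gs)

    dot-invList : ∀ f i k → dot f i (invList f k) ≡ sumTo k (λ j → f (suc (i N.+ j)) * invS f (k N.∸ j))
    dot-invList f i zero = trans (QP.+-identityʳ (f (suc i) * 1ℚ)) (cong (λ n → f (suc n) * 1ℚ) (sym (NP.+-identityʳ i)))
    dot-invList f i (suc k) = trans (cong₂ _+_ (cong (λ n → f (suc n) * invS f (suc k)) (sym (NP.+-identityʳ i)))
        (trans (dot-invList f (suc i) k) (sumTo-cong k λ j _ → cong (λ n → f (suc n) * invS f (k N.∸ j)) (sym (NP.+-suc i j)))))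
      (sym (sumTo-first k (λ j → f (suc (i N.+ j)) * invS f (suc k N.∸ j))))

  invS-suc : ∀ f k → invS f (suc k) ≡ - mulS (f ∘ suc) (invS f) k
  invS-suc f k = trans (invS-dot f k) (cong -_ (dot-invList f 0 k))

  mulS-invS : ∀ f → f 0 ≡ 1ℚ → mulS (invS f) f ≗ˢ oneS
  mulS-invS f e zero = trans (QP.*-identityˡ (f 0)) e
  mulS-invS f e (suc k) = begin
    mulS (invS f) f (suc k) ≡⟨ mulS-comm (invS f) f (suc k) ⟩
    mulS f (invS f) (suc k) ≡⟨ mulS-sucˡ f (invS f) k ⟩
    f 0 * invS f (suc k) + mulS (f ∘ suc) (invS f) k ≡⟨ cong₂ (λ a b → a * b + mulS (f ∘ suc) (invS f) k) e (invS-suc f k) ⟩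
    1ℚ * - mulS (f ∘ suc) (invS f) k + mulS (f ∘ suc) (invS f) k ≡⟨ r₁ (mulS (f ∘ suc) (invS f) k) ⟩
    0ℚ ∎
    where
    open ≡-Reasoning
    r₁ : ∀ x → 1ℚ * - x + x ≡ 0ℚ
    r₁ = solve-∀ ℚ-ring

  invFact : ℕ → ℚ
  invFact k = inv (k !) {{k NP.!≢0}}

  invFact-* : ∀ k → invFact k * ℕtoℚ (k !) ≡ 1ℚ
  invFact-* k = inv-* (k !) {{k NP.!≢0}}

  invFact-suc : ∀ k → invFact (suc k) * ℕtoℚ (suc k) ≡ invFact k
  invFact-suc k = *-cancel (k !) {{k NP.!≢0}} (begin
    invFact (suc k) * ℕtoℚ (suc k) * ℕtoℚ (k !) ≡⟨ QP.*-assoc (invFact (suc k)) (ℕtoℚ (suc k)) (ℕtoℚ (k !)) ⟩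
    invFact (suc k) * (ℕtoℚ (suc k) * ℕtoℚ (k !)) ≡⟨ cong (λ x → invFact (suc k) * x) (ℕtoℚ-* (suc k) (k !)) ⟨
    invFact (suc k) * ℕtoℚ (suc k !) ≡⟨ invFact-* (suc k) ⟩
    1ℚ ≡⟨ invFact-* k ⟨
    invFact k * ℕtoℚ (k !) ∎)
    where open ≡-Reasoning

  expS-suc : ∀ t k → ℕtoℚ (suc k) * expS t (suc k) ≡ t * expS t k
  expS-suc t k = trans (r₁ (ℕtoℚ (suc k)) t (powℚ t k) (invFact (suc k))) (cong (λ x → t * (powℚ t k * x)) (invFact-suc k))
    where
    r₁ : ∀ n t x i → n * (t * x * i) ≡ t * (x * (i * n))
    r₁ = solve-∀ ℚ-ring

  -- Both sides solve `θ f = (t + u) x f` with constant term 1, and this equation determines each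
  -- coefficient from the one before.
  expS-+ : ∀ t u → expS (t + u) ≗ˢ mulS (expS t) (expS u)
  expS-+ t u zero = refl
  expS-+ t u (suc k) = *-cancel (suc k) (begin
    expS (t + u) (suc k) * ℕtoℚ (suc k) ≡⟨ QP.*-comm (expS (t + u) (suc k)) (ℕtoℚ (suc k)) ⟩
    ℕtoℚ (suc k) * expS (t + u) (suc k) ≡⟨ expS-suc (t + u) k ⟩
    (t + u) * expS (t + u) k ≡⟨ cong (λ x → (t + u) * x) (expS-+ t u k) ⟩
    (t + u) * mulS e f k ≡⟨ r₁ t u (mulS e f k) (f (suc k)) (e (suc k)) ⟩
    0ℚ * 1ℚ * f (suc k) + t * mulS e f k + (u * mulS e f k + e (suc k) * (0ℚ * 1ℚ))
      ≡⟨ cong₂ (λ a b → 0ℚ * 1ℚ * f (suc k) + a + (b + e (suc k) * (0ℚ * 1ℚ)))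
          (trans (sym (mulS-*ˡ f t e k)) (mulS-cong {g = f} (λ i → sym (expS-suc t i)) (λ _ → refl) k))
          (trans (sym (mulS-*ʳ e u f k)) (mulS-cong {e} (λ _ → refl) (λ i → sym (expS-suc u i)) k)) ⟩
    θ e 0 * f (suc k) + mulS (θ e ∘ suc) f k + (mulS e (θ f ∘ suc) k + e (suc k) * θ f 0)
      ≡⟨ cong₂ _+_ (mulS-sucˡ (θ e) f k) (mulS-sucʳ e (θ f) k) ⟨
    mulS (θ e) f (suc k) + mulS e (θ f) (suc k) ≡⟨ θ-mulS e f (suc k) ⟨
    ℕtoℚ (suc k) * mulS e f (suc k) ≡⟨ QP.*-comm (ℕtoℚ (suc k)) (mulS e f (suc k)) ⟩
    mulS e f (suc k) * ℕtoℚ (suc k) ∎)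
    where
    open ≡-Reasoning
    e = expS t
    f = expS u
    r₁ : ∀ t u x y z → (t + u) * x ≡ 0ℚ * 1ℚ * y + t * x + (u * x + z * (0ℚ * 1ℚ))
    r₁ = solve-∀ ℚ-ring

  -- coeff n k r is the coefficient of x^k in e^{-rx} ((e^x - 1)/x)^n.
  coeff : ℕ → ℕ → ℤ → ℚ
  coeff n k r = mulS (expS (ℤtoℚ (Z.- r))) (powS expm1OverX n) k

  coeff-translate : ∀ n z r k → coeff n k (r Z.- z) ≡ mulS (expS (ℤtoℚ z)) (λ i → coeff n i r) k
  coeff-translate n z r k = trans
    (mulS-cong {g = powS expm1OverX n} (λ i → trans (cong (λ t → expS t i) (trans (cong ℤtoℚ (r₁ r z)) (ℤtoℚ-+ z (Z.- r)))) (expS-+ (ℤtoℚ z) (ℤtoℚ (Z.- r)) i)) (λ _ → refl) k)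
    (mulS-assoc (expS (ℤtoℚ z)) (expS (ℤtoℚ (Z.- r))) (powS expm1OverX n) k)
    where
    r₁ : ∀ r z → Z.- (r Z.- z) ≡ z Z.+ Z.- r
    r₁ = ZS.solve-∀

  -- Multiply by `e^x - 1`, which is x times `expm1OverX`: the factor `e^x` translates `r` by one,
  -- the factor x moves the index.
  coeff-suc : ∀ n k r → coeff (suc n) k r ≡ coeff n (suc k) (r Z.- Z.1ℤ) - coeff n (suc k) r
  coeff-suc n k r = begin
    coeff (suc n) k r ≡⟨ mulS-swap (expS (ℤtoℚ (Z.- r))) expm1OverX (powS expm1OverX n) k ⟩
    mulS expm1OverX G k ≡⟨ mulS-cong {g = G} (λ i → sym (trans (cong (λ x → x * invFact (suc i)) (powℚ-1 (suc i))) (QP.*-identityˡ (invFact (suc i))))) (λ _ → refl) k ⟩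
    mulS (expS 1ℚ ∘ suc) G k ≡⟨ r₁ (mulS (expS 1ℚ ∘ suc) G k) (G (suc k)) ⟩
    expS 1ℚ 0 * G (suc k) + mulS (expS 1ℚ ∘ suc) G k - G (suc k) ≡⟨ cong (λ x → x - G (suc k)) (trans (sym (mulS-sucˡ (expS 1ℚ) G k)) (sym (coeff-translate n Z.1ℤ r (suc k)))) ⟩
    coeff n (suc k) (r Z.- Z.1ℤ) - coeff n (suc k) r ∎
    where
    open ≡-Reasoning
    G : Series
    G i = coeff n i r
    r₁ : ∀ x y → x ≡ 1ℚ * y + x - y
    r₁ = solve-∀ ℚ-ring

-- These coefficients modulo p

module Coefficients (p : ℕ) (p-prime : Prime p) where

  open Rationals
  open PowerSeries
  open Operators
  open FleckFunction using (act-Δ)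
  open Valuation p p-prime
  open import Data.Nat using (_!)
  open import Data.Nat.Primality using (euclidsLemma)
  import Data.Nat.Properties as NP
  import Data.Nat.Divisibility as ND
  open import Data.Integer as Z using (ℤ)
  open import Data.Rational using (ℚ; 0ℚ; 1ℚ; _+_; _*_; _-_; -_)
  import Data.Rational.Properties as QP
  open import Data.Sum using (inj₁; inj₂)
  open import Function using (_∘_)
  open import Relation.Nullary using (¬_)
  open import Relation.Binary.PropositionalEquality
  open import Tactic.RingSolver using (solve-∀)

  p∤! : ∀ k → k N.< p → ¬ (p ND.∣ k !)
  p∤! zero _ = p∤1
  p∤! (suc k) k<p d with euclidsLemma (suc k) (k !) p-prime d
  ... | inj₁ d′ = NP.<⇒≱ k<p (ND.∣⇒≤ d′)
  ... | inj₂ d′ = p∤! k (NP.<-trans (NP.n<1+n k) k<p) d′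

  int-invFact : ∀ k → k N.< p → Integral (invFact k)
  int-invFact k k<p = int-inv (k !) {{k NP.!≢0}} (p∤! k k<p)

  -- The series `(e^x - 1)/x` has 1/p! in degree `p - 1`, so integrality at `p` holds only up to a
  -- bounded degree, which has to be carried along.
  Integral≤ : ℕ → Series → Set
  Integral≤ d f = ∀ k → k N.≤ d → Integral (f k)

  int-mulS : ∀ {d f g} → Integral≤ d f → Integral≤ d g → Integral≤ d (mulS f g)
  int-mulS {f = f} {g} i j k k≤d = int-≼ (≼-sum k (λ m → f m * g (k N.∸ m))
    λ m m≤k → ≼-int (int-* (i m (NP.≤-trans m≤k k≤d)) (j (k N.∸ m) (NP.≤-trans (NP.m∸n≤m k m) k≤d))))

  int-oneS : ∀ {d} → Integral≤ d oneS
  int-oneS zero _ = int-ℕ 1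
  int-oneS (suc k) _ = int-ℕ 0

  int-powS : ∀ {d f} → Integral≤ d f → ∀ n → Integral≤ d (powS f n)
  int-powS {f = f} i zero k k≤d = subst Integral (sym (powS-zero f k)) (int-oneS k k≤d)
  int-powS {f = f} i (suc n) = int-mulS {f = f} {powS f n} i (int-powS {f = f} i n)

  int-invS : ∀ {d f} → Integral≤ d f → Integral≤ d (invS f)
  int-invS {d} {f} i k = go k k NP.≤-refl
    where
    go : ∀ m k → k N.≤ m → k N.≤ d → Integral (invS f k)
    go m zero _ _ = int-ℕ 1
    go (suc m) (suc k) (N.s≤s k≤m) k≤d = subst Integral (sym (invS-suc f k))
      (int-neg (int-≼ (≼-sum k (λ j → f (suc j) * invS f (k N.∸ j))
        λ j j≤k → ≼-int (int-* (i (suc j) (NP.≤-trans (N.s≤s j≤k) k≤d))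
          (go m (k N.∸ j) (NP.≤-trans (NP.m∸n≤m k j) k≤m) (NP.≤-trans (NP.m∸n≤m k j) (NP.≤-trans (NP.n≤1+n k) k≤d)))))))

  int-expS : ∀ {d} z → d N.< p → Integral≤ d (expS (ℤtoℚ z))
  int-expS z d<p k k≤d = int-* (int-pow (int-ℤ z) k) (int-invFact k (NP.≤-<-trans k≤d d<p))

  int-expm1OverX : ∀ {d} → suc d N.< p → Integral≤ d expm1OverX
  int-expm1OverX d<p k k≤d = int-invFact (suc k) (NP.≤-<-trans (N.s≤s k≤d) d<p)

  int-coeff : ∀ n k r → suc k N.< p → Integral (coeff n k r)
  int-coeff n k r k<p = int-mulS {f = expS (ℤtoℚ (Z.- r))} {powS expm1OverX n} (int-expS (Z.- r) (NP.<-trans (NP.n<1+n k) k<p))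
    (int-powS {f = expm1OverX} (int-expm1OverX k<p) n) k NP.≤-refl

  infix 4 _≡ₚ_[≤_]

  _≡ₚ_[≤_] : Series → Series → ℕ → Set
  f ≡ₚ g [≤ d ] = ∀ k → k N.≤ d → 1 ≼ f k - g k

  ≗⇒≡ₚ : ∀ {f g d} → f ≗ˢ g → f ≡ₚ g [≤ d ]
  ≗⇒≡ₚ {f} {g} e k _ = ≼-resp (sym (trans (cong (λ x → x - g k) (e k)) (QP.+-inverseʳ (g k)))) ≼-0

  ≡ₚ-trans : ∀ {f g h d} → f ≡ₚ g [≤ d ] → g ≡ₚ h [≤ d ] → f ≡ₚ h [≤ d ]
  ≡ₚ-trans {f} {g} {h} e e′ k k≤d = ≼-resp (r₁ (f k) (g k) (h k)) (≼-+ (e k k≤d) (e′ k k≤d))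
    where
    r₁ : ∀ a b c → a - b + (b - c) ≡ a - c
    r₁ = solve-∀ ℚ-ring

  ≡ₚ-sym : ∀ {f g d} → f ≡ₚ g [≤ d ] → g ≡ₚ f [≤ d ]
  ≡ₚ-sym {f} {g} e k k≤d = ≼-resp (r₁ (f k) (g k)) (≼-neg (e k k≤d))
    where
    r₁ : ∀ a b → - (a - b) ≡ b - a
    r₁ = solve-∀ ℚ-ring

  ≡ₚ-mulSʳ : ∀ {f g h d} → Integral≤ d f → g ≡ₚ h [≤ d ] → mulS f g ≡ₚ mulS f h [≤ d ]
  ≡ₚ-mulSʳ {f} {g} {h} i e k k≤d = ≼-resp
    (trans (sym (sumTo-cong k λ j _ → r₁ (f j) (g (k N.∸ j)) (h (k N.∸ j))))
      (trans (mulS-+ʳ f g (λ j → - 1ℚ * h j) k) (trans (cong (λ x → mulS f g k + x) (mulS-*ʳ f (- 1ℚ) h k)) (r₂ (mulS f g k) (mulS f h k)))))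
    (≼-sum k (λ j → f j * (g (k N.∸ j) - h (k N.∸ j)))
      λ j j≤k → ≼-*ʳ (i j (NP.≤-trans j≤k k≤d)) (e (k N.∸ j) (NP.≤-trans (NP.m∸n≤m k j) k≤d)))
    where
    r₁ : ∀ a b c → a * (b + - 1ℚ * c) ≡ a * (b - c)
    r₁ = solve-∀ ℚ-ring
    r₂ : ∀ a b → a + - 1ℚ * b ≡ a - b
    r₂ = solve-∀ ℚ-ring

  -- k [x^k] f^p = [x^k] x (f^p)' is divisible by p.
  powS-p : ∀ {d f} → d N.< p → f 0 ≡ 1ℚ → Integral≤ d f → powS f p ≡ₚ oneS [≤ d ]
  powS-p {f = f} _ e _ zero _ = ≼-resp (sym (trans (cong (λ x → x - 1ℚ) (powS-0 f p e)) (QP.+-inverseʳ 1ℚ))) ≼-0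
  powS-p {d} {f} d<p e i (suc k) k≤d = ≼-resp (sym (QP.+-identityʳ (powS f p (suc k))))
    (≼-unit (suc k) (λ p∣k → NP.<⇒≱ (NP.≤-<-trans k≤d d<p) (ND.∣⇒≤ p∣k)) (go p refl))
    where
    go : ∀ n → n ≡ p → 1 ≼ θ (powS f n) (suc k)
    go zero refl = ≼-resp (sym (QP.*-zeroʳ (ℕtoℚ (suc k)))) ≼-0
    go (suc n) refl = ≼-resp (sym (θ-powS f n (suc k))) (≼-P* (≼-int
      (int-mulS {f = powS f n} {θ f} (int-powS {f = f} i n) (λ j j≤d → int-* (int-ℕ j) (i j j≤d)) (suc k) k≤d)))

  powS-p* : ∀ {d f} → d N.< p → f 0 ≡ 1ℚ → Integral≤ d f → ∀ n → powS f (n N.* p) ≡ₚ oneS [≤ d ]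
  powS-p* {d} {f} d<p e i zero = ≗⇒≡ₚ {powS f 0} {oneS} (powS-zero f)
  powS-p* {d} {f} d<p e i (suc n) = ≡ₚ-trans {powS f (p N.+ n N.* p)} {mulS (powS f p) (powS f (n N.* p))} {oneS}
    (≗⇒≡ₚ {powS f (p N.+ n N.* p)} (powS-+ f p (n N.* p)))
    (≡ₚ-trans {mulS (powS f p) (powS f (n N.* p))} {mulS (powS f p) oneS} {oneS}
      (≡ₚ-mulSʳ {powS f p} {powS f (n N.* p)} {oneS} (int-powS {f = f} i p) (powS-p* {f = f} d<p e i n))
      (≡ₚ-trans {mulS (powS f p) oneS} {powS f p} {oneS}
        (≗⇒≡ₚ {mulS (powS f p) oneS} (λ k → trans (mulS-comm (powS f p) oneS k) (mulS-oneˡ (powS f p) k)))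
        (powS-p {f = f} d<p e i)))

  private
    E : Series
    E = expm1OverX

    k<p : ∀ {k} → suc k N.< p → k N.< p
    k<p = NP.<-trans (NP.n<1+n _)

  coeff-periodic : ∀ n k r → suc k N.< p → 1 ≼ coeff (p N.+ n) k r - coeff n k r
  coeff-periodic n k r k<p′ = ≡ₚ-mulSʳ {expS (ℤtoℚ (Z.- r))} {powS E (p N.+ n)} {powS E n} (int-expS (Z.- r) (k<p k<p′))
    (≡ₚ-trans {powS E (p N.+ n)} {mulS (powS E n) (powS E p)} {powS E n}
      (≗⇒≡ₚ {powS E (p N.+ n)} λ i → trans (powS-+ E p n i) (mulS-comm (powS E p) (powS E n) i))
      (≡ₚ-trans {mulS (powS E n) (powS E p)} {mulS (powS E n) oneS} {powS E n}
        (≡ₚ-mulSʳ {powS E n} {powS E p} {oneS} (int-powS {f = E} (int-expm1OverX k<p′) n)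
          (powS-p {f = E} (k<p k<p′) refl (int-expm1OverX k<p′)))
        (≗⇒≡ₚ {mulS (powS E n) oneS} λ i → trans (mulS-comm (powS E n) oneS i) (mulS-oneˡ (powS E n) i))))
    k NP.≤-refl

  -- With `E` for `(e^x - 1)/x`, the series 1 may be replaced by `E^(m+n)` modulo `p`, since `p`
  -- divides `m + n`. The inverse of `E^m` then leaves `E^n`.
  bernoulli-coeff : ∀ m n k r → p ND.∣ m N.+ n → suc k N.< p →
    1 ≼ mulS (expS (ℤtoℚ (Z.- r))) (powS (invS E) m) k - coeff n k r
  bernoulli-coeff m n k r (ND.divides c m+n) k<p′ =
    ≡ₚ-mulSʳ {expS (ℤtoℚ (Z.- r))} {powS I m} {powS E n} (int-expS (Z.- r) (k<p k<p′))
    (≡ₚ-trans {powS I m} {mulS (powS I m) oneS} {powS E n}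
      (≗⇒≡ₚ {powS I m} λ i → sym (trans (mulS-comm (powS I m) oneS i) (mulS-oneˡ (powS I m) i)))
      (≡ₚ-trans {mulS (powS I m) oneS} {mulS (powS I m) (powS E (m N.+ n))} {powS E n}
        (≡ₚ-mulSʳ {powS I m} {oneS} {powS E (m N.+ n)} (int-powS {f = I} (int-invS {f = E} (int-expm1OverX k<p′)) m)
          (≡ₚ-sym {powS E (m N.+ n)} {oneS} (subst (λ j → powS E j ≡ₚ oneS [≤ k ]) (sym m+n) (powS-p* {f = E} (k<p k<p′) refl (int-expm1OverX k<p′) c))))
        (≗⇒≡ₚ {mulS (powS I m) (powS E (m N.+ n))} cancelled)))
    k NP.≤-refl
    where
    I = invS E
    cancelled : mulS (powS I m) (powS E (m N.+ n)) ≗ˢ powS E n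
    cancelled i = trans (mulS-cong {powS I m} (λ _ → refl) (powS-+ E m n) i)
      (trans (sym (mulS-assoc (powS I m) (powS E m) (powS E n) i))
        (trans (mulS-cong {g = powS E n} (powS-inverse I E (mulS-invS E refl) m) (λ _ → refl) i) (mulS-oneˡ (powS E n) i)))

  -- Translation multiplies by `e^(px)`, whose terms from the second order on are divisible by
  -- `p^2`, as the factorials are prime to `p`. The coefficient of degree `k + 1` may itself have
  -- `p` in its denominator (when `k + 2 = p`), but it cancels.
  coeff-translate-p : ∀ n k r → suc k N.< p → 2 ≼ coeff n (suc k) (r Z.- Z.+ p) - coeff n (suc k) r - P * coeff n k r
  coeff-translate-p n k r k<p′ = ≼-resp
    (cong (λ x → x - G (suc k) - P * G k) (sym (trans (coeff-translate n (Z.+ p) r (suc k)) (mulS-sucˡ (expS P) G k))))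
    (≼-resp (r₁ (G (suc k)) (mulS (expS P ∘ suc) G k) (P * G k)) (tail k NP.≤-refl))
    where
    G : Series
    G i = coeff n i r
    r₁ : ∀ a b c → b - c ≡ 1ℚ * a + b - a - c
    r₁ = solve-∀ ℚ-ring
    r₂ : ∀ P a → P * 1ℚ * 1ℚ * a - P * a ≡ 0ℚ
    r₂ = solve-∀ ℚ-ring
    r₃ : ∀ P a b → P * 1ℚ * 1ℚ * a + b - P * a ≡ b
    r₃ = solve-∀ ℚ-ring
    r₄ : ∀ P x i g → P * (P * x) * i * g ≡ P * (P * (x * i * g))
    r₄ = solve-∀ ℚ-ring
    tail : ∀ j → j N.≤ k → 2 ≼ mulS (expS P ∘ suc) G j - P * G j
    tail zero _ = ≼-resp (sym (r₂ P (G 0))) ≼-0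
    tail (suc j) j≤k = ≼-resp (sym (trans (cong (λ x → x - P * G (suc j)) (mulS-sucˡ (expS P ∘ suc) G j)) (r₃ P (G (suc j)) (mulS (expS P ∘ suc ∘ suc) G j))))
      (≼-sum j (λ i → expS P (suc (suc i)) * G (j N.∸ i)) λ i i≤j →
        ≼-resp (sym (r₄ P (powℚ P i) (invFact (suc (suc i))) (G (j N.∸ i))))
        (≼-P* (≼-P* (≼-int (int-* (int-* (int-pow (int-ℕ p) i)
          (int-invFact (suc (suc i)) (NP.≤-<-trans (N.s≤s (NP.≤-trans (N.s≤s i≤j) j≤k)) k<p′)))
          (int-coeff n (j N.∸ i) r (NP.≤-<-trans (N.s≤s (NP.≤-trans (NP.m∸n≤m j i) (NP.≤-trans (NP.n≤1+n j) j≤k))) k<p′)))))))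

  Δ-coeff : ∀ n k r → act Δ (coeff n (suc k)) r ≡ - coeff (suc n) k r
  Δ-coeff n k r = trans (act-Δ (coeff n (suc k)) r)
    (trans (r₁ (coeff n (suc k) r) (coeff n (suc k) (r Z.- Z.1ℤ))) (cong -_ (sym (coeff-suc n k r))))
    where
    r₁ : ∀ a b → a - b ≡ - (b - a)
    r₁ = solve-∀ ℚ-ring

  Δ-coeff-0 : ∀ n r → act Δ (coeff n 0) r ≡ 0ℚ
  Δ-coeff-0 n r = trans (act-Δ (coeff n 0) r) (QP.+-inverseʳ (coeff n 0 r))

  Δ^-coeff : ∀ i n k r → act (Δ ^ i) (coeff n (i N.+ k)) r ≡ sgn i * coeff (i N.+ n) k r
  Δ^-coeff zero n k r = refl
  Δ^-coeff (suc i) n k r = begin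
    act Δ (act (Δ ^ i) (coeff n (suc (i N.+ k)))) r ≡⟨ act-cong Δ (λ s → trans (cong (λ j → act (Δ ^ i) (coeff n j) s) (sym (NP.+-suc i k))) (Δ^-coeff i n (suc k) s)) r ⟩
    act Δ (λ s → sgn i * coeff (i N.+ n) (suc k) s) r ≡⟨ act-* Δ (sgn i) (coeff (i N.+ n) (suc k)) r ⟩
    sgn i * act Δ (coeff (i N.+ n) (suc k)) r ≡⟨ cong (λ x → sgn i * x) (Δ-coeff (i N.+ n) k r) ⟩
    sgn i * - coeff (suc i N.+ n) k r ≡⟨ r₁ (sgn i) (coeff (suc i N.+ n) k r) ⟩
    sgn (suc i) * coeff (suc i N.+ n) k r ∎
    where
    open ≡-Reasoning
    r₁ : ∀ a b → a * - b ≡ - 1ℚ * a * b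
    r₁ = solve-∀ ℚ-ring

  -- As a function of `r` the coefficient is a polynomial of degree at most `k`.
  Δ^-coeff-vanish : ∀ i n k r → k N.< i → act (Δ ^ i) (coeff n k) r ≡ 0ℚ
  Δ^-coeff-vanish (suc i) n zero r _ = trans (act-comm Δ (Δ ^ i) (coeff n 0) r) (trans (act-cong (Δ ^ i) (Δ-coeff-0 n) r) (act-0 (Δ ^ i) r))
  Δ^-coeff-vanish (suc i) n (suc k) r (N.s≤s k<i) = trans (act-comm Δ (Δ ^ i) (coeff n (suc k)) r)
    (trans (act-cong (Δ ^ i) (Δ-coeff n k) r) (trans (act-neg (Δ ^ i) (coeff (suc n) k) r) (cong -_ (Δ^-coeff-vanish i (suc n) k r k<i))))

-- Fermat's little theorem and factorials modulo p

module Fermat (p : ℕ) (p-prime : Prime p) where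

  open Rationals
  open PowerSeries
  open Operators
  open FleckFunction
  open Valuation p p-prime
  open Freshman p p-prime
  open Weights p p-prime
  open Coefficients p p-prime
  open import Data.Nat using (_!)
  open import Data.Nat.Combinatorics using (_C_; nCk+nC[k+1]≡[n+1]C[k+1]; k![n∸k]!∣n!)
  open import Data.Nat.Combinatorics.Specification using (nCk≡n!/k![n-k]!)
  import Data.Nat.Properties as NP
  import Data.Nat.DivMod as ND
  import Data.Nat.Divisibility as Div
  open import Data.Integer as Z using (ℤ)
  import Data.Integer.Properties as ZP
  import Data.Integer.Tactic.RingSolver as ZS
  open import Data.Rational using (ℚ; 0ℚ; 1ℚ; _+_; _*_; _-_; -_)
  import Data.Rational.Properties as QP
  open import Data.Product using (∃; _,_)
  open import Data.Sum using (inj₁; inj₂)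
  open import Relation.Nullary using (¬_)
  open import Relation.Binary.PropositionalEquality
  open import Tactic.RingSolver using (solve-∀)

  private
    -- Constants `κ z`, evaluated on this function, carry the operator identities `∇^p` and `⊝^p`
    -- over to powers of integers.
    one : ℤ → ℚ
    one _ = 1ℚ

    act-κ^ : ∀ z n r → act (κ z ^ n) one r ≡ powℚ (ℤtoℚ z) n
    act-κ^ z zero r = refl
    act-κ^ z (suc n) r = cong (λ x → ℤtoℚ z * x) (act-κ^ z n r)

    ∇κ : ∀ z → ∇ (κ z) ≈ κ (Z.1ℤ Z.- z)
    ∇κ z = ext λ f r → trans (r₁ (ℤtoℚ z) (f r)) (cong (λ x → x * f r) (sym (ℤtoℚ-- Z.1ℤ z)))
      where
      r₁ : ∀ z x → 1ℚ * x + - 1ℚ * (z * x) ≡ (1ℚ - z) * x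
      r₁ = solve-∀ ℚ-ring

    ⊝κ : ∀ z → ⊝ κ z ≈ κ (Z.- z)
    ⊝κ z = ext λ f r → trans (r₁ (ℤtoℚ z) (f r)) (cong (λ x → x * f r) (sym (ℤtoℚ-neg z)))
      where
      r₁ : ∀ z x → - 1ℚ * (z * x) ≡ - z * x
      r₁ = solve-∀ ℚ-ring

    one-minus : ∀ z → 1 ≼ powℚ (ℤtoℚ (Z.1ℤ Z.- z)) p - (1ℚ - powℚ (ℤtoℚ z) p)
    one-minus z = go (∇^p (κ z))
      where
      r₁ : ∀ u x y → 1ℚ * u + - 1ℚ * x + y - (u - x) ≡ y
      r₁ = solve-∀ ℚ-ring
      go : (∃ λ h → ∇ (κ z) ^ p ≈ ∇ (κ z ^ p) ⊕ κℕ p ⊗ (∇ (κ z) ⊗ h)) → 1 ≼ powℚ (ℤtoℚ (Z.1ℤ Z.- z)) p - (1ℚ - powℚ (ℤtoℚ z) p)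
      go (h , e) = subst (1 ≼_) (sym equation) (≼-P* (≼-act (∇ (κ z) ⊗ h) (λ _ → ≼-int (int-ℕ 1)) Z.0ℤ))
        where
        open ≡-Reasoning
        y = act (∇ (κ z) ⊗ h) one Z.0ℤ
        equation : powℚ (ℤtoℚ (Z.1ℤ Z.- z)) p - (1ℚ - powℚ (ℤtoℚ z) p) ≡ P * y
        equation = begin
          powℚ (ℤtoℚ (Z.1ℤ Z.- z)) p - (1ℚ - powℚ (ℤtoℚ z) p)
            ≡⟨ cong₂ (λ a b → a - (1ℚ - b)) (sym (act-κ^ (Z.1ℤ Z.- z) p Z.0ℤ)) (sym (act-κ^ z p Z.0ℤ)) ⟩
          act (κ (Z.1ℤ Z.- z) ^ p) one Z.0ℤ - (1ℚ - act (κ z ^ p) one Z.0ℤ)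
            ≡⟨ cong (λ a → a - (1ℚ - act (κ z ^ p) one Z.0ℤ)) (at (≈-trans (^-congˡ p (≈-sym (∇κ z))) e) one Z.0ℤ) ⟩
          act (∇ (κ z ^ p) ⊕ κℕ p ⊗ (∇ (κ z) ⊗ h)) one Z.0ℤ - (one Z.0ℤ - act (κ z ^ p) one Z.0ℤ)
            ≡⟨ r₁ (one Z.0ℤ) (act (κ z ^ p) one Z.0ℤ) (P * y) ⟩
          P * y ∎

    negated : ∀ z → 1 ≼ powℚ (ℤtoℚ (Z.- z)) p - - powℚ (ℤtoℚ z) p
    negated z = go (⊝^p (κ z))
      where
      r₁ : ∀ x y → - 1ℚ * x + y - - x ≡ y
      r₁ = solve-∀ ℚ-ring
      go : (∃ λ h → (⊝ κ z) ^ p ≈ ⊝ κ z ^ p ⊕ κℕ p ⊗ (κ z ⊗ h)) → 1 ≼ powℚ (ℤtoℚ (Z.- z)) p - - powℚ (ℤtoℚ z) p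
      go (h , e) = subst (1 ≼_) (sym equation) (≼-P* (≼-act (κ z ⊗ h) (λ _ → ≼-int (int-ℕ 1)) Z.0ℤ))
        where
        open ≡-Reasoning
        y = act (κ z ⊗ h) one Z.0ℤ
        equation : powℚ (ℤtoℚ (Z.- z)) p - - powℚ (ℤtoℚ z) p ≡ P * y
        equation = begin
          powℚ (ℤtoℚ (Z.- z)) p - - powℚ (ℤtoℚ z) p
            ≡⟨ cong₂ (λ a b → a - - b) (sym (act-κ^ (Z.- z) p Z.0ℤ)) (sym (act-κ^ z p Z.0ℤ)) ⟩
          act (κ (Z.- z) ^ p) one Z.0ℤ - - act (κ z ^ p) one Z.0ℤ
            ≡⟨ cong (λ a → a - - act (κ z ^ p) one Z.0ℤ) (at (≈-trans (^-congˡ p (≈-sym (⊝κ z))) e) one Z.0ℤ) ⟩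
          act (⊝ κ z ^ p ⊕ κℕ p ⊗ (κ z ⊗ h)) one Z.0ℤ - - act (κ z ^ p) one Z.0ℤ
            ≡⟨ r₁ (act (κ z ^ p) one Z.0ℤ) (P * y) ⟩
          P * y ∎

    Fixed : ℤ → Set
    Fixed z = 1 ≼ powℚ (ℤtoℚ z) p - ℤtoℚ z

    fixed-1- : ∀ z → Fixed z → Fixed (Z.1ℤ Z.- z)
    fixed-1- z d = ≼-resp (trans (r₁ (powℚ (ℤtoℚ (Z.1ℤ Z.- z)) p) (powℚ (ℤtoℚ z) p) (ℤtoℚ z))
        (cong (λ x → powℚ (ℤtoℚ (Z.1ℤ Z.- z)) p - x) (sym (ℤtoℚ-- Z.1ℤ z)))) (≼-- (one-minus z) d)
      where
      r₁ : ∀ a b c → a - (1ℚ - b) - (b - c) ≡ a - (1ℚ - c)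
      r₁ = solve-∀ ℚ-ring

    fixed-neg : ∀ z → Fixed z → Fixed (Z.- z)
    fixed-neg z d = ≼-resp (trans (r₁ (powℚ (ℤtoℚ (Z.- z)) p) (powℚ (ℤtoℚ z) p) (ℤtoℚ z))
        (cong (λ x → powℚ (ℤtoℚ (Z.- z)) p - x) (sym (ℤtoℚ-neg z)))) (≼-- (negated z) d)
      where
      r₁ : ∀ a b c → a - - b - (b - c) ≡ a - - c
      r₁ = solve-∀ ℚ-ring

  -- z ↦ 1 - z and z ↦ - z preserve z^p ≡ z, hence so do z ↦ z ± 1.
  z^p≡z : ∀ z → 1 ≼ powℚ (ℤtoℚ z) p - ℤtoℚ z
  z^p≡z = integer-induction Fixed
    (subst (λ n → 1 ≼ powℚ 0ℚ n - 0ℚ) (sym p≡) (≼-resp (sym (trans (QP.+-identityʳ (0ℚ * powℚ 0ℚ p′)) (QP.*-zeroˡ (powℚ 0ℚ p′)))) ≼-0))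
    (λ z d → subst Fixed (r₁ z) (fixed-1- (Z.- z) (fixed-neg z d)))
    (λ z d → subst Fixed (r₂ z) (fixed-neg (Z.1ℤ Z.- Z.suc z) (fixed-1- (Z.suc z) d)))
    where
    r₁ : ∀ z → Z.1ℤ Z.- Z.- z ≡ Z.1ℤ Z.+ z
    r₁ = ZS.solve-∀
    r₂ : ∀ z → Z.- (Z.1ℤ Z.- (Z.1ℤ Z.+ z)) ≡ z
    r₂ = ZS.solve-∀

  private
    cancel-ℤ : ∀ z {x} → ¬ p ∣ᶻ z → 1 ≼ ℤtoℚ z * x → 1 ≼ x
    cancel-ℤ (Z.+ n) p∤z d = ≼-unit n (λ (Div.divides k e) → p∤z (Z.+ k , trans (cong Z.+_ (trans e (NP.*-comm k p))) (ZP.pos-* p k))) d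
    cancel-ℤ Z.-[1+ n ] {x} p∤z d = ≼-unit (suc n)
      (λ (Div.divides k e) → p∤z (Z.- Z.+ k , trans (cong (λ m → Z.- (Z.+ m)) (trans e (NP.*-comm k p))) (trans (cong Z.-_ (ZP.pos-* p k)) (ZP.neg-distribʳ-* (Z.+ p) (Z.+ k)))))
      (≼-resp (r₁ (ℕtoℚ (suc n)) x) (≼-neg d))
      where
      r₁ : ∀ a x → - (- a * x) ≡ a * x
      r₁ = solve-∀ ℚ-ring

  -- The indicator of the multiples of `p` is thus replaced by the polynomial `1 - r^(p-1)`, whose
  -- differences are known. This starts the recursion.
  fermat : ∀ r → 1 ≼ fleck p 0 r - 1ℚ + powℚ (ℤtoℚ r) p′
  fermat r with _∣ᶻ?_ p r
  ... | inj₁ (z , refl) = ≼-resp (trans (r₁ (powℚ (ℤtoℚ (Z.+ p Z.* z)) p′)) (cong (λ x → x - 1ℚ + powℚ (ℤtoℚ (Z.+ p Z.* z)) p′) (sym (fleck-on p 0 z))))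
    (go p′ 1≤p′)
    where
    r₁ : ∀ a → a ≡ 1ℚ - 1ℚ + a
    r₁ = solve-∀ ℚ-ring
    go : ∀ n → 1 N.≤ n → 1 ≼ powℚ (ℤtoℚ (Z.+ p Z.* z)) n
    go (suc n) _ = ≼-*ˡ (≼-resp (sym (ℤtoℚ-* (Z.+ p) z)) (≼-P* (≼-int (int-ℤ z)))) (int-pow (int-ℤ (Z.+ p Z.* z)) n)
  ... | inj₂ p∤r = ≼-resp (trans (r₁ (powℚ (ℤtoℚ r) p′)) (cong (λ x → x - 1ℚ + powℚ (ℤtoℚ r) p′) (sym (fleck-off p 0 r p∤r))))
    (cancel-ℤ r p∤r (≼-resp (r₂ (ℤtoℚ r) (powℚ (ℤtoℚ r) p′)) (subst (λ n → 1 ≼ powℚ (ℤtoℚ r) n - ℤtoℚ r) p≡ (z^p≡z r))))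
    where
    r₁ : ∀ a → a - 1ℚ ≡ 0ℚ - 1ℚ + a
    r₁ = solve-∀ ℚ-ring
    r₂ : ∀ a b → a * b - a ≡ a * (b - 1ℚ)
    r₂ = solve-∀ ℚ-ring

  -- Keeping (p - 1)! as a factor avoids Wilson's theorem.
  ω : ℚ
  ω = ℕtoℚ (p′ !)

  -- Neighbours in row `p - 1` of Pascal's triangle add up to an entry of row `p` divisible by `p`,
  -- so the row alternates between 1 and -1.
  C-sign : ∀ k → k N.< p → 1 ≼ ℕtoℚ (p′ C k) - sgn k
  C-sign zero _ = ≼-0
  C-sign (suc k) k<p = ≼-resp (trans (cong (λ x → x - (ℕtoℚ (p′ C k) - sgn k))
      (trans (cong ℕtoℚ (trans (cong (_C suc k) p≡) (sym (nCk+nC[k+1]≡[n+1]C[k+1] p′ k)))) (ℕtoℚ-+ (p′ C k) (p′ C suc k))))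
      (r₁ (ℕtoℚ (p′ C k)) (ℕtoℚ (p′ C suc k)) (sgn k)))
    (≼-- (≼-ℕ (p∣pCk (suc k) (N.s≤s N.z≤n) k<p)) (C-sign k (NP.<-trans (NP.n<1+n k) k<p)))
    where
    r₁ : ∀ a b s → a + b - (a - s) ≡ b - - 1ℚ * s
    r₁ = solve-∀ ℚ-ring

  -- From `(p - 1)! = binom(p - 1, k) k! (p - 1 -
  -- k)!` and `C-sign`. It will link `ω` to the product of `(n-l)_*!` and `(n-l)^*!`, whose arguments sum to `p
  -- - 1`.
  factorials : ∀ k → k N.≤ p′ → 1 ≼ sgn k * ω - ℕtoℚ (k !) * ℕtoℚ ((p′ N.∸ k) !)
  factorials k k≤p′ = ≼-resp (sym (trans (cong₂ (λ a b → sgn k * a - b) ω≡ (sym (ℕtoℚ-* (k !) ((p′ N.∸ k) !))))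
      (r₁ (sgn k) (ℕtoℚ (p′ C k)) (ℕtoℚ d) (sgn² k))))
    (≼-*ʳ (int-* (int-ℕ d) (int-sgn k)) (C-sign k (subst (k N.<_) (sym p≡) (N.s≤s k≤p′))))
    where
    instance d≢0 = NP._!*_!≢0 k (p′ N.∸ k)
    d = k ! N.* (p′ N.∸ k) !
    ω≡ : ω ≡ ℕtoℚ (p′ C k) * ℕtoℚ d
    ω≡ = trans (cong ℕtoℚ (trans (sym (ND.m/n*n≡m (k![n∸k]!∣n! k≤p′))) (cong (N._* d) (sym (nCk≡n!/k![n-k]! k≤p′))))) (ℕtoℚ-* (p′ C k) d)
    r₁ : ∀ s c d → s * s ≡ 1ℚ → s * (c * d) - d ≡ d * s * (c - s)
    r₁ s c d e = trans (cong (λ x → s * (c * d) - x) (trans (sym (QP.*-identityˡ d)) (cong (_* d) (sym e)))) (r₂ s c d)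
      where
      r₂ : ∀ s c d → s * (c * d) - s * s * d ≡ d * s * (c - s)
      r₂ = solve-∀ ℚ-ring

-- The congruence for prime modulus, a = 1

module PrimeModulus (p : ℕ) (p-prime : Prime p) where

  open Rationals
  open PowerSeries
  open Operators
  open FleckFunction
  open Valuation p p-prime
  open Freshman p p-prime
  open Weights p p-prime
  open Coefficients p p-prime
  open Fermat p p-prime
  import Data.Nat.Properties as NP
  import Data.Nat.Tactic.RingSolver as NS
  open import Data.Integer as Z using (ℤ)
  open import Data.Rational using (ℚ; 0ℚ; 1ℚ; _+_; _*_; _-_; -_)
  import Data.Rational.Properties as QP
  open import Data.Product using (∃; _×_; _,_)
  open import Relation.Binary.PropositionalEquality
  open import Tactic.RingSolver using (solve-∀)

  -- The scalar solution of the recursion. The binomial coefficient satisfies it by Pascal's rule,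
  -- the sign of `l` comes from `fleck-shift-suc`, and the rest from differencing `- r^(p-1)`; by
  -- Wilson's theorem `- ω` is 1 modulo `p`.
  leading : ℕ → ℕ → ℕ → ℚ
  leading l j ν = sgn (l N.+ ν) * - ω * binomℚ (ℕtoℚ (l N.+ j)) l

  int-leading : ∀ l j ν → Integral (leading l j ν)
  int-leading l j ν = int-* (int-* (int-sgn (l N.+ ν)) (int-neg (int-ℕ (p′ N.!))))
    (let u , e = binomℚ-integer l (Z.+ (l N.+ j)) in subst Integral (sym e) (int-ℤ u))

  leading-0 : ∀ l ν → leading (suc l) 0 ν ≡ - leading l 0 ν
  leading-0 l ν = trans (cong (λ b → sgn (suc l N.+ ν) * - ω * b) (begin
      binomℚ (ℕtoℚ (suc l N.+ 0)) (suc l) ≡⟨ cong (λ x → binomℚ x (suc l)) (ℕtoℚ-suc (l N.+ 0)) ⟩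
      binomℚ (1ℚ + ℕtoℚ (l N.+ 0)) (suc l) ≡⟨ binomℚ-pascal (ℕtoℚ (l N.+ 0)) l ⟩
      binomℚ (ℕtoℚ (l N.+ 0)) (suc l) + B ≡⟨ cong (_+ B) (binomℚ-<≡0 (l N.+ 0) (suc l) (N.s≤s (NP.≤-reflexive (NP.+-identityʳ l)))) ⟩
      0ℚ + B ≡⟨ QP.+-identityˡ B ⟩
      B ∎)) (r₁ (sgn (l N.+ ν)) ω B)
    where
    open ≡-Reasoning
    B = binomℚ (ℕtoℚ (l N.+ 0)) l
    r₁ : ∀ s w b → - 1ℚ * s * - w * b ≡ - (s * - w * b)
    r₁ = solve-∀ ℚ-ring

  leading-suc : ∀ l j ν → leading (suc l) (suc j) ν ≡ leading (suc l) j ν - leading l (suc j) ν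
  leading-suc l j ν = trans (cong (λ b → sgn (suc l N.+ ν) * - ω * b) (begin
      binomℚ (ℕtoℚ (suc l N.+ suc j)) (suc l) ≡⟨ cong (λ x → binomℚ x (suc l)) (ℕtoℚ-suc (l N.+ suc j)) ⟩
      binomℚ (1ℚ + ℕtoℚ (l N.+ suc j)) (suc l) ≡⟨ binomℚ-pascal (ℕtoℚ (l N.+ suc j)) l ⟩
      binomℚ (ℕtoℚ (l N.+ suc j)) (suc l) + B ≡⟨ cong (λ n → binomℚ (ℕtoℚ n) (suc l) + B) (NP.+-suc l j) ⟩
      A + B ∎)) (r₁ (sgn (l N.+ ν)) ω A B)
    where
    open ≡-Reasoning
    A = binomℚ (ℕtoℚ (suc l N.+ j)) (suc l)
    B = binomℚ (ℕtoℚ (l N.+ suc j)) l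
    r₁ : ∀ s w a b → - 1ℚ * s * - w * (a + b) ≡ - 1ℚ * s * - w * a - s * - w * b
    r₁ = solve-∀ ℚ-ring

  ≼-[-P]^ : ∀ j → j ≼ powℚ (- P) j
  ≼-[-P]^ j = ≼-resp (sym (powℚ-neg P j)) (≼-*ʳ (int-sgn j) (≼-P^ j))

  private
    -- After `fermat`, the difference kills the constant 1, and `r^(p-1)` is up to sign `ω` times
    -- the coefficient of `x^(p-1)` in `e^(-rx)`, on which `Δ` acts by moving indices.
    base : ∀ ν n r → suc n N.+ ν ≡ p′ → 1 ≼ act (Δ ^ suc n) (fleck p 0) r - leading 0 0 ν * coeff (suc n) ν r
    base ν n r n+ν = ≼-resp (begin
      act D g r ≡⟨ act-+ D (λ s → fleck p 0 s - 1ℚ) (λ s → powℚ (ℤtoℚ s) p′) r ⟩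
      act D (λ s → fleck p 0 s - 1ℚ) r + act D (λ s → powℚ (ℤtoℚ s) p′) r
        ≡⟨ cong₂ _+_ (act-- D (fleck p 0) (λ _ → 1ℚ) r) (act-cong D power r) ⟩
      act D (fleck p 0) r - act D (λ _ → 1ℚ) r + act D (λ s → sgn p′ * ω * coeff 0 (suc n N.+ ν) s) r
        ≡⟨ cong₂ (λ a b → act D (fleck p 0) r - a + b) constant (act-* D (sgn p′ * ω) (coeff 0 (suc n N.+ ν)) r) ⟩
      act D (fleck p 0) r - 0ℚ + sgn p′ * ω * act D (coeff 0 (suc n N.+ ν)) r
        ≡⟨ cong (λ x → act D (fleck p 0) r - 0ℚ + sgn p′ * ω * x) (Δ^-coeff (suc n) 0 ν r) ⟩
      act D (fleck p 0) r - 0ℚ + sgn p′ * ω * (sgn (suc n) * coeff (suc n N.+ 0) ν r)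
        ≡⟨ cong₂ (λ s m → act D (fleck p 0) r - 0ℚ + s * ω * (sgn (suc n) * coeff m ν r)) (trans (cong sgn (sym n+ν)) (sgn-+ (suc n) ν)) (NP.+-identityʳ (suc n)) ⟩
      act D (fleck p 0) r - 0ℚ + sgn (suc n) * sgn ν * ω * (sgn (suc n) * coeff (suc n) ν r)
        ≡⟨ r₂ (act D (fleck p 0) r) (sgn (suc n)) (sgn ν) ω (coeff (suc n) ν r) (sgn² (suc n)) ⟩
      act D (fleck p 0) r - leading 0 0 ν * coeff (suc n) ν r ∎)
      (≼-act D fermat r)
      where
      open ≡-Reasoning
      D = Δ ^ suc n
      g : ℤ → ℚ
      g s = fleck p 0 s - 1ℚ + powℚ (ℤtoℚ s) p′
      r₀ : ∀ s x i w → i * w ≡ 1ℚ → s * s ≡ 1ℚ → x ≡ s * w * (s * x * i)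
      r₀ s x i w e e′ = trans (r₀′ x) (trans (cong₂ (λ a b → a * b * x) (sym e) (sym e′)) (r₀″ s x i w))
        where
        r₀′ : ∀ x → x ≡ 1ℚ * 1ℚ * x
        r₀′ = solve-∀ ℚ-ring
        r₀″ : ∀ s x i w → i * w * (s * s) * x ≡ s * w * (s * x * i)
        r₀″ = solve-∀ ℚ-ring
      power : ∀ s → powℚ (ℤtoℚ s) p′ ≡ sgn p′ * ω * coeff 0 (suc n N.+ ν) s
      power s = trans (r₀ (sgn p′) (powℚ (ℤtoℚ s) p′) (invFact p′) ω (invFact-* p′) (sgn² p′))
        (cong (λ x → sgn p′ * ω * x) (trans (cong (_* invFact p′) (sym (trans (cong (λ x → powℚ x p′) (ℤtoℚ-neg s)) (powℚ-neg (ℤtoℚ s) p′))))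
          (sym (trans (cong (λ k → coeff 0 k s) n+ν) (trans (mulS-comm e (powS expm1OverX 0) p′) (trans (mulS-cong {g = e} (powS-zero expm1OverX) (λ _ → refl) p′) (mulS-oneˡ e p′)))))))
        where e = expS (ℤtoℚ (Z.- s))
      constant : act D (λ _ → 1ℚ) r ≡ 0ℚ
      constant = trans (act-comm Δ (Δ ^ n) (λ _ → 1ℚ) r) (trans (act-cong (Δ ^ n) (λ _ → refl) r) (act-0 (Δ ^ n) r))
      r₂ : ∀ a s t w c → s * s ≡ 1ℚ → a - 0ℚ + s * t * w * (s * c) ≡ a - t * - w * 1ℚ * c
      r₂ a s t w c e = trans (r₂′ a s t w c) (trans (cong (λ x → a + x * (t * w * c)) e) (r₂″ a t w c))
        where
        r₂′ : ∀ a s t w c → a - 0ℚ + s * t * w * (s * c) ≡ a + s * s * (t * w * c)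
        r₂′ = solve-∀ ℚ-ring
        r₂″ : ∀ a t w c → a + 1ℚ * (t * w * c) ≡ a - t * - w * 1ℚ * c
        r₂″ = solve-∀ ℚ-ring

    -- p h₀ Δ = Δ^p - (1 - σ^p), and Δ^p kills polynomials of degree below p.
    h₀-coeff : ∀ n k r → suc k N.< p → 2 ≼ P * act h₀ (coeff (suc n) k) r + P * coeff n k r
    h₀-coeff n k r k<p = ≼-resp (sym (trans (cong (λ x → x + P * coeff n k r) (begin
        P * act h₀ (coeff (suc n) k) r
          ≡⟨ r₁ (P * act h₀ (coeff (suc n) k) r) (act (∇ (σ p)) c r) ⟩
        act (∇ (σ p)) c r - (act (∇ (σ p)) c r + - (P * act h₀ (coeff (suc n) k) r))
          ≡⟨ cong (λ x → act (∇ (σ p)) c r - (act (∇ (σ p)) c r + x))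
             (trans (r₂ P (act h₀ (coeff (suc n) k) r)) (cong (λ x → P * x) (sym (trans (act-comm Δ h₀ c r) (trans (act-cong h₀ (Δ-coeff n k) r) (act-neg h₀ (coeff (suc n) k) r)))))) ⟩
        act (∇ (σ p)) c r - (act (∇ (σ p)) c r + P * act Δ (act h₀ c) r)
          ≡⟨ cong (λ x → act (∇ (σ p)) c r - x) (trans (sym (at Δ^p c r)) (Δ^-coeff-vanish p n (suc k) r k<p)) ⟩
        1ℚ * c r + - 1ℚ * c (r Z.- Z.+ p) - 0ℚ ∎)) (r₃ (c r) (c (r Z.- Z.+ p)) (P * coeff n k r))))
      (≼-neg (coeff-translate-p n k r k<p))
      where
      open ≡-Reasoning
      c = coeff n (suc k)
      r₁ : ∀ a b → a ≡ b - (b + - a)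
      r₁ = solve-∀ ℚ-ring
      r₂ : ∀ P x → - (P * x) ≡ P * - x
      r₂ = solve-∀ ℚ-ring
      r₃ : ∀ a b d → 1ℚ * a + - 1ℚ * b - 0ℚ + d ≡ - (b - a - d)
      r₃ = solve-∀ ℚ-ring

    -- The index equation says `n - l - 1 = (l + j)(p - 1) + (p - 2 - ν)`. So `j` is the exponent
    -- belonging to `n`, and `ν` the distance from `n` to the last value with that exponent.
    Congruence : ℕ → ℕ → Set
    Congruence l j = ∀ ν n r → suc ν N.< p → n N.+ ν ≡ l N.+ p′ N.* suc (l N.+ j) →
      suc j ≼ act (Δ ^ n) (fleck p l) r - powℚ (- P) j * leading l j ν * coeff n ν r

    Δ^[p+n] : ∀ n → Δ ^ (p N.+ n) ≈ Δ ^ n ⊗ ∇ (σ p) ⊕ κℕ p ⊗ (h₀ ⊗ Δ ^ suc n)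
    Δ^[p+n] n = ≈-trans (^-homo-* Δ p n) (≈-trans (*-cong Δ^p (≈-refl {Δ ^ n}))
      (solve 5 (λ a x d p h → (d :+ p :* (a :* h)) :* x := x :* d :+ p :* (h :* (a :* x))) ≈-refl Δ (Δ ^ n) (∇ (σ p)) (κℕ p) h₀))

    -- Three errors are added: that of the induction hypothesis, raised by the factor `p`; that of
    -- `h₀-coeff`, of order `p^2` and multiplied by `(-p)^j`; and that of periodicity in `n`, with
    -- one more explicit `p`.
    lower-j : ∀ l j → Congruence l j → ∀ ν n r → suc ν N.< p → suc n N.+ ν ≡ l N.+ p′ N.* suc (l N.+ j) →
      suc (suc j) ≼ P * act h₀ (act (Δ ^ suc n) (fleck p l)) r - powℚ (- P) (suc j) * leading l j ν * coeff (p N.+ n) ν r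
    lower-j l j IH ν n r ν<p e = ≼-resp (begin
        P * act h₀ (λ s → X s - a * c s) r + a * (P * act h₀ c r + P * coeff n ν r + P * (coeff (p N.+ n) ν r - coeff n ν r))
          ≡⟨ cong (λ x → P * x + a * (P * act h₀ c r + P * coeff n ν r + P * (coeff (p N.+ n) ν r - coeff n ν r)))
              (trans (act-- h₀ X (λ s → a * c s) r) (cong (λ x → act h₀ X r - x) (act-* h₀ a c r))) ⟩
        P * (act h₀ X r - a * act h₀ c r) + a * (P * act h₀ c r + P * coeff n ν r + P * (coeff (p N.+ n) ν r - coeff n ν r))
          ≡⟨ r₁ P (act h₀ X r) (powℚ (- P) j) (leading l j ν) (act h₀ c r) (coeff n ν r) (coeff (p N.+ n) ν r) ⟩
        P * act h₀ X r - powℚ (- P) (suc j) * leading l j ν * coeff (p N.+ n) ν r ∎)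
      (≼-+ (≼-P* (≼-act h₀ (λ s → IH ν (suc n) s ν<p e) r))
        (subst (_≼ a * (P * act h₀ c r + P * coeff n ν r + P * (coeff (p N.+ n) ν r - coeff n ν r))) (NP.+-comm j 2)
          (≼-* (≼-*ˡ (≼-[-P]^ j) (int-leading l j ν)) (≼-+ (h₀-coeff n ν r ν<p) (≼-P* (coeff-periodic n ν r ν<p))))))
      where
      open ≡-Reasoning
      a = powℚ (- P) j * leading l j ν
      X = act (Δ ^ suc n) (fleck p l)
      c = coeff (suc n) ν
      r₁ : ∀ P x b k y u v → P * (x - b * k * y) + b * k * (P * y + P * u + P * (v - u)) ≡ P * x - - P * b * k * v
      r₁ = solve-∀ ℚ-ring

    -- Here the hypothesis is used with the same `j`, and passing from the coefficient for `n` to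
    -- the one for `p + n` costs only a multiple of `p^(j+1)`.
    lower-l : ∀ l j → Congruence l j → ∀ ν n r → suc ν N.< p → n N.+ ν ≡ l N.+ p′ N.* suc (l N.+ j) →
      suc j ≼ act (Δ ^ n) (act (∇ (σ p)) (fleck p (suc l))) r - powℚ (- P) j * - leading l j ν * coeff (p N.+ n) ν r
    lower-l l j IH ν n r ν<p e = ≼-resp (begin
        a * (coeff (p N.+ n) ν r - coeff n ν r) - (act (Δ ^ n) (fleck p l) r - a * coeff n ν r)
          ≡⟨ r₁ (powℚ (- P) j) (leading l j ν) (coeff (p N.+ n) ν r) (coeff n ν r) (act (Δ ^ n) (fleck p l) r) ⟩
        - act (Δ ^ n) (fleck p l) r - powℚ (- P) j * - leading l j ν * coeff (p N.+ n) ν r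
          ≡⟨ cong (λ x → x - powℚ (- P) j * - leading l j ν * coeff (p N.+ n) ν r)
              (trans (sym (act-neg (Δ ^ n) (fleck p l) r)) (act-cong (Δ ^ n) (λ s → sym (fleck-shift-suc p l s)) r)) ⟩
        act (Δ ^ n) (act (∇ (σ p)) (fleck p (suc l))) r - powℚ (- P) j * - leading l j ν * coeff (p N.+ n) ν r ∎)
      (≼-- (subst (_≼ a * (coeff (p N.+ n) ν r - coeff n ν r)) (NP.+-comm j 1)
             (≼-* (≼-*ˡ (≼-[-P]^ j) (int-leading l j ν)) (coeff-periodic n ν r ν<p))) (IH ν n r ν<p e))
      where
      open ≡-Reasoning
      a = powℚ (- P) j * leading l j ν
      r₁ : ∀ b k v u x → b * k * (v - u) - (x - b * k * u) ≡ - x - b * - k * v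
      r₁ = solve-∀ ℚ-ring

    split : ∀ n ν x → n N.+ ν ≡ p N.+ x → ν N.≤ x → ∃ λ n′ → n ≡ p N.+ n′ × n′ N.+ ν ≡ x
    split n ν x e ν≤x = x N.∸ ν , NP.+-cancelʳ-≡ ν n (p N.+ (x N.∸ ν))
        (trans e (trans (cong (p N.+_) (sym (NP.m∸n+n≡m ν≤x))) (sym (NP.+-assoc p (x N.∸ ν) ν)))) , NP.m∸n+n≡m ν≤x

    split-ν≤ : ∀ ν l m → suc ν N.< p → ν N.≤ l N.+ p′ N.* suc m
    split-ν≤ ν l m ν<p = NP.≤-trans (NP.≤-pred (NP.≤-pred (NP.m≤n⇒m≤1+n (subst (suc (suc ν) N.≤_) p≡ ν<p))))
      (NP.≤-trans (NP.m≤m*n p′ (suc m)) (NP.m≤n+m (p′ N.* suc m) l))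

    index-l : ∀ l j → suc l N.+ p′ N.* suc (suc l N.+ j) ≡ p N.+ (l N.+ p′ N.* suc (l N.+ j))
    index-l l j = trans (r₁ l p′ (l N.+ j)) (cong (N._+ (l N.+ p′ N.* suc (l N.+ j))) (sym p≡))
      where
      r₁ : ∀ l q m → suc l N.+ q N.* suc (suc m) ≡ suc q N.+ (l N.+ q N.* suc m)
      r₁ = NS.solve-∀

    index-j : ∀ l j n ν → p N.+ n N.+ ν ≡ l N.+ p′ N.* suc (l N.+ suc j) → suc n N.+ ν ≡ l N.+ p′ N.* suc (l N.+ j)
    index-j l j n ν e = NP.+-cancelˡ-≡ p′ (suc n N.+ ν) (l N.+ p′ N.* suc (l N.+ j))
      (trans (r₁ p′ n ν) (trans (cong (λ q → q N.+ n N.+ ν) (sym p≡)) (trans e (trans (cong (λ m → l N.+ p′ N.* suc m) (NP.+-suc l j)) (r₂ l p′ (l N.+ j))))))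
      where
      r₁ : ∀ q n ν → q N.+ (suc n N.+ ν) ≡ suc q N.+ n N.+ ν
      r₁ = NS.solve-∀
      r₂ : ∀ l q m → l N.+ q N.* suc (suc m) ≡ q N.+ (l N.+ q N.* suc m)
      r₂ = NS.solve-∀

    combine : ∀ {k} x y a u v w → w ≡ u + v → ∀ c → k ≼ x - a * u * c → k ≼ y - a * v * c → k ≼ x + y - a * w * c
    combine x y a u v w refl c d d′ = ≼-resp (r₁ x y a u v c) (≼-+ d d′)
      where
      r₁ : ∀ x y a u v c → x - a * u * c + (y - a * v * c) ≡ x + y - a * (u + v) * c
      r₁ = solve-∀ ℚ-ring

    congruence-00 : Congruence 0 0
    -- For `n = 0` the index equation would give `ν = p - 1`, which is out of range.
    congruence-00 ν zero r ν<p e with () ← NP.<-irrefl (trans e (NP.*-identityʳ p′)) (NP.≤-pred (subst (suc (suc ν) N.≤_) p≡ ν<p))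
    congruence-00 ν (suc n) r ν<p e = ≼-resp (cong (λ x → act (Δ ^ suc n) (fleck p 0) r - x * coeff (suc n) ν r) (sym (QP.*-identityˡ (leading 0 0 ν))))
      (base ν n r (trans e (NP.*-identityʳ p′)))

    -- For `l = 0` the summand with `1 - σ^p` vanishes, the indicator being periodic, and only
    -- `lower-j` contributes.
    step-j : ∀ j → Congruence 0 j → Congruence 0 (suc j)
    step-j j IH ν n r ν<p e = go (n N.∸ p) (NP.m+[n∸m]≡n p≤n)
      where
      p≤n : p N.≤ n
      p≤n = NP.+-cancelʳ-≤ ν p n (begin
        p N.+ ν ≡⟨ cong (N._+ ν) p≡ ⟩
        suc p′ N.+ ν ≡⟨ NP.+-suc p′ ν ⟨
        p′ N.+ suc ν ≤⟨ NP.+-monoʳ-≤ p′ (NP.≤-pred (subst (suc (suc ν) N.≤_) p≡ ν<p)) ⟩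
        p′ N.+ p′ ≤⟨ NP.+-monoʳ-≤ p′ (NP.m≤m*n p′ (suc j)) ⟩
        p′ N.+ p′ N.* suc j ≡⟨ NP.*-suc p′ (suc j) ⟨
        p′ N.* suc (suc j) ≡⟨ e ⟨
        n N.+ ν ∎)
        where open NP.≤-Reasoning
      r₁ : ∀ a k c → 0ℚ - a * 0ℚ * c ≡ 0ℚ
      r₁ = solve-∀ ℚ-ring
      go : ∀ n′ → p N.+ n′ ≡ n → suc (suc j) ≼ act (Δ ^ n) (fleck p 0) r - powℚ (- P) (suc j) * leading 0 (suc j) ν * coeff n ν r
      go n′ refl = ≼-resp (cong (λ x → x - powℚ (- P) (suc j) * leading 0 (suc j) ν * coeff (p N.+ n′) ν r) (sym (at (Δ^[p+n] n′) (fleck p 0) r)))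
        (combine (act (Δ ^ n′) (act (∇ (σ p)) (fleck p 0)) r) (P * act h₀ (act (Δ ^ suc n′) (fleck p 0)) r)
          (powℚ (- P) (suc j)) 0ℚ (leading 0 j ν) (leading 0 (suc j) ν) (sym (QP.+-identityˡ (leading 0 j ν))) (coeff (p N.+ n′) ν r)
          (≼-resp (sym (trans (cong (λ x → x - powℚ (- P) (suc j) * 0ℚ * coeff (p N.+ n′) ν r)
              (trans (act-cong (Δ ^ n′) (fleck-shift-0 p) r) (act-0 (Δ ^ n′) r))) (r₁ (powℚ (- P) (suc j)) 0ℚ (coeff (p N.+ n′) ν r)))) ≼-0)
          (lower-j 0 j IH ν n′ r ν<p (index-j 0 j n′ ν e)))

    -- For `j = 0` one works modulo `p`, so the summand with the factor `p` drops out and only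
    -- `lower-l` contributes.
    step-l : ∀ l → Congruence l 0 → Congruence (suc l) 0
    step-l l IH ν n r ν<p e = go (split n ν (l N.+ p′ N.* suc (l N.+ 0)) (trans e (index-l l 0)) (split-ν≤ ν l (l N.+ 0) ν<p))
      where
      r₁ : ∀ x c → x ≡ x - 1ℚ * 0ℚ * c
      r₁ = solve-∀ ℚ-ring
      go : (∃ λ n′ → n ≡ p N.+ n′ × n′ N.+ ν ≡ l N.+ p′ N.* suc (l N.+ 0)) →
        1 ≼ act (Δ ^ n) (fleck p (suc l)) r - powℚ (- P) 0 * leading (suc l) 0 ν * coeff n ν r
      go (n′ , refl , e′) = ≼-resp (cong (λ x → x - powℚ (- P) 0 * leading (suc l) 0 ν * coeff (p N.+ n′) ν r) (sym (at (Δ^[p+n] n′) (fleck p (suc l)) r)))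
        (combine (act (Δ ^ n′) (act (∇ (σ p)) (fleck p (suc l))) r) (P * act h₀ (act (Δ ^ suc n′) (fleck p (suc l))) r)
          (powℚ (- P) 0) (- leading l 0 ν) 0ℚ (leading (suc l) 0 ν) (trans (leading-0 l ν) (sym (QP.+-identityʳ (- leading l 0 ν)))) (coeff (p N.+ n′) ν r)
          (lower-l l 0 IH ν n′ r ν<p e′)
          (≼-resp (r₁ (P * act h₀ (act (Δ ^ suc n′) (fleck p (suc l))) r) (coeff (p N.+ n′) ν r)) (≼-P* (≼-act (h₀ ⊗ Δ ^ suc n′) (≼-fleck p (suc l)) r))))

    step-lj : ∀ l j → Congruence l (suc j) → Congruence (suc l) j → Congruence (suc l) (suc j)
    step-lj l j IH IH′ ν n r ν<p e = go (split n ν (l N.+ p′ N.* suc (l N.+ suc j)) (trans e (index-l l (suc j))) (split-ν≤ ν l (l N.+ suc j) ν<p))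
      where
      go : (∃ λ n′ → n ≡ p N.+ n′ × n′ N.+ ν ≡ l N.+ p′ N.* suc (l N.+ suc j)) →
        suc (suc j) ≼ act (Δ ^ n) (fleck p (suc l)) r - powℚ (- P) (suc j) * leading (suc l) (suc j) ν * coeff n ν r
      go (n′ , refl , e′) = ≼-resp (cong (λ x → x - powℚ (- P) (suc j) * leading (suc l) (suc j) ν * coeff (p N.+ n′) ν r) (sym (at (Δ^[p+n] n′) (fleck p (suc l)) r)))
        (combine (act (Δ ^ n′) (act (∇ (σ p)) (fleck p (suc l))) r) (P * act h₀ (act (Δ ^ suc n′) (fleck p (suc l))) r)
          (powℚ (- P) (suc j)) (- leading l (suc j) ν) (leading (suc l) j ν) (leading (suc l) (suc j) ν)
          (trans (leading-suc l j ν) (QP.+-comm (leading (suc l) j ν) (- leading l (suc j) ν))) (coeff (p N.+ n′) ν r)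
          (lower-l l (suc j) IH ν n′ r ν<p e′)
          (lower-j (suc l) j IH′ ν n′ r ν<p (index-j (suc l) j n′ ν e)))

  Δ^-fleck : ∀ l j ν n r → suc ν N.< p → n N.+ ν ≡ l N.+ p′ N.* suc (l N.+ j) →
    suc j ≼ act (Δ ^ n) (fleck p l) r - powℚ (- P) j * leading l j ν * coeff n ν r
  Δ^-fleck zero zero = congruence-00
  Δ^-fleck zero (suc j) = step-j j (Δ^-fleck 0 j)
  Δ^-fleck (suc l) zero = step-l l (Δ^-fleck l 0)
  Δ^-fleck (suc l) (suc j) = step-lj l j (Δ^-fleck l (suc j)) (Δ^-fleck (suc l) j)

-- Differences of sparse functions, and reflection

module Sparse where

  open Rationals
  open Operators
  open FleckFunction
  import Data.Nat.Properties as NP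
  open import Data.Nat.Combinatorics using (_C_; nCk+nC[k+1]≡[n+1]C[k+1]; k>n⇒nCk≡0)
  open import Data.Integer as Z using (ℤ)
  import Data.Integer.Properties as ZP
  import Data.Integer.Tactic.RingSolver as ZS
  open import Data.Rational using (ℚ; 0ℚ; 1ℚ; _+_; _*_; _-_; -_)
  import Data.Rational.Properties as QP
  open import Data.Product using (_,_; proj₂)
  open import Data.Sum using (inj₁; inj₂)
  open import Relation.Nullary using (¬_)
  open import Relation.Binary.PropositionalEquality
  open import Tactic.RingSolver using (solve-∀)

  SupportedOn : ℕ → (ℤ → ℚ) → Set
  SupportedOn m f = ∀ r → ¬ m ∣ᶻ r → f r ≡ 0ℚ

  module _ (m : ℕ) .{{_ : N.NonZero m}} where

    ∤-between : ∀ y t → 0 N.< t → t N.< m → ¬ m ∣ᶻ (Z.+ m Z.* y Z.+ Z.+ t)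
    ∤-between y t 0<t t<m (z , e) = NP.<-irrefl
      (trans (sym (proj₂ (divMod-unique m (Z.+ m Z.* z) 0 z (N.>-nonZero⁻¹ m) (r₁ (Z.+ m) z))))
        (proj₂ (divMod-unique m (Z.+ m Z.* z) t y t<m (trans (sym e) (r₂ (Z.+ m) y (Z.+ t)))))) 0<t
      where
      r₁ : ∀ m z → m Z.* z ≡ Z.0ℤ Z.+ z Z.* m
      r₁ = ZS.solve-∀
      r₂ : ∀ m y t → m Z.* y Z.+ t ≡ t Z.+ y Z.* m
      r₂ = ZS.solve-∀

    supported-sub : ∀ A {f} → SupportedOn m f → SupportedOn m (act (sub m A) f)
    supported-sub A {f} h r m∤r = trans (cong (act (sub m A) f) (r₁ r (Z.+ m))) (trans (act-sub m A f r Z.0ℤ)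
        (trans (act-cong A (λ i → h (r Z.+ Z.+ m Z.* i) (λ (z , e) → m∤r (z Z.- i , trans (r₂ r (Z.+ m) i) (trans (cong (λ x → x Z.- Z.+ m Z.* i) e) (r₃ (Z.+ m) z i))))) Z.0ℤ) (act-0 A Z.0ℤ)))
      where
      r₁ : ∀ r m → r ≡ r Z.+ m Z.* Z.0ℤ
      r₁ = ZS.solve-∀
      r₂ : ∀ r m i → r ≡ r Z.+ m Z.* i Z.- m Z.* i
      r₂ = ZS.solve-∀
      r₃ : ∀ m z i → m Z.* z Z.- m Z.* i ≡ m Z.* (z Z.- i)
      r₃ = ZS.solve-∀

    act-sub-0 : ∀ A f r → act (sub m A) f (Z.+ m Z.* r) ≡ act A (λ i → f (Z.+ m Z.* i)) r
    act-sub-0 A f r = trans (cong (act (sub m A) f) (sym (ZP.+-identityˡ (Z.+ m Z.* r)))) (trans (act-sub m A f Z.0ℤ r)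
      (act-cong A (λ i → cong f (ZP.+-identityˡ (Z.+ m Z.* i))) r))

    ∇σ^-sub : ∀ n → ∇ (σ m) ^ n ≡ sub m (Δ ^ n)
    ∇σ^-sub n = trans (cong (λ k → ∇ (σ k) ^ n) (sym (NP.*-identityʳ m))) (sym (sub-^ m Δ n))

  -- Among the arguments `m y + t - k` with `0 ≤ k ≤ s < m`, at most `k = t` gives a multiple of
  -- `m`. So a single binomial term survives, and this is where the theorem's binom(s, t) arises.
  Δ^-supported : ∀ m .{{_ : N.NonZero m}} w → SupportedOn m w → ∀ s t y → s N.< m → t N.< m →
    act (Δ ^ s) w (Z.+ m Z.* y Z.+ Z.+ t) ≡ sgn t * ℕtoℚ (s C t) * w (Z.+ m Z.* y)
  Δ^-supported m@(suc m′) w h zero zero y _ _ = trans (cong (λ z → 1ℚ * w z) (ZP.+-identityʳ (Z.+ m Z.* y))) (cong (_* w (Z.+ m Z.* y)) (sym (QP.*-identityʳ 1ℚ)))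
  Δ^-supported m@(suc m′) w h zero (suc t) y _ t<m = trans (QP.*-identityˡ (w (Z.+ m Z.* y Z.+ Z.+ suc t)))
    (trans (h (Z.+ m Z.* y Z.+ Z.+ suc t) (∤-between m y (suc t) (N.s≤s N.z≤n) t<m)) (r₁ (sgn (suc t)) (w (Z.+ m Z.* y))))
    where
    r₁ : ∀ a b → 0ℚ ≡ a * 0ℚ * b
    r₁ = solve-∀ ℚ-ring
  Δ^-supported m@(suc m′) w h (suc s) zero y s<m _ = begin
    act Δ f (Z.+ m Z.* y Z.+ Z.0ℤ) ≡⟨ act-Δ f (Z.+ m Z.* y Z.+ Z.0ℤ) ⟩
    -- The point `m y - 1` belongs to the previous block, with offset `m - 1`. Its contribution is
    -- zero because this offset exceeds the order `s` of the difference.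
    f (Z.+ m Z.* y Z.+ Z.0ℤ) - f (Z.+ m Z.* y Z.+ Z.0ℤ Z.- Z.1ℤ)
      ≡⟨ cong₂ _-_ (Δ^-supported m w h s 0 y (NP.<-trans (NP.n<1+n s) s<m) (N.s≤s N.z≤n))
          (trans (cong f (trans (r₁ (Z.+ m) y) (cong (λ z → Z.+ m Z.* (y Z.- Z.1ℤ) Z.+ z) (r₂ (Z.+ m′)))))
            (Δ^-supported m w h s m′ (y Z.- Z.1ℤ) (NP.<-trans (NP.n<1+n s) s<m) (NP.n<1+n m′))) ⟩
    1ℚ * 1ℚ * w₀ - sgn m′ * ℕtoℚ (s C m′) * w (Z.+ m Z.* (y Z.- Z.1ℤ))
      ≡⟨ cong (λ c → 1ℚ * 1ℚ * w₀ - sgn m′ * ℕtoℚ c * w (Z.+ m Z.* (y Z.- Z.1ℤ))) (k>n⇒nCk≡0 (NP.≤-pred s<m)) ⟩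
    1ℚ * 1ℚ * w₀ - sgn m′ * 0ℚ * w (Z.+ m Z.* (y Z.- Z.1ℤ)) ≡⟨ r₃ w₀ (sgn m′) (w (Z.+ m Z.* (y Z.- Z.1ℤ))) ⟩
    1ℚ * 1ℚ * w₀ ∎
    where
    open ≡-Reasoning
    f = act (Δ ^ s) w
    w₀ = w (Z.+ m Z.* y)
    r₁ : ∀ m y → m Z.* y Z.+ Z.0ℤ Z.- Z.1ℤ ≡ m Z.* (y Z.- Z.1ℤ) Z.+ (m Z.- Z.1ℤ)
    r₁ = ZS.solve-∀
    r₂ : ∀ k → Z.1ℤ Z.+ k Z.- Z.1ℤ ≡ k
    r₂ = ZS.solve-∀
    r₃ : ∀ w a b → 1ℚ * 1ℚ * w - a * 0ℚ * b ≡ 1ℚ * 1ℚ * w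
    r₃ = solve-∀ ℚ-ring
  Δ^-supported m@(suc m′) w h (suc s) (suc t) y s<m t<m = begin
    act Δ f (Z.+ m Z.* y Z.+ Z.+ suc t) ≡⟨ act-Δ f (Z.+ m Z.* y Z.+ Z.+ suc t) ⟩
    f (Z.+ m Z.* y Z.+ Z.+ suc t) - f (Z.+ m Z.* y Z.+ Z.+ suc t Z.- Z.1ℤ)
      ≡⟨ cong₂ _-_ (Δ^-supported m w h s (suc t) y (NP.<-trans (NP.n<1+n s) s<m) t<m)
          (trans (cong f (r₁ (Z.+ m Z.* y) (Z.+ t))) (Δ^-supported m w h s t y (NP.<-trans (NP.n<1+n s) s<m) (NP.<-trans (NP.n<1+n t) t<m))) ⟩
    sgn (suc t) * ℕtoℚ (s C suc t) * w₀ - sgn t * ℕtoℚ (s C t) * w₀ ≡⟨ r₂ (sgn t) (ℕtoℚ (s C suc t)) (ℕtoℚ (s C t)) w₀ ⟩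
    sgn (suc t) * (ℕtoℚ (s C t) + ℕtoℚ (s C suc t)) * w₀
      ≡⟨ cong (λ c → sgn (suc t) * c * w₀) (trans (sym (ℕtoℚ-+ (s C t) (s C suc t))) (cong ℕtoℚ (nCk+nC[k+1]≡[n+1]C[k+1] s t))) ⟩
    sgn (suc t) * ℕtoℚ (suc s C suc t) * w₀ ∎
    where
    open ≡-Reasoning
    f = act (Δ ^ s) w
    w₀ = w (Z.+ m Z.* y)
    r₁ : ∀ a t → a Z.+ (Z.1ℤ Z.+ t) Z.- Z.1ℤ ≡ a Z.+ t
    r₁ = ZS.solve-∀
    r₂ : ∀ s a b w → - 1ℚ * s * a * w - s * b * w ≡ - 1ℚ * s * (b + a) * w
    r₂ = solve-∀ ℚ-ring

  -- Reflection reverses the order of the terms in the binomial expansion, which multiplies their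
  -- alternating signs by `(-1)^k`.
  Δ^-reflect : ∀ u → (∀ i → u (Z.- i) ≡ u i) → ∀ k i → act (Δ ^ k) u (Z.+ k Z.- i) ≡ sgn k * act (Δ ^ k) u i
  Δ^-reflect u even zero i = trans (cong (λ z → 1ℚ * u z) (ZP.+-identityˡ (Z.- i))) (trans (cong (1ℚ *_) (even i)) (sym (QP.*-identityˡ (1ℚ * u i))))
  Δ^-reflect u even (suc k) i = begin
    act Δ f (Z.+ suc k Z.- i) ≡⟨ act-Δ f (Z.+ suc k Z.- i) ⟩
    f (Z.+ suc k Z.- i) - f (Z.+ suc k Z.- i Z.- Z.1ℤ)
      ≡⟨ cong₂ _-_ (trans (cong f (r₁ (Z.+ k) i)) (Δ^-reflect u even k (i Z.- Z.1ℤ))) (trans (cong f (r₂ (Z.+ k) i)) (Δ^-reflect u even k i)) ⟩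
    sgn k * f (i Z.- Z.1ℤ) - sgn k * f i ≡⟨ r₃ (sgn k) (f (i Z.- Z.1ℤ)) (f i) ⟩
    sgn (suc k) * (f i - f (i Z.- Z.1ℤ)) ≡⟨ cong (λ x → sgn (suc k) * x) (act-Δ f i) ⟨
    sgn (suc k) * act Δ f i ∎
    where
    open ≡-Reasoning
    f = act (Δ ^ k) u
    r₁ : ∀ k i → Z.1ℤ Z.+ k Z.- i ≡ k Z.- (i Z.- Z.1ℤ)
    r₁ = ZS.solve-∀
    r₂ : ∀ k i → Z.1ℤ Z.+ k Z.- i Z.- Z.1ℤ ≡ k Z.- i
    r₂ = ZS.solve-∀
    r₃ : ∀ s a b → s * a - s * b ≡ - 1ℚ * s * (b - a)
    r₃ = solve-∀ ℚ-ring

  private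
    ∣ᶻ-neg : ∀ {q} r → q ∣ᶻ r → q ∣ᶻ Z.- r
    ∣ᶻ-neg {q} r (z , e) = Z.- z , trans (cong Z.-_ e) (ZP.neg-distribʳ-* (Z.+ q) z)

  module _ (q : ℕ) .{{_ : N.NonZero q}} where

    fleck-0-even : ∀ i → fleck q 0 (Z.- i) ≡ fleck q 0 i
    fleck-0-even i with _∣ᶻ?_ q i
    ... | inj₁ (z , refl) = trans (cong (fleck q 0) (ZP.neg-distribʳ-* (Z.+ q) z)) (trans (fleck-on q 0 (Z.- z)) (sym (fleck-on q 0 z)))
    ... | inj₂ q∤i = trans (fleck-off q 0 (Z.- i) λ d → q∤i (subst (q ∣ᶻ_) (ZP.neg-involutive i) (∣ᶻ-neg {q} (Z.- i) d))) (sym (fleck-off q 0 i q∤i))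

    fleck-0-periodic : ∀ z i → fleck q 0 (i Z.- Z.+ q Z.* z) ≡ fleck q 0 i
    fleck-0-periodic z i with _∣ᶻ?_ q i
    ... | inj₁ (y , refl) = trans (cong (fleck q 0) (r₁ (Z.+ q) y z)) (trans (fleck-on q 0 (y Z.- z)) (sym (fleck-on q 0 y)))
      where
      r₁ : ∀ q y z → q Z.* y Z.- q Z.* z ≡ q Z.* (y Z.- z)
      r₁ = ZS.solve-∀
    ... | inj₂ q∤i = trans (fleck-off q 0 (i Z.- Z.+ q Z.* z) λ (y , e) → q∤i (y Z.+ z , trans (r₁ i (Z.+ q Z.* z)) (trans (cong (λ x → x Z.+ Z.+ q Z.* z) e) (sym (ZP.*-distribˡ-+ (Z.+ q) y z))))) (sym (fleck-off q 0 i q∤i))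
      where
      r₁ : ∀ i a → i ≡ i Z.- a Z.+ a
      r₁ = ZS.solve-∀

    -- Up to a period the point is fixed by the reflection `i ↦ n - i` with `n = 2 t + q`. As `n` is
    -- odd, the value equals its own negative.
    Δ^-centre : ∀ t k r → k ≡ t N.+ t → sgn (k N.+ q) ≡ - 1ℚ → act (Δ ^ (k N.+ q)) (fleck q 0) (Z.+ q Z.* r Z.+ Z.+ t) ≡ 0ℚ
    Δ^-centre t k r refl odd = self-negative (f i) (begin
      f i ≡⟨ act-cong (Δ ^ n) (λ s → sym (fleck-0-periodic z s)) i ⟩
      act (Δ ^ n) (λ s → fleck q 0 (s Z.- Z.+ q Z.* z)) i ≡⟨ act-shift (Δ ^ n) (Z.+ q Z.* z) (fleck q 0) i ⟩
      f (i Z.- Z.+ q Z.* z) ≡⟨ cong f (trans (r₁ (Z.+ q) (Z.+ t) r) (cong (λ x → x Z.- i) (sym (trans (ZP.pos-+ (t N.+ t) q) (cong (λ x → x Z.+ Z.+ q) (ZP.pos-+ t t)))))) ⟩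
      f (Z.+ n Z.- i) ≡⟨ Δ^-reflect (fleck q 0) fleck-0-even n i ⟩
      sgn n * f i ≡⟨ cong (_* f i) odd ⟩
      - 1ℚ * f i ∎)
      where
      open ≡-Reasoning
      n = t N.+ t N.+ q
      i = Z.+ q Z.* r Z.+ Z.+ t
      -- Solved from `i - q z = n - i`: the period that carries `i` to its mirror image.
      z = r Z.+ r Z.- Z.1ℤ
      f = act (Δ ^ n) (fleck q 0)
      r₁ : ∀ q t r → q Z.* r Z.+ t Z.- q Z.* (r Z.+ r Z.- Z.1ℤ) ≡ t Z.+ t Z.+ q Z.- (q Z.* r Z.+ t)
      r₁ = ZS.solve-∀
      self-negative : ∀ x → x ≡ - 1ℚ * x → x ≡ 0ℚ
      self-negative x e = *-cancel 2 (trans (r₂ x) (trans (cong (_+ x) e) (r₃ x)))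
        where
        r₂ : ∀ x → x * (1ℚ + 1ℚ) ≡ x + x
        r₂ = solve-∀ ℚ-ring
        r₃ : ∀ x → - 1ℚ * x + x ≡ 0ℚ * (1ℚ + 1ℚ)
        r₃ = solve-∀ ℚ-ring

-- Reduction of the modulus p^a to p for a > 1

module Lucas (p : ℕ) (p-prime : Prime p) where

  open Rationals
  open Operators
  open FleckFunction
  open Sparse
  open Valuation p p-prime
  open Freshman p p-prime
  open Weights p p-prime
  import Data.Nat.Properties as NP
  import Data.Nat.Divisibility as ND
  import Data.Nat.DivMod as DM
  open import Data.Nat.Combinatorics using (_C_)
  open import Data.Integer as Z using (ℤ)
  import Data.Integer.Properties as ZP
  import Data.Integer.Tactic.RingSolver as ZS
  open import Data.Rational using (ℚ; 0ℚ; 1ℚ; _+_; _*_; _-_; -_)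
  import Data.Rational.Properties as QP
  open import Data.Product using (∃; _×_; _,_; proj₁; proj₂)
  open import Data.Sum using (_⊎_; inj₁; inj₂)
  open import Data.Empty using (⊥-elim)
  open import Relation.Nullary using (¬_)
  open import Relation.Binary.PropositionalEquality
  open import Tactic.RingSolver using (solve-∀)

  [A+pK]^ : ∀ A K n → ∃ λ L → (A ⊕ κℕ p ⊗ K) ^ n ≈ A ^ n ⊕ κℕ p ⊗ L
  [A+pK]^ A K zero = κ (Z.+ 0) , solve 1 (λ p → con (Z.+ 1) := con (Z.+ 1) :+ p :* con (Z.+ 0)) ≈-refl (κℕ p)
  [A+pK]^ A K (suc n) = let L , e = [A+pK]^ A K n in (A ⊕ κℕ p ⊗ K) ⊗ L ⊕ K ⊗ A ^ n ,
    ≈-trans (*-cong (≈-refl {A ⊕ κℕ p ⊗ K}) e)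
      (solve 5 (λ a p k x l → (a :+ p :* k) :* (x :+ p :* l) := a :* x :+ p :* ((a :+ p :* k) :* l :+ k :* x)) ≈-refl A (κℕ p) K (A ^ n) L)

  module _ (c : ℕ) where

    private
      -- Here a = c + 2, so that `q` is p^a and `M` is p^(a-1). The number `m` is p^(a-2), the scale
      -- at which (ii) and (iii) read the leading digits of `s` and `t`.
      m = p N.^ c
      M = p N.* m
      q = p N.* M
      instance
        m≢0 : N.NonZero m
        m≢0 = NP.m^n≢0 p c
        M≢0 : N.NonZero M
        M≢0 = NP.m*n≢0 p m
        q≢0 : N.NonZero q
        q≢0 = NP.m*n≢0 p M
      A = ∇ (σ M)
      W = ∇ (σ m)
      h = sub m h₀
      lift = Δ^p^[1+b] c
      L = proj₁ lift
      D = W ⊗ h ⊕ κℕ p ⊗ L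
      B = A ⊕ κℕ p ⊗ D

    private
      weight-drop : ∀ l j n → weight l (suc j) N.≤ suc n → weight l j N.≤ n
      weight-drop l j n w = NP.+-cancelʳ-≤ 1 (weight l j) n (NP.≤-trans (NP.+-monoʳ-≤ (weight l j) 1≤p′)
        (subst₂ N._≤_ (weight-suc-j l j) (NP.+-comm 1 n) w))

    module _ (l : ℕ) where

      private
        e = fleck q l

        -- (1 - X)^2 ≡ 1 - X^2 modulo 2, so that D² gains the weight which p² alone does not provide when p = 2.
        D²-even : p ≡ 2 → ∃ λ G → D ⊗ D ≈ h ⊗ h ⊗ A ⊕ G ⊗ κℕ p
        D²-even refl = W ⊗ h ⊗ h ⊗ h ⊕ κℕ 2 ⊗ W ⊗ h ⊗ L ⊕ κℕ p ⊗ (L ⊗ L) ,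
          ≈-trans (solve 4 (λ w h p l → (w :* h :+ p :* l) :* (w :* h :+ p :* l)
              := (w :* (w :* con (Z.+ 1))) :* (h :* h) :+ p :* (con (Z.+ 2) :* w :* h :* l :+ p :* (l :* l))) ≈-refl W h (κℕ p) L)
          (≈-trans (+-cong (*-cong (∇σ^p m) (≈-refl {h ⊗ h})) (≈-refl {κℕ p ⊗ (κℕ 2 ⊗ W ⊗ h ⊗ L ⊕ κℕ p ⊗ (L ⊗ L))}))
            (solve 5 (λ a w h p l → (a :+ p :* (w :* h)) :* (h :* h) :+ p :* (con (Z.+ 2) :* w :* h :* l :+ p :* (l :* l))
              := h :* h :* a :+ (w :* h :* h :* h :+ con (Z.+ 2) :* w :* h :* l :+ p :* (l :* l)) :* p) ≈-refl A W h (κℕ p) L))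

        -- Lowering `j` by one frees weight `p - 1`. For odd `p` this pays for two missing factors.
        -- For p = 2 it pays for one, and `D²-even` supplies the other, as an `A` or as a `p`.
        ≼-D² : ∀ j i k → weight l (suc j) N.≤ suc (suc (i N.+ k)) → ∀ r → j ≼ act (D ⊗ D ⊗ (A ^ i ⊗ B ^ k)) e r
        ≼-D² j i k w r = go p≡2⊎odd
          where
          f = act (A ^ i ⊗ B ^ k) e
          even : ∀ j → weight l (suc j) N.≤ suc (suc (i N.+ k)) → ∀ r → j ≼ act A f r × j ≼ P * f r
          even zero _ r = ≼-act (A ⊗ (A ^ i ⊗ B ^ k)) (≼-fleck q l) r , ≼-weaken N.z≤n (≼-P* (≼-act (A ^ i ⊗ B ^ k) (≼-fleck q l) r))
          even (suc j) w r = ≼-A^B^ M D l (suc j) (suc i) k (weight-drop l (suc j) (suc (i N.+ k)) w) r ,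
            ≼-P* (≼-A^B^ M D l j i k (weight-drop l j (i N.+ k) (weight-drop l (suc j) (suc (i N.+ k)) w)) r)
          go : p ≡ 2 ⊎ (∃ λ k → p ≡ suc (k N.+ k)) → j ≼ act (D ⊗ D ⊗ (A ^ i ⊗ B ^ k)) e r
          go (inj₁ p≡2) = let G , D²≈ = D²-even p≡2 in ≼-resp (sym (at D²≈ f r))
            (≼-+ (≼-act (h ⊗ h) (λ s → proj₁ (even j w s)) r) (≼-act G (λ s → proj₂ (even j w s)) r))
          go (inj₂ (zero , p≡1)) = ⊥-elim (NP.<-irrefl (sym p≡1) 1<p)
          go (inj₂ (suc k′ , p≡3+)) = ≼-act (D ⊗ D) (≼-A^B^ M D l j i k (NP.+-cancelʳ-≤ 2 (weight l j) (i N.+ k)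
            (NP.≤-trans (NP.+-monoʳ-≤ (weight l j) 2≤p′) (subst₂ N._≤_ (weight-suc-j l j) (NP.+-comm 2 (i N.+ k)) w)))) r
            where
            2≤p′ : 2 N.≤ p′
            2≤p′ = NP.≤-pred (subst (3 N.≤_) p≡ (subst (3 N.≤_) (sym (trans p≡3+ (cong suc (cong suc (NP.+-suc k′ k′))))) (N.s≤s (N.s≤s (N.s≤s N.z≤n)))))

        -- The factor `B ^ k` accumulates what the recursion of `remainder` pulls out. Each term
        -- then has `p^2` in place of two factors counted by the weight, and by `≼-D²` these cost
        -- only one power of `p`.
        ≼-remainder : ∀ j i k → weight l j N.≤ suc i N.+ k → ∀ r → suc j ≼ act (B ^ k ⊗ remainder A (κℕ p) D i) e r
        ≼-remainder j zero k _ r = ≼-resp (sym (trans (act-cong (B ^ k) (λ s → QP.*-zeroˡ (e s)) r) (act-0 (B ^ k) r))) ≼-0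
        ≼-remainder j (suc i) k w r = ≼-resp (sym (at rearranged e r))
          (≼-+ (≼-remainder j i (suc k) (subst (weight l j N.≤_) (sym (NP.+-suc (suc i) k)) w) r)
            (≼-*ʳ (int-ℕ (suc i)) (second j w)))
          where
          rearranged : B ^ k ⊗ remainder A (κℕ p) D (suc i)
            ≈ B ^ suc k ⊗ remainder A (κℕ p) D i ⊕ κℕ (suc i) ⊗ (κℕ p ⊗ (κℕ p ⊗ (D ⊗ D ⊗ (A ^ i ⊗ B ^ k))))
          rearranged = solve 7 (λ b x R n p d y → x :* (b :* R :+ n :* (p :* p :* (d :* d :* y))) := b :* x :* R :+ n :* (p :* (p :* (d :* d :* (y :* x)))))
            ≈-refl B (B ^ k) (remainder A (κℕ p) D i) (κℕ (suc i)) (κℕ p) D (A ^ i)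
          second : ∀ j → weight l j N.≤ suc (suc i) N.+ k → suc j ≼ P * (P * act (D ⊗ D ⊗ (A ^ i ⊗ B ^ k)) e r)
          second zero _ = ≼-P* (≼-weaken N.z≤n (≼-P* (≼-act (D ⊗ D ⊗ (A ^ i ⊗ B ^ k)) (≼-fleck q l) r)))
          second (suc j) w = ≼-P* (≼-P* (≼-D² j i k w r))

      -- The hypotheses on (n, s, t) under which the first-order term of (A + pD)^n can be neglected.
      data Negligible (j n : ℕ) : (s₁ t₁ : ℕ) → Set where
        p∣n : ∀ {s₁ t₁} → p ND.∣ suc n → Negligible j n s₁ t₁
        surplus : ∀ {s₁ t₁} → weight l j N.≤ n → Negligible j n s₁ t₁
        doubled : ∀ {t₁} → p ≢ 2 → Negligible j n (t₁ N.+ t₁) t₁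
        maximal : ∀ {t₁} → Negligible j n p′ t₁

      private
        e-supported : SupportedOn M e
        e-supported r M∤r = trans (cong (λ k → fleck k l r) (NP.*-comm p M)) (fleck-sparse M p l r M∤r)

        module _ (n j : ℕ) (w : weight l (suc j) N.≤ suc n) where

          -- The exponent belonging to `n + 1` is at least `j + 1`, while `g` has only `n` factors
          -- `A` and is guaranteed `p^j`. The first-order term must find the missing factor `p`
          -- elsewhere.
          g : ℤ → ℚ
          g = act (A ^ n) e

          ≼-g : ∀ r → j ≼ g r
          ≼-g = ≼-A^ M l j n (weight-drop l j n w)

          ≼-Ag : ∀ r → suc j ≼ act A g r
          ≼-Ag = ≼-A^ M l (suc j) (suc n) w

          g-supported : SupportedOn M g
          g-supported = subst (λ Q → SupportedOn M (act Q e)) (sym (∇σ^-sub M n)) (supported-sub M (Δ ^ n) e-supported)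

          g′ : ℤ → ℚ
          g′ i = g (Z.+ m Z.* i)

          g′-supported : SupportedOn p g′
          g′-supported i p∤i = g-supported (Z.+ m Z.* i) λ (z , eq) → p∤i (z , ZP.*-cancelˡ-≡ (Z.+ m) i (Z.+ p Z.* z)
            (trans eq (trans (cong (Z._* z) (ZP.pos-* p m)) (r₁ (Z.+ p) (Z.+ m) z))))
            where
            r₁ : ∀ p m z → p Z.* m Z.* z ≡ m Z.* (p Z.* z)
            r₁ = ZS.solve-∀

          -- Since `A g` is divisible by `p^(j+1)`, translation by `M` does not change `g` modulo
          -- `p^(j+1)`. Together with its support this makes `g′` a constant times the indicator of
          -- the multiples of `p`.
          g′-constant : ∀ z → suc j ≼ g′ (Z.+ p Z.* z) - g′ (Z.+ p Z.* Z.0ℤ)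
          g′-constant = integer-induction (λ z → suc j ≼ g′ (Z.+ p Z.* z) - g₀)
            (≼-resp (sym (QP.+-inverseʳ g₀)) ≼-0)
            (λ z d → ≼-resp (r₂ (g′ (Z.+ p Z.* Z.suc z)) (g′ (Z.+ p Z.* z)) g₀) (≼-+ (step z) d))
            (λ z d → ≼-resp (r₃ (g′ (Z.+ p Z.* Z.suc z)) (g′ (Z.+ p Z.* z)) g₀) (≼-- d (step z)))
            where
            g₀ = g′ (Z.+ p Z.* Z.0ℤ)
            r₀ : ∀ a b → 1ℚ * a + - 1ℚ * b ≡ a - b
            r₀ = solve-∀ ℚ-ring
            r₁ : ∀ p m z → m Z.* (p Z.* (Z.1ℤ Z.+ z)) Z.- p Z.* m ≡ m Z.* (p Z.* z)
            r₁ = ZS.solve-∀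
            r₂ : ∀ a b c → a - b + (b - c) ≡ a - c
            r₂ = solve-∀ ℚ-ring
            r₃ : ∀ a b c → a - c - (a - b) ≡ b - c
            r₃ = solve-∀ ℚ-ring
            step : ∀ z → suc j ≼ g′ (Z.+ p Z.* Z.suc z) - g′ (Z.+ p Z.* z)
            step z = ≼-resp (trans (r₀ (g x) (g (x Z.- Z.+ M))) (cong (λ y → g x - g y)
                (trans (cong (λ y → x Z.- y) (ZP.pos-* p m)) (r₁ (Z.+ p) (Z.+ m) z)))) (≼-Ag x)
              where x = Z.+ m Z.* (Z.+ p Z.* Z.suc z)

          -- Modulo `p^(j+1)` one may replace `g′` by a multiple of the indicator `u`. Its
          -- difference is zero at this point by `Δ^-centre`; `p` being odd makes the total order
          -- `2 t₁ + p` odd.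
          centred : p ≢ 2 → ∀ t₁ y → suc j ≼ act (Δ ^ (t₁ N.+ t₁) ⊗ (Δ ⊗ h₀)) g′ (Z.+ p Z.* y Z.+ Z.+ t₁)
          centred p≢2 t₁ y = ≼-resp (sym (begin
              act Q g′ x ≡⟨ act-cong Q (λ i → r₁ (g′ i) (g₀ * u i)) x ⟩
              act Q (λ i → g₀ * u i + (g′ i - g₀ * u i)) x ≡⟨ act-+ Q (λ i → g₀ * u i) (λ i → g′ i - g₀ * u i) x ⟩
              act Q (λ i → g₀ * u i) x + act Q (λ i → g′ i - g₀ * u i) x
                ≡⟨ cong (_+ act Q (λ i → g′ i - g₀ * u i) x) (trans (act-* Q g₀ u x) (trans (cong (g₀ *_) zero-at-centre) (QP.*-zeroʳ g₀))) ⟩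
              0ℚ + act Q (λ i → g′ i - g₀ * u i) x ≡⟨ QP.+-identityˡ (act Q (λ i → g′ i - g₀ * u i) x) ⟩
              act Q (λ i → g′ i - g₀ * u i) x ∎))
            (≼-act Q error x)
            where
            open ≡-Reasoning
            x = Z.+ p Z.* y Z.+ Z.+ t₁
            Q = Δ ^ (t₁ N.+ t₁) ⊗ (Δ ⊗ h₀)
            u = fleck p 0
            g₀ = g′ (Z.+ p Z.* Z.0ℤ)
            r₁ : ∀ a b → a ≡ b + (a - b)
            r₁ = solve-∀ ℚ-ring
            r₂ : ∀ a → 0ℚ ≡ 0ℚ - a * 0ℚ
            r₂ = solve-∀ ℚ-ring
            r₃ : ∀ a b → a ≡ b + a - b
            r₃ = solve-∀ ℚ-ring
            error : ∀ i → suc j ≼ g′ i - g₀ * u i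
            error i = go (_∣ᶻ?_ p i)
              where
              go : p ∣ᶻ i ⊎ ¬ p ∣ᶻ i → suc j ≼ g′ i - g₀ * u i
              go (inj₁ (z , refl)) = ≼-resp (cong (λ a → g′ (Z.+ p Z.* z) - a) (trans (sym (QP.*-identityʳ g₀)) (cong (g₀ *_) (sym (fleck-on p 0 z))))) (g′-constant z)
              go (inj₂ p∤i) = ≼-resp (trans (r₂ g₀) (cong₂ (λ a b → a - g₀ * b) (sym (g′-supported i p∤i)) (sym (fleck-off p 0 i p∤i)))) ≼-0
            odd-sign : sgn (t₁ N.+ t₁ N.+ p) ≡ - 1ℚ
            odd-sign = go p≡2⊎odd
              where
              go : p ≡ 2 ⊎ (∃ λ k → p ≡ suc (k N.+ k)) → sgn (t₁ N.+ t₁ N.+ p) ≡ - 1ℚ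
              go (inj₁ p≡2) = ⊥-elim (p≢2 p≡2)
              go (inj₂ (k , p≡)) = trans (sgn-+ (t₁ N.+ t₁) p) (cong₂ _*_ (sgn-double t₁) (trans (cong sgn p≡) (cong (- 1ℚ *_) (sgn-double k))))
            zero-at-centre : act Q u x ≡ 0ℚ
            zero-at-centre = *-cancel p (begin
              act Q u x * P ≡⟨ QP.*-comm (act Q u x) P ⟩
              -- Adding the term with `1 - σ^p`, which is zero on the periodic `u`, completes
              -- `p Δ h₀` to the power `Δ^p`.
              P * act Q u x ≡⟨ r₃ (P * act Q u x) (act (Δ ^ (t₁ N.+ t₁) ⊗ ∇ (σ p)) u x) ⟩
              act (Δ ^ (t₁ N.+ t₁) ⊗ ∇ (σ p) ⊕ κℕ p ⊗ Q) u x - act (Δ ^ (t₁ N.+ t₁) ⊗ ∇ (σ p)) u x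
                ≡⟨ cong₂ _-_ (at (≈-trans (solve 4 (λ x d p y → x :* d :+ p :* (x :* y) := x :* (d :+ p :* y)) ≈-refl (Δ ^ (t₁ N.+ t₁)) (∇ (σ p)) (κℕ p) (Δ ⊗ h₀))
                    (≈-trans (*-cong (≈-refl {Δ ^ (t₁ N.+ t₁)}) (≈-sym Δ^p)) (≈-sym (^-homo-* Δ (t₁ N.+ t₁) p)))) u x)
                    (trans (act-cong (Δ ^ (t₁ N.+ t₁)) (fleck-shift-0 p) x) (act-0 (Δ ^ (t₁ N.+ t₁)) x)) ⟩
              act (Δ ^ (t₁ N.+ t₁ N.+ p)) u x - 0ℚ ≡⟨ cong (_- 0ℚ) (Δ^-centre p t₁ (t₁ N.+ t₁) y refl odd-sign) ⟩
              0ℚ - 0ℚ ≡⟨ QP.*-zeroˡ P ⟨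
              0ℚ * P ∎)

        -- Modulo `p`, `Δ^m` is `W` and `D` is `W h`. The error has its `p` on the right, where it
        -- meets `g` first and supplies the missing factor.
        Δ^-split : ∀ s₀ s₁ → ∃ λ Z → Δ ^ (s₀ N.+ s₁ N.* m) ⊗ D ≈ Δ ^ s₀ ⊗ (W ^ s₁ ⊗ (W ⊗ h)) ⊕ Z ⊗ κℕ p
        Δ^-split s₀ s₁ = Δ ^ s₀ ⊗ (L₁ ⊗ D ⊕ W ^ s₁ ⊗ L) , (begin
          Δ ^ (s₀ N.+ s₁ N.* m) ⊗ D ≈⟨ *-cong (≈-trans (^-homo-* Δ s₀ (s₁ N.* m)) (*-cong (≈-refl {Δ ^ s₀})
              (≈-trans (≈-reflexive (cong (Δ ^_) (NP.*-comm s₁ m))) (≈-trans (≈-sym (^-assocʳ Δ m s₁)) (≈-trans (^-congˡ s₁ (proj₂ (Δ^p^b c))) (proj₂ W^)))))) (≈-refl {D}) ⟩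
          Δ ^ s₀ ⊗ (W ^ s₁ ⊕ κℕ p ⊗ L₁) ⊗ (W ⊗ h ⊕ κℕ p ⊗ L)
            ≈⟨ solve 7 (λ x w p l₁ W h l → x :* (w :+ p :* l₁) :* (W :* h :+ p :* l)
                := x :* (w :* (W :* h)) :+ x :* (l₁ :* (W :* h :+ p :* l) :+ w :* l) :* p) ≈-refl (Δ ^ s₀) (W ^ s₁) (κℕ p) L₁ W h L ⟩
          Δ ^ s₀ ⊗ (W ^ s₁ ⊗ (W ⊗ h)) ⊕ Δ ^ s₀ ⊗ (L₁ ⊗ D ⊕ W ^ s₁ ⊗ L) ⊗ κℕ p ∎)
          where
          open import Relation.Binary.Reasoning.Setoid Op-setoid
          W^ = [A+pK]^ W (proj₁ (Δ^p^b c)) s₁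
          L₁ = proj₁ W^

        -- A leading digit `p - 1` of `s` completes the factor `W` of `D` to `W^p`, which is `A`
        -- modulo `p`; and `A g` does have the missing factor.
        W^p′ : W ^ p′ ⊗ (W ⊗ h) ≈ h ⊗ A ⊕ h ⊗ W ⊗ h ⊗ κℕ p
        W^p′ = ≈-trans (solve 3 (λ x w h → x :* (w :* h) := h :* (w :* x)) ≈-refl (W ^ p′) W h)
          (≈-trans (*-cong (≈-refl {h}) (≈-trans (≈-reflexive (cong (W ^_) (sym p≡))) (∇σ^p m)))
            (solve 4 (λ a h w p → h :* (a :+ p :* (w :* h)) := h :* a :+ h :* w :* h :* p) ≈-refl A h W (κℕ p)))

        point : ∀ r t₀ t₁ → Z.+ M Z.* r Z.+ Z.+ (t₀ N.+ t₁ N.* m) ≡ Z.+ m Z.* (Z.+ p Z.* r Z.+ Z.+ t₁) Z.+ Z.+ t₀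
        point r t₀ t₁ = trans (cong₂ (λ a b → a Z.* r Z.+ b) (ZP.pos-* p m) (trans (ZP.pos-+ t₀ (t₁ N.* m)) (cong (λ z → Z.+ t₀ Z.+ z) (ZP.pos-* t₁ m))))
          (r₁ (Z.+ p) (Z.+ m) r (Z.+ t₀) (Z.+ t₁))
          where
          r₁ : ∀ p m r t₀ t₁ → p Z.* m Z.* r Z.+ (t₀ Z.+ t₁ Z.* m) ≡ m Z.* (p Z.* r Z.+ t₁) Z.+ t₀
          r₁ = ZS.solve-∀

        module _ (n j : ℕ) (w : weight l (suc j) N.≤ suc n) (r : ℤ) (s₀ t₀ : ℕ) (s₀<m : s₀ N.< m) (t₀<m : t₀ N.< m) where

          reduce : ∀ s₁ t₁ → suc j ≼ act (Δ ^ s₀ ⊗ (W ^ s₁ ⊗ (W ⊗ h))) (g n j w) (Z.+ M Z.* r Z.+ Z.+ (t₀ N.+ t₁ N.* m)) →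
            suc j ≼ act (Δ ^ (s₀ N.+ s₁ N.* m) ⊗ (D ⊗ A ^ n)) e (Z.+ M Z.* r Z.+ Z.+ (t₀ N.+ t₁ N.* m))
          reduce s₁ t₁ d = let Z , split = Δ^-split s₀ s₁ in
            ≼-resp (sym (at split (g n j w) (Z.+ M Z.* r Z.+ Z.+ (t₀ N.+ t₁ N.* m))))
              (≼-+ d (≼-act Z (λ i → ≼-P* (≼-g n j w i)) (Z.+ M Z.* r Z.+ Z.+ (t₀ N.+ t₁ N.* m))))

          first-order-maximal : ∀ t₁ → suc j ≼ act (Δ ^ s₀ ⊗ (W ^ p′ ⊗ (W ⊗ h))) (g n j w) (Z.+ M Z.* r Z.+ Z.+ (t₀ N.+ t₁ N.* m))
          first-order-maximal t₁ = ≼-act (Δ ^ s₀) (λ i → ≼-resp (sym (at W^p′ (g n j w) i))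
            (≼-+ (≼-act h (≼-Ag n j w) i) (≼-act (h ⊗ W ⊗ h) (λ i → ≼-P* (≼-g n j w i)) i))) (Z.+ M Z.* r Z.+ Z.+ (t₀ N.+ t₁ N.* m))

          -- The operator next to `Δ^s₀` is a polynomial in `σ m`, so its result is supported on
          -- multiples of `m`. `Δ^-supported` removes the lower digits, and the remaining point is
          -- the centre treated above.
          first-order-doubled : p ≢ 2 → ∀ t₁ → suc j ≼ act (Δ ^ s₀ ⊗ (W ^ (t₁ N.+ t₁) ⊗ (W ⊗ h))) (g n j w) (Z.+ M Z.* r Z.+ Z.+ (t₀ N.+ t₁ N.* m))
          first-order-doubled p≢2 t₁ = subst (suc j ≼_) (sym (begin
              act (Δ ^ s₀ ⊗ (W ^ (t₁ N.+ t₁) ⊗ (W ⊗ h))) (g n j w) (Z.+ M Z.* r Z.+ Z.+ (t₀ N.+ t₁ N.* m))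
                ≡⟨ cong₂ (λ Q i → act (Δ ^ s₀ ⊗ Q) (g n j w) i) W≡ (point r t₀ t₁) ⟩
              act (Δ ^ s₀) v (Z.+ m Z.* y Z.+ Z.+ t₀) ≡⟨ Δ^-supported m v v-supported s₀ t₀ y s₀<m t₀<m ⟩
              sgn t₀ * ℕtoℚ (s₀ C t₀) * v (Z.+ m Z.* y) ≡⟨ cong (λ x → sgn t₀ * ℕtoℚ (s₀ C t₀) * x) (act-sub-0 m Q (g n j w) y) ⟩
              sgn t₀ * ℕtoℚ (s₀ C t₀) * act Q (g′ n j w) y ∎))
            (≼-*ʳ (int-* (int-sgn t₀) (int-ℕ (s₀ C t₀))) (centred n j w p≢2 t₁ r))
            where
            open ≡-Reasoning
            y = Z.+ p Z.* r Z.+ Z.+ t₁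
            Q = Δ ^ (t₁ N.+ t₁) ⊗ (Δ ⊗ h₀)
            v = act (sub m Q) (g n j w)
            W≡ : W ^ (t₁ N.+ t₁) ⊗ (W ⊗ h) ≡ sub m Q
            W≡ = cong₂ _⊗_ (∇σ^-sub m (t₁ N.+ t₁)) (cong (λ k → ∇ (σ k) ⊗ h) (sym (NP.*-identityʳ m)))
            v-supported : SupportedOn m v
            v-supported = supported-sub m Q λ i m∤i → g-supported n j w i λ (z , eq) → m∤i (Z.+ p Z.* z ,
              trans eq (trans (cong (Z._* z) (trans (ZP.pos-* p m) (ZP.*-comm (Z.+ p) (Z.+ m)))) (ZP.*-assoc (Z.+ m) (Z.+ p) z)))

        first-order : ∀ j n s₀ s₁ t₀ t₁ r → s₀ N.< m → t₀ N.< m → weight l j N.≤ suc n → Negligible j n s₁ t₁ →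
          suc j ≼ ℕtoℚ (suc n) * (P * act (Δ ^ (s₀ N.+ s₁ N.* m) ⊗ (D ⊗ A ^ n)) e (Z.+ M Z.* r Z.+ Z.+ (t₀ N.+ t₁ N.* m)))
        -- For `j = 0` the explicit factor `p` is enough.
        first-order zero n s₀ s₁ t₀ t₁ r _ _ _ _ = ≼-*ʳ (int-ℕ (suc n)) (≼-P*
          (≼-act (Δ ^ (s₀ N.+ s₁ N.* m) ⊗ (D ⊗ A ^ n)) (≼-fleck q l) (Z.+ M Z.* r Z.+ Z.+ (t₀ N.+ t₁ N.* m))))
        first-order (suc j) n s₀ s₁ t₀ t₁ r s₀<m t₀<m w (p∣n d) = ≼-* (≼-ℕ d) (≼-P* (≼-act (Δ ^ (s₀ N.+ s₁ N.* m) ⊗ D) (≼-g n j w) (Z.+ M Z.* r Z.+ Z.+ (t₀ N.+ t₁ N.* m))))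
        first-order (suc j) n s₀ s₁ t₀ t₁ r s₀<m t₀<m w (surplus w′) = ≼-*ʳ (int-ℕ (suc n)) (≼-P* (≼-act (Δ ^ (s₀ N.+ s₁ N.* m) ⊗ D) (≼-A^ M l (suc j) n w′) (Z.+ M Z.* r Z.+ Z.+ (t₀ N.+ t₁ N.* m))))
        first-order (suc j) n s₀ .(t₁ N.+ t₁) t₀ t₁ r s₀<m t₀<m w (doubled p≢2) = ≼-*ʳ (int-ℕ (suc n)) (≼-P*
          (reduce n j w r s₀ t₀ s₀<m t₀<m (t₁ N.+ t₁) t₁ (first-order-doubled n j w r s₀ t₀ s₀<m t₀<m p≢2 t₁)))
        first-order (suc j) n s₀ .p′ t₀ t₁ r s₀<m t₀<m w maximal = ≼-*ʳ (int-ℕ (suc n)) (≼-P*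
          (reduce n j w r s₀ t₀ s₀<m t₀<m p′ t₁ (first-order-maximal n j w r s₀ t₀ s₀<m t₀<m t₁)))

        Δ^[Mn+s] : ∀ n s → Δ ^ (M N.* suc n N.+ s) ≈ Δ ^ s ⊗ A ^ suc n ⊕ κℕ (suc n) ⊗ (κℕ p ⊗ (Δ ^ s ⊗ (D ⊗ A ^ n))) ⊕ Δ ^ s ⊗ (B ^ 0 ⊗ remainder A (κℕ p) D n)
        Δ^[Mn+s] n s = begin
          Δ ^ (M N.* suc n N.+ s) ≈⟨ ^-homo-* Δ (M N.* suc n) s ⟩
          Δ ^ (M N.* suc n) ⊗ Δ ^ s ≈⟨ *-cong (≈-trans (≈-sym (^-assocʳ Δ M (suc n))) (≈-trans (^-congˡ (suc n) (proj₂ lift)) (expansion A (κℕ p) D n))) (≈-refl {Δ ^ s}) ⟩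
          (A ^ suc n ⊕ κℕ (suc n) ⊗ (κℕ p ⊗ (D ⊗ A ^ n)) ⊕ remainder A (κℕ p) D n) ⊗ Δ ^ s
            ≈⟨ solve 7 (λ x y k p d z R → (x :+ k :* (p :* (d :* z)) :+ R) :* y := y :* x :+ k :* (p :* (y :* (d :* z))) :+ y :* (con (Z.+ 1) :* R))
                ≈-refl (A ^ suc n) (Δ ^ s) (κℕ (suc n)) (κℕ p) D (A ^ n) (remainder A (κℕ p) D n) ⟩
          Δ ^ s ⊗ A ^ suc n ⊕ κℕ (suc n) ⊗ (κℕ p ⊗ (Δ ^ s ⊗ (D ⊗ A ^ n))) ⊕ Δ ^ s ⊗ (B ^ 0 ⊗ remainder A (κℕ p) D n) ∎
          where open import Relation.Binary.Reasoning.Setoid Op-setoid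

        -- `A ^ n` keeps the support of `e` on the multiples of `M`, so `Δ^-supported` evaluates
        -- `Δ ^ s`. Rescaling by `M` then turns the modulus `q` into `p`.
        main-term : ∀ n s t r → s N.< M → t N.< M →
          act (Δ ^ s ⊗ A ^ n) e (Z.+ M Z.* r Z.+ Z.+ t) ≡ sgn t * ℕtoℚ (s C t) * act (Δ ^ n) (fleck p l) r
        main-term n s t r s<M t<M = begin
          act (Δ ^ s) (act (A ^ n) e) x ≡⟨ cong (λ Q → act (Δ ^ s) (act Q e) x) (∇σ^-sub M n) ⟩
          act (Δ ^ s) v x ≡⟨ Δ^-supported M v (supported-sub M (Δ ^ n) e-supported) s t r s<M t<M ⟩
          sgn t * ℕtoℚ (s C t) * v (Z.+ M Z.* r) ≡⟨ cong (λ y → sgn t * ℕtoℚ (s C t) * y) (trans (act-sub-0 M (Δ ^ n) e r)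
              (act-cong (Δ ^ n) (λ i → trans (cong (λ k → fleck k l (Z.+ M Z.* i)) (NP.*-comm p M)) (fleck-scale M p l i)) r)) ⟩
          sgn t * ℕtoℚ (s C t) * act (Δ ^ n) (fleck p l) r ∎
          where
          open ≡-Reasoning
          x = Z.+ M Z.* r Z.+ Z.+ t
          v = act (sub M (Δ ^ n)) e

      lucas-decomposed : ∀ j n s₀ s₁ t₀ t₁ r → s₀ N.< m → t₀ N.< m → s₀ N.+ s₁ N.* m N.< M → t₀ N.+ t₁ N.* m N.< M →
        weight l j N.≤ suc n → Negligible j n s₁ t₁ →
        suc j ≼ act (Δ ^ (M N.* suc n N.+ (s₀ N.+ s₁ N.* m))) (fleck (p N.* M) l) (Z.+ M Z.* r Z.+ Z.+ (t₀ N.+ t₁ N.* m))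
          - sgn (t₀ N.+ t₁ N.* m) * ℕtoℚ ((s₀ N.+ s₁ N.* m) C (t₀ N.+ t₁ N.* m)) * act (Δ ^ suc n) (fleck p l) r
      lucas-decomposed j n s₀ s₁ t₀ t₁ r s₀<m t₀<m s<M t<M w ne = subst (suc j ≼_) (begin
          T₂ + T₃ ≡⟨ r₁ (act (Δ ^ s ⊗ A ^ suc n) e x) T₂ T₃ ⟩
          act (Δ ^ s ⊗ A ^ suc n) e x + T₂ + T₃ - act (Δ ^ s ⊗ A ^ suc n) e x
            ≡⟨ cong₂ _-_ (sym (at (Δ^[Mn+s] n s) e x)) (main-term (suc n) s t r s<M t<M) ⟩
          act (Δ ^ (M N.* suc n N.+ s)) e x - sgn t * ℕtoℚ (s C t) * act (Δ ^ suc n) (fleck p l) r ∎)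
        (≼-+ (first-order j n s₀ s₁ t₀ t₁ r s₀<m t₀<m w ne)
          (≼-act (Δ ^ s) (≼-remainder j n 0 (subst (weight l j N.≤_) (sym (NP.+-identityʳ (suc n))) w)) x))
        where
        open ≡-Reasoning
        s = s₀ N.+ s₁ N.* m
        t = t₀ N.+ t₁ N.* m
        x = Z.+ M Z.* r Z.+ Z.+ t
        T₂ = ℕtoℚ (suc n) * (P * act (Δ ^ s ⊗ (D ⊗ A ^ n)) e x)
        T₃ = act (Δ ^ s ⊗ (B ^ 0 ⊗ remainder A (κℕ p) D n)) e x
        r₁ : ∀ a b c → b + c ≡ a + b + c - a
        r₁ = solve-∀ ℚ-ring

      lucas : ∀ j n s t r → s N.< M → t N.< M → weight l j N.≤ suc n → Negligible j n (s N./ m) (t N./ m) →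
        suc j ≼ act (Δ ^ (M N.* suc n N.+ s)) (fleck (p N.* M) l) (Z.+ M Z.* r Z.+ Z.+ t)
          - sgn t * ℕtoℚ (s C t) * act (Δ ^ suc n) (fleck p l) r
      lucas j n s t r s<M t<M w ne = subst₂ (λ s t → suc j ≼ act (Δ ^ (M N.* suc n N.+ s)) (fleck (p N.* M) l) (Z.+ M Z.* r Z.+ Z.+ t)
          - sgn t * ℕtoℚ (s C t) * act (Δ ^ suc n) (fleck p l) r) (sym s≡) (sym t≡)
        (lucas-decomposed j n (s N.% m) (s N./ m) (t N.% m) (t N./ m) r (DM.m%n<n s m) (DM.m%n<n t m)
          (subst (N._< M) s≡ s<M) (subst (N._< M) t≡ t<M) w ne)
        where
        s≡ = DM.m≡m%n+[m/n]*n s m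
        t≡ = DM.m≡m%n+[m/n]*n t m

-- Exponents, signs and the final congruence

module MainCongruence (p : ℕ) (p-prime : Prime p) where

  open Rationals
  open PowerSeries
  open Operators
  open FleckFunction
  open Valuation p p-prime
  open Weights p p-prime
  open Coefficients p p-prime
  open Fermat p p-prime
  open PrimeModulus p p-prime
  open Lucas p p-prime
  open import Data.Nat using (_!)
  import Data.Nat.Properties as NP
  import Data.Nat.Divisibility as ND
  import Data.Nat.DivMod as DM
  open import Data.Nat.Combinatorics using (_C_)
  open import Data.Nat.Coprimality as Coprime using (Coprime; coprime?)
  open import Data.Nat.Primality using (prime⇒irreducible)
  import Data.Nat.Tactic.RingSolver as NS
  open import Data.Integer as Z using (ℤ)
  import Data.Integer.Properties as ZP
  import Data.Integer.Divisibility as ZD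
  import Data.Integer.Tactic.RingSolver as ZS
  open import Data.List using ([]; _∷_; length; filter; applyUpTo)
  open import Data.List.Properties using (applyUpTo-∷ʳ; filter-++; filter-accept; filter-reject; length-++)
  open import Data.Rational using (ℚ; 0ℚ; 1ℚ; _+_; _*_; _-_; -_)
  import Data.Rational.Properties as QP
  open import Data.Product using (_×_; _,_; proj₁; proj₂)
  open import Data.Sum using (_⊎_; inj₁; inj₂)
  open import Data.Empty using (⊥-elim)
  open import Relation.Nullary using (¬_; Dec; yes; no)
  open import Relation.Binary.PropositionalEquality
  open import Tactic.RingSolver using (solve-∀)

  private
    count : ℕ → ℕ → ℕ
    count N n = length (filter (λ k → coprime? k N) (applyUpTo suc n))

    count-suc : ∀ N n → count N (suc n) ≡ count N n N.+ length (filter (λ k → coprime? k N) (suc n ∷ []))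
    count-suc N n = trans (cong (λ xs → length (filter (λ k → coprime? k N) xs)) (sym (applyUpTo-∷ʳ suc n)))
      (trans (cong length (filter-++ (λ k → coprime? k N) (applyUpTo suc n) (suc n ∷ []))) (length-++ (filter (λ k → coprime? k N) (applyUpTo suc n))))

    count-coprime : ∀ N n → Coprime (suc n) N → count N (suc n) ≡ suc (count N n)
    count-coprime N n c = trans (count-suc N n) (trans (cong (count N n N.+_) one) (NP.+-comm (count N n) 1))
      where
      one : length (filter (λ k → coprime? k N) (suc n ∷ [])) ≡ 1
      one = cong length (filter-accept (λ k → coprime? k N) {suc n} {[]} c)

    count-¬coprime : ∀ N n → ¬ Coprime (suc n) N → count N (suc n) ≡ count N n
    count-¬coprime N n ¬c = trans (count-suc N n) (trans (cong (count N n N.+_) none) (NP.+-identityʳ (count N n)))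
      where
      none : length (filter (λ k → coprime? k N) (suc n ∷ [])) ≡ 0
      none = cong length (filter-reject (λ k → coprime? k N) {suc n} {[]} ¬c)

    coprime-^ : ∀ k b → ¬ (p ND.∣ k) → Coprime k (p N.^ b)
    coprime-^ k zero p∤k = Coprime.sym (Coprime.1-coprimeTo k)
    coprime-^ k (suc b) p∤k {d} (d∣k , d∣) = coprime-^ k b p∤k (d∣k , Coprime.coprime-divisor d-coprime-p d∣)
      where
      d-coprime-p : Coprime d p
      d-coprime-p (i∣d , i∣p) with prime⇒irreducible p-prime i∣p
      ... | inj₁ i≡1 = i≡1
      ... | inj₂ refl = ⊥-elim (p∤k (ND.∣-trans i∣d d∣k))

    p∤between : ∀ i j → suc j N.≤ p′ → ¬ (p ND.∣ i N.* p N.+ suc j)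
    p∤between i j j<p′ d = NP.<⇒≱ (subst (suc j N.<_) (sym p≡) (N.s≤s j<p′)) (ND.∣⇒≤ (ND.∣m+n∣m⇒∣n d (ND.n∣m*n i)))

    module _ (b : ℕ) where

      count-row : ∀ i j → j N.≤ p′ → count (p N.^ suc b) (i N.* p) ≡ i N.* p′ → count (p N.^ suc b) (i N.* p N.+ j) ≡ i N.* p′ N.+ j
      count-row i zero _ e = trans (cong (count (p N.^ suc b)) (NP.+-identityʳ (i N.* p))) (trans e (sym (NP.+-identityʳ (i N.* p′))))
      count-row i (suc j) j<p′ e = trans (cong (count (p N.^ suc b)) (NP.+-suc (i N.* p) j))
        (trans (count-coprime (p N.^ suc b) (i N.* p N.+ j) (coprime-^ (suc (i N.* p N.+ j)) (suc b)
            (subst (λ k → ¬ (p ND.∣ k)) (NP.+-suc (i N.* p) j) (p∤between i j j<p′))))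
          (trans (cong suc (count-row i j (NP.<⇒≤ j<p′) e)) (sym (NP.+-suc (i N.* p′) j))))

      -- Each block of `p` consecutive integers consists of `p - 1` numbers prime to `p`, followed
      -- by one multiple of `p`.
      count-p* : ∀ i → count (p N.^ suc b) (i N.* p) ≡ i N.* p′
      count-p* zero = refl
      count-p* (suc i) = begin
        count (p N.^ suc b) (suc i N.* p) ≡⟨ cong (count (p N.^ suc b)) index ⟩
        count (p N.^ suc b) (suc (i N.* p N.+ p′)) ≡⟨ count-¬coprime (p N.^ suc b) (i N.* p N.+ p′) not-coprime ⟩
        count (p N.^ suc b) (i N.* p N.+ p′) ≡⟨ count-row i p′ NP.≤-refl (count-p* i) ⟩
        i N.* p′ N.+ p′ ≡⟨ NP.+-comm (i N.* p′) p′ ⟩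
        suc i N.* p′ ∎
        where
        open ≡-Reasoning
        index : suc i N.* p ≡ suc (i N.* p N.+ p′)
        index = trans (cong (N._+ i N.* p) p≡) (cong suc (NP.+-comm p′ (i N.* p)))
        not-coprime : ¬ Coprime (suc (i N.* p N.+ p′)) (p N.^ suc b)
        not-coprime c = NP.<-irrefl (sym (c (subst (p ND.∣_) index (ND.n∣m*n (suc i)) , ND.m∣m*n (p N.^ b)))) 1<p

  totient-p^ : ∀ b → totient (p N.^ suc b) ≡ p N.^ b N.* p′
  totient-p^ b = trans (cong (count (p N.^ suc b)) (NP.*-comm p (p N.^ b))) (count-p* b (p N.^ b))

  -- The numerator is `M (n - l - 1 - l (p - 1)) + s`, and `s < M` is too small to affect the floor.
  -- This is the floor of `(n - l - 1)/(p - 1)` lowered by `l`.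
  fleckExp-p^ : ∀ b l n s k ρ → s N.< p N.^ b → ρ N.< p′ →
    Z.+ n Z.- Z.+ l Z.- Z.1ℤ ≡ Z.+ ρ Z.+ k Z.* Z.+ p′ →
    fleckExp p (suc b) l (p N.^ b N.* n N.+ s) ≡ k Z.- Z.+ l
  fleckExp-p^ b l n s k ρ s<M ρ<p′ e = trans (cong (fdiv x) (totient-p^ b))
      (proj₁ (divMod-unique (M N.* p′) x (M N.* ρ N.+ s) (k Z.- Z.+ l) small decomposition))
    where
    M = p N.^ b
    x = Z.+ (M N.* n N.+ s) Z.- Z.+ (l N.* p N.^ suc b) Z.- Z.+ M
    small : M N.* ρ N.+ s N.< M N.* p′
    small = begin-strict
      M N.* ρ N.+ s <⟨ NP.+-monoʳ-< (M N.* ρ) s<M ⟩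
      M N.* ρ N.+ M ≡⟨ NP.+-comm (M N.* ρ) M ⟩
      M N.+ M N.* ρ ≡⟨ NP.*-suc M ρ ⟨
      M N.* suc ρ ≤⟨ NP.*-monoʳ-≤ M ρ<p′ ⟩
      M N.* p′ ∎
      where open NP.≤-Reasoning
    r₁ : ∀ M n s l q → M Z.* n Z.+ s Z.- l Z.* ((Z.1ℤ Z.+ q) Z.* M) Z.- M ≡ M Z.* (n Z.- l Z.- Z.1ℤ) Z.+ s Z.- l Z.* q Z.* M
    r₁ = ZS.solve-∀
    r₂ : ∀ M s l q ρ k → M Z.* (ρ Z.+ k Z.* q) Z.+ s Z.- l Z.* q Z.* M ≡ M Z.* ρ Z.+ s Z.+ (k Z.- l) Z.* (M Z.* q)
    r₂ = ZS.solve-∀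
    decomposition : x ≡ Z.+ (M N.* ρ N.+ s) Z.+ (k Z.- Z.+ l) Z.* Z.+ (M N.* p′)
    decomposition = begin
      Z.+ (M N.* n N.+ s) Z.- Z.+ (l N.* (p N.* M)) Z.- Z.+ M
        ≡⟨ cong₂ (λ a b → a Z.- b Z.- Z.+ M) (trans (ZP.pos-+ (M N.* n) s) (cong (Z._+ Z.+ s) (ZP.pos-* M n)))
            (trans (ZP.pos-* l (p N.* M)) (cong (Z.+ l Z.*_) (trans (ZP.pos-* p M) (cong (λ q → Z.+ q Z.* Z.+ M) p≡)))) ⟩
      Z.+ M Z.* Z.+ n Z.+ Z.+ s Z.- Z.+ l Z.* ((Z.1ℤ Z.+ Z.+ p′) Z.* Z.+ M) Z.- Z.+ M ≡⟨ r₁ (Z.+ M) (Z.+ n) (Z.+ s) (Z.+ l) (Z.+ p′) ⟩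
      Z.+ M Z.* (Z.+ n Z.- Z.+ l Z.- Z.1ℤ) Z.+ Z.+ s Z.- Z.+ l Z.* Z.+ p′ Z.* Z.+ M ≡⟨ cong (λ y → Z.+ M Z.* y Z.+ Z.+ s Z.- Z.+ l Z.* Z.+ p′ Z.* Z.+ M) e ⟩
      Z.+ M Z.* (Z.+ ρ Z.+ k Z.* Z.+ p′) Z.+ Z.+ s Z.- Z.+ l Z.* Z.+ p′ Z.* Z.+ M ≡⟨ r₂ (Z.+ M) (Z.+ s) (Z.+ l) (Z.+ p′) (Z.+ ρ) k ⟩
      Z.+ M Z.* Z.+ ρ Z.+ Z.+ s Z.+ (k Z.- Z.+ l) Z.* (Z.+ M Z.* Z.+ p′)
        ≡⟨ cong₂ (λ a b → a Z.+ (k Z.- Z.+ l) Z.* b) (trans (ZP.pos-+ (M N.* ρ) s) (cong (Z._+ Z.+ s) (ZP.pos-* M ρ))) (ZP.pos-* M p′) ⟨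
      Z.+ (M N.* ρ N.+ s) Z.+ (k Z.- Z.+ l) Z.* Z.+ (M N.* p′) ∎
      where open ≡-Reasoning

  negPowℤ-inverse : ∀ j → negPowℤ p (Z.- Z.+ j) * powℚ (- P) j ≡ 1ℚ
  negPowℤ-inverse zero = QP.*-identityˡ 1ℚ
  negPowℤ-inverse (suc i) = go p refl
    where
    go : ∀ q → q ≡ p → negPowℤ q Z.-[1+ i ] * powℚ (- ℕtoℚ q) (suc i) ≡ 1ℚ
    go zero 0≡p = ⊥-elim (NP.n≮0 (subst (1 N.<_) (sym 0≡p) 1<p))
    go (suc q) _ = begin
      sgn (suc i) * v * powℚ (- ℕtoℚ (suc q)) (suc i) ≡⟨ cong (λ x → sgn (suc i) * v * x) (powℚ-neg (ℕtoℚ (suc q)) (suc i)) ⟩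
      sgn (suc i) * v * (sgn (suc i) * powℚ (ℕtoℚ (suc q)) (suc i)) ≡⟨ r₁ (sgn (suc i)) v (powℚ (ℕtoℚ (suc q)) (suc i)) ⟩
      sgn (suc i) * sgn (suc i) * (v * powℚ (ℕtoℚ (suc q)) (suc i))
        ≡⟨ cong₂ (λ a b → a * b) (sgn² (suc i)) (trans (cong (λ x → v * x) (sym (ℕtoℚ-^ (suc q) (suc i)))) (inv-* (suc q N.^ suc i) {{NP.m^n≢0 (suc q) (suc i)}})) ⟩
      1ℚ * 1ℚ ≡⟨ QP.*-identityˡ 1ℚ ⟩
      1ℚ ∎
      where
      open ≡-Reasoning
      v = inv (suc q N.^ suc i) {{NP.m^n≢0 (suc q) (suc i)}}
      r₁ : ∀ s v x → s * v * (s * x) ≡ s * s * (v * x)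
      r₁ = solve-∀ ℚ-ring

  ≼-negPowℤ : ∀ j {y} → suc j ≼ y → 1 ≼ negPowℤ p (Z.- Z.+ j) * y
  ≼-negPowℤ j (multiple q i refl) = ≼-resp (begin
      P * (sgn j * q) ≡⟨ QP.*-identityˡ (P * (sgn j * q)) ⟨
      1ℚ * (P * (sgn j * q)) ≡⟨ cong (_* (P * (sgn j * q))) (negPowℤ-inverse j) ⟨
      negPowℤ p (Z.- Z.+ j) * powℚ (- P) j * (P * (sgn j * q)) ≡⟨ cong (λ x → negPowℤ p (Z.- Z.+ j) * x * (P * (sgn j * q))) (powℚ-neg P j) ⟩
      negPowℤ p (Z.- Z.+ j) * (sgn j * powℚ P j) * (P * (sgn j * q)) ≡⟨ r₁ (negPowℤ p (Z.- Z.+ j)) (sgn j) (powℚ P j) P q ⟩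
      sgn j * sgn j * (negPowℤ p (Z.- Z.+ j) * (P * powℚ P j * q)) ≡⟨ cong (_* (negPowℤ p (Z.- Z.+ j) * (P * powℚ P j * q))) (sgn² j) ⟩
      1ℚ * (negPowℤ p (Z.- Z.+ j) * (P * powℚ P j * q)) ≡⟨ QP.*-identityˡ (negPowℤ p (Z.- Z.+ j) * (P * powℚ P j * q)) ⟩
      negPowℤ p (Z.- Z.+ j) * (powℚ P (suc j) * q) ∎)
    (≼-P* (≼-int (int-* (int-sgn j) i)))
    where
    open ≡-Reasoning
    r₁ : ∀ N s x P q → N * (s * x) * (P * (s * q)) ≡ s * s * (N * (P * x * q))
    r₁ = solve-∀ ℚ-ring

  -- Here `b` stands for a - 1. The exponent `suc b ∸ 2` is left unsimplified to match the
  -- hypothesis of the theorem literally.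
  Hypothesis : (b l n s t : ℕ) → Set
  Hypothesis b l n s t =
    (suc b ≡ 1 ⊎ p ND.∣ n ⊎ ¬ (Z.+ p′ ZD.∣ Z.+ n Z.- Z.+ l Z.- Z.1ℤ))
      ⊎ (s // (p N.^ (suc b N.∸ 2)) ≡ 2 N.* (t // (p N.^ (suc b N.∸ 2))) × p ≢ 2)
      ⊎ (s // (p N.^ (suc b N.∸ 2)) ≡ p′ × t // (p N.^ (suc b N.∸ 2)) ≡ p′)

  private
    //≡/ : ∀ x d .{{_ : N.NonZero d}} → x // d ≡ x N./ d
    //≡/ x (suc d) = refl

  -- For `b = 0` the bounds force `s = t = 0` and both terms agree. Otherwise `lucas` applies once
  -- the hypothesis is translated into `Negligible`.
  reduction : ∀ b l n j ρ s t r → s N.< p N.^ b → t N.< p N.^ b → suc n ≡ weight l j N.+ ρ →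
    Z.+ suc n Z.- Z.+ l Z.- Z.1ℤ ≡ Z.+ ρ Z.+ Z.+ (l N.+ j) Z.* Z.+ p′ → Hypothesis b l (suc n) s t →
    suc j ≼ act (Δ ^ (p N.^ b N.* suc n N.+ s)) (fleck (p N.^ suc b) l) (Z.+ (p N.^ b) Z.* r Z.+ Z.+ t)
      - sgn t * ℕtoℚ (s C t) * act (Δ ^ suc n) (fleck p l) r
  reduction zero l n j ρ zero zero r _ _ _ _ _ = ≼-resp (sym (begin
      act (Δ ^ (1 N.* suc n N.+ 0)) (fleck (p N.* 1) l) (Z.1ℤ Z.* r Z.+ Z.0ℤ) - 1ℚ * 1ℚ * X
        ≡⟨ cong (_- 1ℚ * 1ℚ * X) (trans (cong₂ (λ k q → act (Δ ^ k) (fleck q l) (Z.1ℤ Z.* r Z.+ Z.0ℤ)) (trans (NP.+-identityʳ (1 N.* suc n)) (NP.*-identityˡ (suc n))) (NP.*-identityʳ p))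
            (cong (act (Δ ^ suc n) (fleck p l)) (r₀ r))) ⟩
      X - 1ℚ * 1ℚ * X ≡⟨ r₁ X ⟩
      0ℚ ∎)) ≼-0
    where
    open ≡-Reasoning
    X = act (Δ ^ suc n) (fleck p l) r
    r₀ : ∀ r → Z.1ℤ Z.* r Z.+ Z.0ℤ ≡ r
    r₀ = ZS.solve-∀
    r₁ : ∀ x → x - 1ℚ * 1ℚ * x ≡ 0ℚ
    r₁ = solve-∀ ℚ-ring
  reduction zero l n j ρ (suc s) t r (N.s≤s ()) _ _ _ _
  reduction zero l n j ρ s (suc t) r _ (N.s≤s ()) _ _ _
  reduction (suc c) l n j ρ s t r s<M t<M n≡ x≡ hyp = lucas c l j n s t r s<M t<M w (negligible hyp)
    where
    instance
      m≢0 : N.NonZero (p N.^ c)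
      m≢0 = NP.m^n≢0 p c
    w : weight l j N.≤ suc n
    w = subst (weight l j N.≤_) (sym n≡) (NP.m≤m+n (weight l j) ρ)
    -- `ρ` is the weight left over by `suc n`. It is zero only if `p - 1` divides `n - l - 1`;
    -- otherwise one `A` can be given up without losing a power of `p`.
    ρ≢0 : ¬ (Z.+ p′ ZD.∣ Z.+ suc n Z.- Z.+ l Z.- Z.1ℤ) → ∀ ρ′ → ρ ≡ ρ′ → weight l j N.≤ n
    ρ≢0 ∤ zero refl = ⊥-elim (∤ (ND.divides (l N.+ j) (trans (cong Z.∣_∣ (trans x≡ (ZP.+-identityˡ (Z.+ (l N.+ j) Z.* Z.+ p′)))) (ZP.abs-* (Z.+ (l N.+ j)) (Z.+ p′)))))
    ρ≢0 ∤ (suc ρ′) refl = NP.≤-pred (subst (suc (weight l j) N.≤_) (sym (trans n≡ (NP.+-suc (weight l j) ρ′))) (N.s≤s (NP.m≤m+n (weight l j) ρ′)))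
    negligible : Hypothesis (suc c) l (suc n) s t → Negligible c l j n (s N./ p N.^ c) (t N./ p N.^ c)
    negligible (inj₁ (inj₁ ()))
    negligible (inj₁ (inj₂ (inj₁ d))) = p∣n d
    negligible (inj₁ (inj₂ (inj₂ ∤))) = surplus (ρ≢0 ∤ ρ refl)
    negligible (inj₂ (inj₁ (e , p≢2))) = subst (λ a → Negligible c l j n a (t N./ p N.^ c))
      (sym (trans (sym (//≡/ s (p N.^ c))) (trans e (trans (cong (2 N.*_) (//≡/ t (p N.^ c))) (cong (t N./ p N.^ c N.+_) (NP.+-identityʳ (t N./ p N.^ c))))))) (doubled p≢2)
    negligible (inj₂ (inj₂ (e , _))) = subst (λ a → Negligible c l j n a (t N./ p N.^ c)) (sym (trans (sym (//≡/ s (p N.^ c))) e)) maximal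

  private
    binomial-integral : ∀ z l → Integral (binomℚ (ℤtoℚ z) l)
    binomial-integral z l = let u , e = binomℚ-integer l z in subst Integral (sym e) (int-ℤ u)

    iv-yes : ∀ {l n} → l N.< n → iv (l N.<? n) ≡ 1ℚ
    iv-yes {l} {n} l<n with l N.<? n
    ... | yes _ = refl
    ... | no l≮n = ⊥-elim (l≮n l<n)

    iv-no : ∀ {l n} → ¬ l N.< n → iv (l N.<? n) ≡ 0ℚ
    iv-no {l} {n} l≮n with l N.<? n
    ... | yes l<n = ⊥-elim (l≮n l<n)
    ... | no _ = refl

    instance
      p′≢0 : N.NonZero p′
      p′≢0 = N.>-nonZero 1≤p′

    excess : ℕ → ℕ → ℤ
    excess n l = Z.+ n Z.- Z.+ l Z.- Z.1ℤ

    excess-suc : ∀ l y → excess (suc l N.+ y) l ≡ Z.+ y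
    excess-suc l y = trans (cong (λ z → z Z.- Z.+ l Z.- Z.1ℤ) (ZP.pos-+ (suc l) y)) (r₁ (Z.+ l) (Z.+ y))
      where
      r₁ : ∀ l y → Z.1ℤ Z.+ l Z.+ y Z.- l Z.- Z.1ℤ ≡ y
      r₁ = ZS.solve-∀

    -- When the exponent of p is positive, the binomial coefficient or the bracket on the right vanishes.
    vanishing : ∀ n l i → fdiv (excess n l) p′ Z.- Z.+ l ≡ Z.-[1+ i ] →
      iv (l N.<? n) * binomℚ (ℤtoℚ (fdiv (excess n l) p′)) l ≡ 0ℚ
    vanishing n l i e = go (l N.<? n)
      where
      B = binomℚ (ℤtoℚ (fdiv (excess n l) p′)) l
      go : Dec (l N.< n) → iv (l N.<? n) * B ≡ 0ℚ
      go (no l≮n) = trans (cong (_* B) (iv-no l≮n)) (QP.*-zeroˡ B)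
      go (yes l<n) = trans (cong (iv (l N.<? n) *_) (trans (cong (λ k → binomℚ (ℤtoℚ k) l) k≡) (binomℚ-<≡0 K l (NP.≰⇒> K≱l)))) (QP.*-zeroʳ (iv (l N.<? n)))
        where
        y = n N.∸ suc l
        K = y N./ p′
        k≡ : fdiv (excess n l) p′ ≡ Z.+ K
        k≡ = proj₁ (divMod-unique p′ (excess n l) (y N.% p′) (Z.+ K) (DM.m%n<n y p′)
          (trans (cong (λ m → excess m l) (sym (NP.m+[n∸m]≡n l<n))) (trans (excess-suc l y)
            (trans (cong Z.+_ (DM.m≡m%n+[m/n]*n y p′)) (trans (ZP.pos-+ (y N.% p′) (K N.* p′)) (cong (λ z → Z.+ (y N.% p′) Z.+ z) (ZP.pos-* K p′)))))))
        K≱l : ¬ l N.≤ K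
        K≱l l≤K with () ← trans (sym (trans (cong (λ k → k Z.- Z.+ l) k≡) (trans (ZP.m-n≡m⊖n K l) (ZP.⊖-≥ l≤K)))) e

  module _ (b l n s t m : ℕ) (r : ℤ) (s<M : s N.< p N.^ b) (t<M : t N.< p N.^ b) (m+n : p ND.∣ m N.+ n) (hyp : Hypothesis b l n s t) where

    M = p N.^ b
    x = excess n l
    k = fdiv x p′
    ρ = fmod x p′
    -- As `n - l` is congruent to `ρ + 1` modulo `p - 1`, `suc ρ` is `(n-l)_*` and `ν` is `(n-l)^*`.
    ν = p′ N.∸ suc ρ
    S = fleckSum p (suc b) l (M N.* n N.+ s) (Z.+ M Z.* r Z.+ Z.+ t)
    Bn = binomℚ (ℤtoℚ k) l
    c = ℕtoℚ (s C t)
    -- The exponent `l + t + 1` has the parity of `l + t - 1` and is always a natural number.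
    lhs = sgn (l N.+ t N.+ 1) * F p (suc b) l (M N.* n N.+ s) (Z.+ M Z.* r Z.+ Z.+ t)
    rhs = iv (l N.<? n) * c * Bn * ℕtoℚ (lowStar p (Z.+ n Z.- Z.+ l) !) * bernoulliPoly m (upStar p (Z.+ n Z.- Z.+ l)) (ℤtoℚ (Z.- r))

    ρ<p′ : ρ N.< p′
    ρ<p′ = proj₂ (divMod-spec p′ x)

    x≡ : x ≡ Z.+ ρ Z.+ k Z.* Z.+ p′
    x≡ = proj₁ (divMod-spec p′ x)

    exponent : fleckExp p (suc b) l (M N.* n N.+ s) ≡ k Z.- Z.+ l
    exponent = fleckExp-p^ b l n s k ρ s<M ρ<p′ x≡

    S≡ : S ≡ act (Δ ^ (M N.* n N.+ s)) (fleck (p N.^ suc b) l) (Z.+ M Z.* r Z.+ Z.+ t)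
    S≡ = fleckSum≡act p (suc b) l (M N.* n N.+ s) (Z.+ M Z.* r Z.+ Z.+ t)

    -- The Fleck quotient is then a positive power of `-p` times an integral sum, so it vanishes
    -- modulo `p`, and `vanishing` makes the right side zero.
    low-excess : ∀ i → k Z.- Z.+ l ≡ Z.-[1+ i ] → 1 ≼ lhs - rhs
    low-excess i e = ≼-- (≼-*ʳ (int-sgn (l N.+ t N.+ 1)) (subst (λ d → 1 ≼ negPowℤ p (Z.- d) * S) (sym (trans exponent e))
        (≼-*ˡ (≼-weaken (N.s≤s N.z≤n) (≼-[-P]^ (suc i))) integral-S)))
      (≼-resp (sym rhs≡0) ≼-0)
      where
      integral-S : Integral S
      integral-S = subst Integral (sym S≡) (≼⇒integral (≼-act (Δ ^ (M N.* n N.+ s)) (≼-fleck (p N.^ suc b) {{NP.m^n≢0 p (suc b)}} l) (Z.+ M Z.* r Z.+ Z.+ t)))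
      low = ℕtoℚ (lowStar p (Z.+ n Z.- Z.+ l) !)
      bern = bernoulliPoly m (upStar p (Z.+ n Z.- Z.+ l)) (ℤtoℚ (Z.- r))
      r₁ : ∀ i c B u v → i * c * B * u * v ≡ i * B * (c * u * v)
      r₁ = solve-∀ ℚ-ring
      rhs≡0 : rhs ≡ 0ℚ
      rhs≡0 = trans (r₁ (iv (l N.<? n)) c Bn low bern) (trans (cong (_* (c * low * bern)) (vanishing n l i e)) (QP.*-zeroˡ (c * low * bern)))

    module _ (j n′ : ℕ) (e : k Z.- Z.+ l ≡ Z.+ j) (n≡ : n ≡ suc n′) (n′≡ : n′ ≡ l N.+ ρ N.+ (l N.+ j) N.* p′) where

      k≡ : k ≡ Z.+ (l N.+ j)
      k≡ = trans (r₁ k (Z.+ l)) (trans (cong (λ z → Z.+ l Z.+ z) e) (sym (ZP.pos-+ l j)))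
        where
        r₁ : ∀ k l → k ≡ l Z.+ (k Z.- l)
        r₁ = ZS.solve-∀

      ρ+ν : suc ρ N.+ ν ≡ p′
      ρ+ν = NP.m+[n∸m]≡n ρ<p′

      ν<p : suc ν N.< p
      ν<p = subst (suc ν N.<_) (trans (cong suc ρ+ν) (sym p≡)) (N.s≤s (N.s≤s (NP.m≤n+m ν ρ)))

      index : n N.+ ν ≡ l N.+ p′ N.* suc (l N.+ j)
      index = begin
        n N.+ ν ≡⟨ cong (N._+ ν) (trans n≡ (cong suc n′≡)) ⟩
        suc (l N.+ ρ N.+ (l N.+ j) N.* p′) N.+ ν ≡⟨ r₁ l ρ ((l N.+ j) N.* p′) ν ⟩
        l N.+ (suc ρ N.+ ν N.+ (l N.+ j) N.* p′) ≡⟨ cong (λ a → l N.+ (a N.+ (l N.+ j) N.* p′)) ρ+ν ⟩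
        l N.+ (p′ N.+ (l N.+ j) N.* p′) ≡⟨ cong (l N.+_) (NP.*-comm (suc (l N.+ j)) p′) ⟩
        l N.+ p′ N.* suc (l N.+ j) ∎
        where
        open ≡-Reasoning
        r₁ : ∀ l ρ a ν → suc (l N.+ ρ N.+ a) N.+ ν ≡ l N.+ (suc ρ N.+ ν N.+ a)
        r₁ = NS.solve-∀

      n≡weight : suc n′ ≡ weight l j N.+ ρ
      n≡weight = trans (cong suc n′≡) (trans (r₁ l ρ j p′) (cong (λ q → l N.* q N.+ suc (p′ N.* j) N.+ ρ) (sym p≡)))
        where
        r₁ : ∀ l ρ j q → suc (l N.+ ρ N.+ (l N.+ j) N.* q) ≡ l N.* suc q N.+ suc (q N.* j) N.+ ρ
        r₁ = NS.solve-∀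

      upStar≡ : upStar p (Z.+ n Z.- Z.+ l) ≡ ν
      upStar≡ = proj₂ (divMod-unique p′ (Z.- (Z.+ n Z.- Z.+ l)) ν (Z.- k Z.- Z.1ℤ) (subst (ν N.<_) ρ+ν (N.s≤s (NP.m≤n+m ν ρ)))
        (begin
          Z.- (Z.+ n Z.- Z.+ l) ≡⟨ r₁ (Z.+ n) (Z.+ l) ⟩
          Z.- (Z.1ℤ Z.+ x) ≡⟨ cong (λ z → Z.- (Z.1ℤ Z.+ z)) x≡ ⟩
          Z.- (Z.1ℤ Z.+ (Z.+ ρ Z.+ k Z.* Z.+ p′)) ≡⟨ r₂ (Z.+ ρ) (Z.+ ν) k (Z.+ p′) ⟩
          Z.+ ν Z.- (Z.1ℤ Z.+ Z.+ ρ Z.+ Z.+ ν) Z.- k Z.* Z.+ p′ ≡⟨ cong (λ z → Z.+ ν Z.- z Z.- k Z.* Z.+ p′) (trans (sym (ZP.pos-+ (suc ρ) ν)) (cong Z.+_ ρ+ν)) ⟩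
          Z.+ ν Z.- Z.+ p′ Z.- k Z.* Z.+ p′ ≡⟨ r₃ (Z.+ ν) (Z.+ p′) k ⟩
          Z.+ ν Z.+ (Z.- k Z.- Z.1ℤ) Z.* Z.+ p′ ∎))
        where
        open ≡-Reasoning
        r₁ : ∀ n l → Z.- (n Z.- l) ≡ Z.- (Z.1ℤ Z.+ (n Z.- l Z.- Z.1ℤ))
        r₁ = ZS.solve-∀
        r₂ : ∀ ρ ν k q → Z.- (Z.1ℤ Z.+ (ρ Z.+ k Z.* q)) ≡ ν Z.- (Z.1ℤ Z.+ ρ Z.+ ν) Z.- k Z.* q
        r₂ = ZS.solve-∀
        r₃ : ∀ ν q k → ν Z.- q Z.- k Z.* q ≡ ν Z.+ (Z.- k Z.- Z.1ℤ) Z.* q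
        r₃ = ZS.solve-∀

      Nj = negPowℤ p (Z.- Z.+ j)
      σlt = sgn (l N.+ t N.+ 1)
      X = act (Δ ^ n) (fleck p l) r
      d = coeff n ν r
      lead = leading l j ν
      low = ℕtoℚ (suc ρ !)
      up = ℕtoℚ (ν !)
      β = mulS (expS (ℤtoℚ (Z.- r))) (powS (invS expm1OverX) m) ν

      S-congruence : suc j ≼ S - sgn t * c * (powℚ (- P) j * lead * d)
      S-congruence = ≼-resp (r₁ S (sgn t * c) X (powℚ (- P) j * lead * d))
        (≼-+ (subst₂ (λ S n → suc j ≼ S - sgn t * c * act (Δ ^ n) (fleck p l) r) (trans (cong (λ n → act (Δ ^ (M N.* n N.+ s)) (fleck (p N.^ suc b) l) (Z.+ M Z.* r Z.+ Z.+ t)) (sym n≡)) (sym S≡)) (sym n≡)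
            (reduction b l n′ j ρ s t r s<M t<M n≡weight
              (subst₂ (λ n k → excess n l ≡ Z.+ ρ Z.+ k Z.* Z.+ p′) n≡ k≡ x≡) (subst (λ n → Hypothesis b l n s t) n≡ hyp)))
          (≼-*ʳ (int-* (int-sgn t) (int-ℕ (s C t))) (Δ^-fleck l j ν n r ν<p index)))
        where
        r₁ : ∀ S a X Y → S - a * X + a * (X - Y) ≡ S - a * Y
        r₁ = solve-∀ ℚ-ring

      -- The sign in front of the Fleck quotient cancels those of `l` and `t`, and its last -1 turns
      -- `- ω` into `ω`.
      signs : σlt * (sgn t * (sgn (l N.+ ν) * - ω)) ≡ sgn ν * ω
      signs = begin
        σlt * (sgn t * (sgn (l N.+ ν) * - ω)) ≡⟨ cong₂ (λ a b → a * (sgn t * (b * - ω))) (trans (sgn-+ (l N.+ t) 1) (cong (_* sgn 1) (sgn-+ l t))) (sgn-+ l ν) ⟩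
        sgn l * sgn t * sgn 1 * (sgn t * (sgn l * sgn ν * - ω)) ≡⟨ r₁ (sgn l) (sgn t) (sgn ν) ω ⟩
        sgn l * sgn l * (sgn t * sgn t) * (sgn ν * ω) ≡⟨ cong₂ (λ a b → a * b * (sgn ν * ω)) (sgn² l) (sgn² t) ⟩
        1ℚ * 1ℚ * (sgn ν * ω) ≡⟨ r₂ (sgn ν * ω) ⟩
        sgn ν * ω ∎
        where
        open ≡-Reasoning
        r₁ : ∀ l t ν ω → l * t * (- 1ℚ * 1ℚ) * (t * (l * ν * - ω)) ≡ l * l * (t * t) * (ν * ω)
        r₁ = solve-∀ ℚ-ring
        r₂ : ∀ x → 1ℚ * 1ℚ * x ≡ x
        r₂ = solve-∀ ℚ-ring

      lhs-congruence : 1 ≼ lhs - c * Bn * (sgn ν * ω) * d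
      lhs-congruence = subst (1 ≼_) (begin
          σlt * (Nj * (S - sgn t * c * (powℚ (- P) j * lead * d))) ≡⟨ r₁ σlt Nj S (sgn t) c (powℚ (- P) j) lead d ⟩
          σlt * (Nj * S) - σlt * sgn t * c * (Nj * powℚ (- P) j) * lead * d
            ≡⟨ cong (λ a → σlt * (Nj * S) - σlt * sgn t * c * a * lead * d) (negPowℤ-inverse j) ⟩
          σlt * (Nj * S) - σlt * sgn t * c * 1ℚ * lead * d ≡⟨ r₂ (σlt * (Nj * S)) σlt (sgn t) c (sgn (l N.+ ν) * - ω) (binomℚ (ℕtoℚ (l N.+ j)) l) d ⟩
          σlt * (Nj * S) - c * binomℚ (ℕtoℚ (l N.+ j)) l * (σlt * (sgn t * (sgn (l N.+ ν) * - ω))) * d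
            ≡⟨ cong₂ (λ k a → σlt * (Nj * S) - c * binomℚ (ℤtoℚ k) l * a * d) (sym k≡) signs ⟩
          σlt * (Nj * S) - c * Bn * (sgn ν * ω) * d
            ≡⟨ cong (λ z → σlt * (negPowℤ p (Z.- z) * S) - c * Bn * (sgn ν * ω) * d) (sym (trans exponent e)) ⟩
          lhs - c * Bn * (sgn ν * ω) * d ∎)
        (≼-*ʳ (int-sgn (l N.+ t N.+ 1)) (≼-negPowℤ j S-congruence))
        where
        open ≡-Reasoning
        r₁ : ∀ a N S t c x k d → a * (N * (S - t * c * (x * k * d))) ≡ a * (N * S) - a * t * c * (N * x) * k * d
        r₁ = solve-∀ ℚ-ring
        r₂ : ∀ y a t c k B d → y - a * t * c * 1ℚ * (k * B) * d ≡ y - c * B * (a * (t * k)) * d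
        r₂ = solve-∀ ℚ-ring

      rhs≡ : rhs ≡ c * Bn * low * (up * β)
      rhs≡ = trans (cong₂ (λ i ν → i * c * Bn * low * bernoulliPoly m ν (ℤtoℚ (Z.- r))) (iv-yes l<n) upStar≡) (r₁ c Bn low (up * β))
        where
        l<n : l N.< n
        l<n = subst (l N.<_) (sym (trans n≡ (cong suc n′≡))) (N.s≤s (NP.≤-trans (NP.m≤m+n l ρ) (NP.m≤m+n (l N.+ ρ) ((l N.+ j) N.* p′))))
        r₁ : ∀ c B u v → 1ℚ * c * B * u * v ≡ c * B * u * v
        r₁ = solve-∀ ℚ-ring

      -- `factorials` replaces the signed `ω` by `(ρ + 1)! ν!`, and `bernoulli-coeff` replaces the
      -- coefficient. The factor `ν!` is the one that makes it a Bernoulli polynomial.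
      rhs-congruence : 1 ≼ c * Bn * (sgn ν * ω) * d - rhs
      rhs-congruence = subst (1 ≼_) (trans (r₁ c Bn (sgn ν * ω) up low d β) (cong (λ z → c * Bn * (sgn ν * ω) * d - z) (sym rhs≡)))
        (≼-*ʳ (int-* (int-ℕ (s C t)) (binomial-integral k l))
          (≼-- (≼-*ˡ (subst (λ a → 1 ≼ sgn ν * ω - up * ℕtoℚ (a !)) (NP.m∸[m∸n]≡n ρ<p′) (factorials ν (NP.m∸n≤m p′ (suc ρ)))) (int-coeff n ν r ν<p))
            (≼-*ʳ (int-* (int-ℕ (ν !)) (int-ℕ (suc ρ !))) (bernoulli-coeff m n ν r m+n ν<p))))
        where
        r₁ : ∀ c B w u v d β → c * B * ((w - u * v) * d - u * v * (β - d)) ≡ c * B * w * d - c * B * v * (u * β)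
        r₁ = solve-∀ ℚ-ring

      high-excess : 1 ≼ lhs - rhs
      high-excess = ≼-resp (r₁ lhs (c * Bn * (sgn ν * ω) * d) rhs) (≼-+ lhs-congruence rhs-congruence)
        where
        r₁ : ∀ a b c → a - b + (b - c) ≡ a - c
        r₁ = solve-∀ ℚ-ring

    congruence : lhs ≡ rhs [modℚ p ]
    congruence = ≼⇒≡[modℚ] {lhs} {rhs} (go (k Z.- Z.+ l) refl)
      where
      go : ∀ z → k Z.- Z.+ l ≡ z → 1 ≼ lhs - rhs
      go Z.-[1+ i ] e = low-excess i e
      -- A nonnegative exponent forces `n = 1 + l + ρ + (l + j)(p - 1)`, so `n` is a successor, as
      -- the expansion of `(A + p D)^n` requires.
      go (Z.+ j) e = high-excess j (l N.+ ρ N.+ (l N.+ j) N.* p′) e (ZP.+-injective (begin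
        Z.+ n ≡⟨ r₁ (Z.+ n) (Z.+ l) ⟩
        Z.1ℤ Z.+ (Z.+ l Z.+ x) ≡⟨ cong (λ z → Z.1ℤ Z.+ (Z.+ l Z.+ z)) x≡ ⟩
        Z.1ℤ Z.+ (Z.+ l Z.+ (Z.+ ρ Z.+ k Z.* Z.+ p′)) ≡⟨ r₂ (Z.+ l) (Z.+ ρ) k (Z.+ p′) ⟩
        Z.1ℤ Z.+ (Z.+ l Z.+ Z.+ ρ Z.+ (Z.+ l Z.+ (k Z.- Z.+ l)) Z.* Z.+ p′)
          ≡⟨ cong (λ z → Z.1ℤ Z.+ (Z.+ l Z.+ Z.+ ρ Z.+ (Z.+ l Z.+ z) Z.* Z.+ p′)) e ⟩
        Z.1ℤ Z.+ (Z.+ l Z.+ Z.+ ρ Z.+ (Z.+ l Z.+ Z.+ j) Z.* Z.+ p′)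
          ≡⟨ cong (λ z → Z.1ℤ Z.+ (Z.+ l Z.+ Z.+ ρ Z.+ z)) (ZP.pos-* (l N.+ j) p′) ⟨
        Z.+ suc (l N.+ ρ N.+ (l N.+ j) N.* p′) ∎)) refl
        where
        open ≡-Reasoning
        r₁ : ∀ n l → n ≡ Z.1ℤ Z.+ (l Z.+ (n Z.- l Z.- Z.1ℤ))
        r₁ = ZS.solve-∀
        r₂ : ∀ l ρ k q → Z.1ℤ Z.+ (l Z.+ (ρ Z.+ k Z.* q)) ≡ Z.1ℤ Z.+ (l Z.+ ρ Z.+ (l Z.+ (k Z.- l)) Z.* q)
        r₂ = ZS.solve-∀

open import Data.Nat using (ℕ; _+_; _*_; _∸_; _^_; _≤_; _<_; _<?_)
open import Data.Nat.Base using (_!)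
open import Data.Nat.Divisibility using (_∣_)
open import Data.Nat.Primality using (Prime)
open import Data.Nat.Combinatorics using (_C_)
open import Data.Integer as Z using (ℤ; +_)
open import Data.Integer.Divisibility as ZD using ()
open import Data.Rational as Q using (ℚ)
open import Data.Sum using (_⊎_)
open import Data.Product using (_×_)
open import Relation.Binary.PropositionalEquality using (_≡_; _≢_)
open import Relation.Nullary using (¬_)

theorem5p1 :
  (p a l n : ℕ) (r : ℤ) (s t m : ℕ) →
  Prime p → 1 ≤ a →
  s < p ^ (a ∸ 1) → t < p ^ (a ∸ 1) →
  p ∣ (m + n) →
  ((a ≡ 1 ⊎ p ∣ n ⊎ ¬ ((+ (p ∸ 1)) ZD.∣ ((+ n) Z.- (+ l) Z.- (+ 1))))
   ⊎ (s // (p ^ (a ∸ 2)) ≡ 2 * (t // (p ^ (a ∸ 2))) × p ≢ 2)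
   ⊎ (s // (p ^ (a ∸ 2)) ≡ p ∸ 1 × t // (p ^ (a ∸ 2)) ≡ p ∸ 1)) →
  (sgn (l + t + 1) Q.* F p a l (p ^ (a ∸ 1) * n + s) ((+ (p ^ (a ∸ 1))) Z.* r Z.+ (+ t)))
    ≡ (iv (l <? n) Q.* ℕtoℚ (s C t)
        Q.* binomℚ (ℤtoℚ (fdiv ((+ n) Z.- (+ l) Z.- (+ 1)) (p ∸ 1))) l
        Q.* ℕtoℚ (lowStar p ((+ n) Z.- (+ l)) !)
        Q.* bernoulliPoly m (upStar p ((+ n) Z.- (+ l))) (ℤtoℚ (Z.- r)))
    [modℚ p ]
theorem5p1 p zero l n r s t m p-prime () s<M t<M m+n hyp
theorem5p1 p (suc b) l n r s t m p-prime _ s<M t<M m+n hyp =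
  MainCongruence.congruence p p-prime b l n s t m r s<M t<M m+n hyp
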